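{- Fix an integer $k\ge1$ and $\alpha\ge 1+1/k$. One can construct an online randomized algorithm $\mathrm{ONL}\in\mathcal{A}^k_\alpha$ and a quantity $\beta$ (independent of the input) such that $\mathbf{E}[\mathrm{ONL}(\sigma)]\le O(k^2\log^2 n)\cdot\mathrm{OFF}(\sigma)+\beta$ for every offline algorithm $\mathrm{OFF}\in\mathcal{A}^k_\alpha$ and every request sequence $\sigma$ with ring demands.
   Context: Online bisection with ring demands: $n$ nodes $v_1,\dots,v_n$ ($n$ even) on a cycle with edges $(v_1,v_2),\dots,(v_n,v_1)$. An algorithm maintains a red/blue coloring of the nodes, starting from a fixed initial coloring with $n/2$ nodes of each color. Each request is a cycle edge; the algorithm pays $1$ if its endpoints have different colors (hit cost), then may recolor nodes at cost $1$ per node. $\mathrm{ALG}(\sigma)$ is the total cost on $\sigma$. A coloring is $\alpha$-balanced if each color is used on at most $\alpha n/2$ nodes; an algorithm is $\alpha$-augmented if after each request's recoloring its coloring is $\alpha$-balanced. The cut-edges of a coloring are the cycle edges whose endpoints have different colors; any even-size set of cycle edges induces a coloring (up to swapping colors) with exactly those cut-edges. Global rebalancing: given a valid set $\mathcal{C}$ of cut-edges inducing a $1$-balanced coloring, a fixed deterministic procedure computes $\mathcal{C}_{2k}\subseteq\mathcal{C}$ with $|\mathcal{C}_{2k}|=\min\{2k,|\mathcal{C}|\}$ inducing a $(1+1/k)$-balanced coloring. For $k\ge1$ and $\alpha\ge1+1/k$, $\mathcal{A}^k_\alpha$ is the class of (online or offline) algorithms that (i) are $\alpha$-augmented, (ii)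 before processing the input replace the initial coloring by the coloring induced by applying the global rebalancing procedure to the cut-edges of the initial coloring, and (iii) at all times have at most $2k$ cut-edges. Expectation is over the algorithm's random bits with the input fixed in advance (oblivious adversary).
   Formalization: The augmentation parameter α ≥ 1+1/k is taken to be a rational number rather than an arbitrary real number. -}

module Defs where

open import Data.Nat as ℕ using (ℕ; zero; suc; _⊓_; NonZero)
open import Data.Nat.DivMod using (_mod_)
open import Data.Integer using (+_)
open import Data.Fin using (Fin; toℕ)
open import Data.Bool using (Bool; true; false; if_then_else_; _xor_)
open import Data.Vec as Vec using (Vec; lookup)
open import Data.Vec.Relation.Unary.All as VAll using ()
open import Data.List using (List; []; _∷_; map; allFin; length)
open import Data.Nat.ListAction using (sum)
open import Data.List.Relation.Unary.All using (All)
open import Data.Product using (Σ; _×_; _,_; proj₁)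
open import Data.Rational as ℚ using (ℚ; 0ℚ; 1ℚ; _/_)
open import Relation.Binary.PropositionalEquality using (_≡_)

ℕtoℚ : ℕ → ℚ
ℕtoℚ m = (+ m) / 1

onePlusInv : (k : ℕ) → .{{NonZero k}} → ℚ
onePlusInv k = (+ (suc k)) / k

-- A coloring of v_1..v_n : true = red, false = blue (node v_{i+1} is index i)
Coloring : ℕ → Set
Coloring n = Vec Bool n

-- successor on the cycle: edge i joins node i and node (i+1 mod n)
next : ∀ {n} → Fin n → Fin n
next {suc m} i = suc (toℕ i) mod (suc m)

differ : Bool → Bool → ℕ
differ a b = if a xor b then 1 else 0

hit : ∀ {n} → Coloring n → Fin n → ℕ
hit c i = differ (lookup c i) (lookup c (next i))

numCuts : ∀ {n} → Coloring n → ℕ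
numCuts {n} c = sum (map (hit c) (allFin n))

hamming : ∀ {n} → Coloring n → Coloring n → ℕ
hamming {n} c d = sum (map (λ i → differ (lookup c i) (lookup d i)) (allFin n))

numRed numBlue : ∀ {n} → Coloring n → ℕ
numRed {n} c = sum (map (λ i → if lookup c i then 1 else 0) (allFin n))
numBlue {n} c = sum (map (λ i → if lookup c i then 0 else 1) (allFin n))

Balanced : ∀ {n} → ℚ → Coloring n → Set
Balanced {n} α c =
  (ℕtoℚ (2 ℕ.* numRed c) ℚ.≤ α ℚ.* ℕtoℚ n) × (ℕtoℚ (2 ℕ.* numBlue c) ℚ.≤ α ℚ.* ℕtoℚ n)

Allowed : ∀ {n} → ℕ → ℚ → Coloring n → Set
Allowed k α c = Balanced α c × (numCuts c ℕ.≤ 2 ℕ.* k)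

-- Specification of the global rebalancing procedure (acting on colorings; its
-- output coloring determines the chosen cut-edge set, the color-swap
-- convention being absorbed into the procedure).
RebalanceSpec : ∀ {n} (k : ℕ) → .{{NonZero k}} → (Coloring n → Coloring n) → Set
RebalanceSpec {n} k reb =
  (c : Coloring n) → Balanced 1ℚ c →
    ((i : Fin n) → hit (reb c) i ≡ 1 → hit c i ≡ 1)
    × (numCuts (reb c) ≡ (2 ℕ.* k) ⊓ numCuts c)
    × Balanced (onePlusInv k) (reb c)

sumℚ : List ℚ → ℚ
sumℚ [] = 0ℚ
sumℚ (x ∷ xs) = x ℚ.+ sumℚ xs

record Dist (A : Set) : Set where
  field
    outcomes : List (ℚ × A)
    nonneg   : All (λ o → 0ℚ ℚ.≤ proj₁ o) outcomes
    total    : sumℚ (map proj₁ outcomes) ≡ 1ℚ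

-- Online randomized algorithms: an arbitrary (possibly hidden) internal
-- state, a random initial state, and a random transition on each request
-- that may depend only on the current state and the current request.

record OnlineAlg (n : ℕ) : Set₁ where
  field
    State : Set
    color : State → Coloring n
    start : Dist State
    step  : State → Fin n → Dist State

module _ {n : ℕ} (A : OnlineAlg n) where
  open OnlineAlg A

  mutual
    expFrom : State → List (Fin n) → ℚ
    expFrom s [] = 0ℚ
    expFrom s (r ∷ σ) = ℕtoℚ (hit (color s) r) ℚ.+ expSucc s (Dist.outcomes (step s r)) σ

    expSucc : State → List (ℚ × State) → List (Fin n) → ℚ
    expSucc s [] σ = 0ℚ
    expSucc s ((p , s') ∷ xs) σ =
      p ℚ.* (ℕtoℚ (hamming (color s) (color s')) ℚ.+ expFrom s' σ) ℚ.+ expSucc s xs σ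

  expStart : Coloring n → List (ℚ × State) → List (Fin n) → ℚ
  expStart init [] σ = 0ℚ
  expStart init ((p , s₀) ∷ xs) σ =
    p ℚ.* (ℕtoℚ (hamming init (color s₀)) ℚ.+ expFrom s₀ σ) ℚ.+ expStart init xs σ

  expCost : Coloring n → List (Fin n) → ℚ
  expCost init σ = expStart init (Dist.outcomes start) σ

  InClass : ℕ → ℚ → (Coloring n → Coloring n) → Coloring n → Set
  InClass k α reb init =
    ((s : State) → Allowed k α (color s))
    × All (λ o → color (Data.Product.proj₂ o) ≡ reb init) (Dist.outcomes start)

-- Offline algorithms: on σ, a sequence of colorings (one after each request)

offCostFrom : ∀ {n} → Coloring n → (σ : List (Fin n)) → Vec (Coloring n) (length σ) → ℕ
offCostFrom c [] Vec.[] = 0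
offCostFrom c (r ∷ σ) (c' Vec.∷ cs) = hit c r ℕ.+ hamming c c' ℕ.+ offCostFrom c' σ cs

offCost : ∀ {n} → Coloring n → Coloring n → (σ : List (Fin n)) → Vec (Coloring n) (length σ) → ℕ
offCost init c₀ σ cs = hamming init c₀ ℕ.+ offCostFrom c₀ σ cs

OffValid : ∀ {n m} → ℕ → ℚ → Vec (Coloring n) m → Set
OffValid k α cs = VAll.All (Allowed k α) cs

{-# OPTIONS --safe #-}

-- For an offset r, call two colorings equivalent at level j if they agree on the nodes
-- congruent to r modulo 16^i for all i ≥ j.  Colorings with at most 2k cuts that agree at level j are
-- O(k 16^j) apart, while for random r two colorings at distance d disagree at level j with probability
-- at most d / 16^j; so a random tree metric dominates the Hamming distance and stretches it by
-- O(k log n) on average.  On the tree the algorithm sits at the minimiser of w + noise, where w is the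
-- (offline) work function and the noise of a state is a sum of independent truncated exponentials, one
-- for each cell containing it.  The noise is smaller than the tree distance, so a state whose work
-- function is dictated by another state is never occupied and hits are paid for by the growth of the
-- minimum.  When w grows by one unit at the current state, memorylessness bounds the probability of
-- leaving its level-j cell by O(log(size of parent / size of cell)) / diameter, up to the truncation
-- error, which is amortised by a potential.  These logarithms telescope along a path, and there are
-- n^O(k) states, so moving costs O(k log n) times the growth of the minimum.

module Submission where

open import Defs
open import Data.Bool using (Bool; true; false)
open import Data.Bool.Properties using (T-irrelevant)
open import Data.Fin using (Fin; zero; suc; toℕ; fromℕ<; inject₁; combine; remQuot)
open import Data.Fin.Properties using (fromℕ<-cong; remQuot-combine; toℕ-fromℕ<; toℕ-injective; toℕ-inject₁; toℕ<n)
import Data.Integer as ℤ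
import Data.Integer.Properties as ℤ
open import Data.List using (List; []; _∷_; _++_; allFin; concatMap; downFrom; filter; length; map)
open import Data.List.Extrema.Nat using (argmin; argmin-sel; f[argmin]≤f[xs])
open import Data.List.Membership.Propositional using (_∈_; find; lose)
open import Data.List.Membership.Propositional.Properties
  using (∈-allFin; ∈-concatMap⁺; ∈-concatMap⁻; ∈-downFrom⁺; ∈-downFrom⁻; ∈-filter⁺; ∈-filter⁻; ∈-map⁺; ∈-map⁻; ∈-++⁺ˡ; ∈-++⁺ʳ)
open import Data.List.Properties using (length-downFrom; map-tabulate)
import Data.List.Properties as List
open import Data.List.Relation.Unary.All as All using (All; []; _∷_)
import Data.List.Relation.Unary.All.Properties as All
open import Data.List.Relation.Unary.Any using (Any; any?; here; there)
open import Data.Nat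
import Data.Nat as ℕ
open import Data.Nat.DivMod
open import Data.Nat.Divisibility using (_∣_; divides; n∣m*n)
open import Data.Nat.Induction using (<-rec)
open import Data.Nat.ListAction using (product; sum)
open import Data.Nat.ListAction.Properties using (product≢0; ∈⇒∣product)
open import Data.Nat.Logarithm
open import Data.Nat.Properties
import Data.Nat.Properties as ℕ
open import Data.Nat.Tactic.RingSolver using (solve-∀)
open import Data.Product using (Σ; ∃; _×_; _,_; proj₁; proj₂)
open import Data.Rational as ℚ using (ℚ; 0ℚ; 1ℚ; toℚᵘ)
import Data.Rational.Properties as ℚ
open import Data.Rational.Unnormalised as ℚᵘ using (_≃_; mkℚᵘ; *≡*; *≤*)
import Data.Rational.Unnormalised.Properties as ℚᵘ
open import Data.Sum using (inj₁; inj₂)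
open import Data.Vec as Vec using (Vec; []; _∷_; lookup; _[_]≔_)
open import Data.Vec.Properties using (lookup∘update; lookup∘update′)
open import Data.Vec.Relation.Unary.All using ([]; _∷_)
open import Function using (_∘_; id)
open import Relation.Binary using (tri<; tri≈; tri>)
open import Relation.Binary.PropositionalEquality
open import Relation.Nullary using (¬_; Dec; yes; no; contradiction)
open import Relation.Nullary.Decidable using (True; toWitness; fromWitness; _×-dec_)
open import Relation.Unary using (Decidable)

-- The noise of a cell must stay below the tree distance, hence the truncation, and truncation
-- breaks memorylessness: an exit near the truncated end (noise 0, because the weights grow with the
-- noise) is not matched by a rise of the global minimum. Such an exit does force the minimum over
-- the abandoned cell to rise. The potential weighs child cells by their share of the states of the
-- parent cell, so this rise earns about |cell| / |parent|, and the truncation error has to stay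
-- below that. It is exponentially small in the depth of the noise (its range in units of doubling),
-- so depth O(1 + log(|parent| / |cell|)) suffices; this choice is what makes the logarithms
-- telescope.
--
-- Given the offset, the work function does not depend on the seed, and the requests are fixed in
-- advance. Each unit of growth is therefore analysed under the same law of the seed, and nothing
-- has to be independent between steps. Costs are scaled by `K` to leave room for integral noise,
-- expectations are unnormalised sums of naturals, and rationals enter only when the initial
-- distribution is normalised.

private variable
  I I′ : Set

-- Finite sums and indicators of decidable propositions.

∑ : List I → (I → ℕ) → ℕ
∑ xs f = sum (map f xs)

∑-mono : ∀ (xs : List I) {f g : I → ℕ} → (∀ {x} → x ∈ xs → f x ≤ g x) → ∑ xs f ≤ ∑ xs g
∑-mono []       h = z≤n
∑-mono (x ∷ xs) h = +-mono-≤ (h (here refl)) (∑-mono xs (h ∘ there))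

∑-mono-< : ∀ {xs : List I} {f g : I → ℕ} {z} → z ∈ xs → (∀ {x} → x ∈ xs → f x ≤ g x) → f z < g z →
           ∑ xs f < ∑ xs g
∑-mono-< {xs = x ∷ xs} (here refl) h z< = +-mono-<-≤ z< (∑-mono xs (h ∘ there))
∑-mono-< {xs = x ∷ xs} (there p)   h z< = +-mono-≤-< (h (here refl)) (∑-mono-< p (h ∘ there) z<)

∑-cong : ∀ (xs : List I) {f g : I → ℕ} → (∀ {x} → x ∈ xs → f x ≡ g x) → ∑ xs f ≡ ∑ xs g
∑-cong []       h = refl
∑-cong (x ∷ xs) h = cong₂ _+_ (h (here refl)) (∑-cong xs (h ∘ there))

∑-distrib-+ : ∀ (xs : List I) (f g : I → ℕ) → ∑ xs (λ x → f x + g x) ≡ ∑ xs f + ∑ xs g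
∑-distrib-+ []       f g = refl
∑-distrib-+ (x ∷ xs) f g =
  trans (cong (f x + g x +_) (∑-distrib-+ xs f g)) (interchange (f x) (g x) (∑ xs f) (∑ xs g))
  where
  interchange : ∀ a b c d → a + b + (c + d) ≡ a + c + (b + d)
  interchange = solve-∀

∑-*ˡ : ∀ (xs : List I) c (f : I → ℕ) → ∑ xs (λ x → c * f x) ≡ c * ∑ xs f
∑-*ˡ []       c f = sym (*-zeroʳ c)
∑-*ˡ (x ∷ xs) c f = trans (cong (c * f x +_) (∑-*ˡ xs c f)) (sym (*-distribˡ-+ c (f x) _))

∑-const : ∀ (xs : List I) c → ∑ xs (λ _ → c) ≡ length xs * c
∑-const []       c = refl
∑-const (x ∷ xs) c = cong (c +_) (∑-const xs c)

∑-zero : ∀ (xs : List I) → ∑ xs (λ _ → 0) ≡ 0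
∑-zero xs = trans (∑-const xs 0) (*-zeroʳ (length xs))

∑-swap : ∀ (xs : List I) (ys : List I′) (f : I → I′ → ℕ) →
         ∑ xs (λ x → ∑ ys (f x)) ≡ ∑ ys (λ y → ∑ xs (λ x → f x y))
∑-swap []       ys f = sym (∑-zero ys)
∑-swap (x ∷ xs) ys f =
  trans (cong (∑ ys (f x) +_) (∑-swap xs ys f)) (sym (∑-distrib-+ ys (f x) _))

∑-∈ : ∀ {xs : List I} {x} (f : I → ℕ) → x ∈ xs → f x ≤ ∑ xs f
∑-∈ f (here refl) = m≤m+n _ _
∑-∈ f (there p)   = ≤-trans (∑-∈ f p) (m≤n+m _ _)

∑-++ : ∀ (xs ys : List I) (f : I → ℕ) → ∑ (xs ++ ys) f ≡ ∑ xs f + ∑ ys f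
∑-++ []       ys f = refl
∑-++ (x ∷ xs) ys f = trans (cong (f x +_) (∑-++ xs ys f)) (sym (+-assoc (f x) _ _))

∑-map : ∀ (xs : List I) (g : I → I′) (f : I′ → ℕ) → ∑ (map g xs) f ≡ ∑ xs (f ∘ g)
∑-map []       g f = refl
∑-map (x ∷ xs) g f = cong (f (g x) +_) (∑-map xs g f)

∑-concatMap : ∀ (xs : List I) (g : I → List I′) (f : I′ → ℕ) →
              ∑ (concatMap g xs) f ≡ ∑ xs (λ x → ∑ (g x) f)
∑-concatMap []       g f = refl
∑-concatMap (x ∷ xs) g f = trans (∑-++ (g x) _ f) (cong (∑ (g x) f +_) (∑-concatMap xs g f))

∑≤∑*ʳ : ∀ (xs : List I) {f : I → ℕ} {c} → (∀ {x} → x ∈ xs → f x ≤ c) → ∑ xs f ≤ length xs * c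
∑≤∑*ʳ xs {c = c} h = subst (∑ xs _ ≤_) (∑-const xs c) (∑-mono xs h)

by-cases : {P C : Set} → Dec P → (P → C) → (¬ P → C) → C
by-cases (yes p) f g = f p
by-cases (no ¬p) f g = g ¬p

⟦_⟧ : {P : Set} → Dec P → ℕ
⟦ yes _ ⟧ = 1
⟦ no  _ ⟧ = 0

⟦_⟧ᶜ : {P : Set} → Dec P → ℕ
⟦ yes _ ⟧ᶜ = 0
⟦ no  _ ⟧ᶜ = 1

⟦⟧≤1 : {P : Set} (d : Dec P) → ⟦ d ⟧ ≤ 1
⟦⟧≤1 (yes _) = ≤-refl
⟦⟧≤1 (no  _) = z≤n

⟦⟧ᶜ≤1 : {P : Set} (d : Dec P) → ⟦ d ⟧ᶜ ≤ 1
⟦⟧ᶜ≤1 (yes _) = z≤n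
⟦⟧ᶜ≤1 (no  _) = ≤-refl

⟦⟧-true : {P : Set} (d : Dec P) → P → ⟦ d ⟧ ≡ 1
⟦⟧-true (yes _) p = refl
⟦⟧-true (no ¬p) p = contradiction p ¬p

⟦⟧-false : {P : Set} (d : Dec P) → ¬ P → ⟦ d ⟧ ≡ 0
⟦⟧-false (yes p) ¬p = contradiction p ¬p
⟦⟧-false (no  _) ¬p = refl

⟦⟧ᶜ-true : {P : Set} (d : Dec P) → P → ⟦ d ⟧ᶜ ≡ 0
⟦⟧ᶜ-true (yes _) p = refl
⟦⟧ᶜ-true (no ¬p) p = contradiction p ¬p

⟦⟧ᶜ-false : {P : Set} (d : Dec P) → ¬ P → ⟦ d ⟧ᶜ ≡ 1
⟦⟧ᶜ-false (yes p) ¬p = contradiction p ¬p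
⟦⟧ᶜ-false (no  _) ¬p = refl

⟦⟧*⟦⟧ᶜ≢0 : {P Q : Set} (d : Dec P) (d′ : Dec Q) → ⟦ d ⟧ * ⟦ d′ ⟧ᶜ ≢ 0 → P × ¬ Q
⟦⟧*⟦⟧ᶜ≢0 (yes p) (no ¬q) h = p , ¬q
⟦⟧*⟦⟧ᶜ≢0 (yes p) (yes q) h = contradiction refl h
⟦⟧*⟦⟧ᶜ≢0 (no ¬p) _       h = contradiction refl h

∑-filter : ∀ {P : I → Set} (P? : Decidable P) (xs : List I) (f : I → ℕ) →
           ∑ (filter P? xs) f ≡ ∑ xs (λ x → ⟦ P? x ⟧ * f x)
∑-filter P? []       f = refl
∑-filter P? (x ∷ xs) f with P? x
... | yes _ = cong₂ _+_ (sym (+-identityʳ (f x))) (∑-filter P? xs f)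
... | no  _ = ∑-filter P? xs f

length-filter : ∀ {P : I → Set} (P? : Decidable P) (xs : List I) →
                length (filter P? xs) ≡ ∑ xs (λ x → ⟦ P? x ⟧)
length-filter P? []       = refl
length-filter P? (x ∷ xs) with P? x
... | yes _ = cong suc (length-filter P? xs)
... | no  _ = length-filter P? xs

-- Reduces linear arithmetic to one ring identity: the hypotheses are added up to `l ≤ r`, and `s`
-- is the slack that they leave.
≤-by : ∀ {a b l r} → l ≤ r → ∀ s → a + r + s ≡ b + l → a ≤ b
≤-by {a} {b} {l} {r} l≤r s eq = +-cancelʳ-≤ l a b (begin
  a + l     ≤⟨ +-monoʳ-≤ a l≤r ⟩
  a + r     ≤⟨ m≤m+n (a + r) s ⟩
  a + r + s ≡⟨ eq ⟩
  b + l     ∎)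
  where open ≤-Reasoning

-- Random seeds

∑-prefix : ∀ {f g : ℕ → ℕ} {k n} → k ≤ n → (∀ {y} → y < k → f y ≤ g y) →
           ∑ (downFrom k) f ≤ ∑ (downFrom n) g
∑-prefix {f} {g} {k} {n} k≤n h = go (≤⇒≤′ k≤n)
  where
  go : ∀ {n} → k ≤′ n → ∑ (downFrom k) f ≤ ∑ (downFrom n) g
  go ≤′-refl     = ∑-mono (downFrom k) (h ∘ ∈-downFrom⁻)
  go (≤′-step p) = ≤-trans (go p) (m≤n+m _ _)

∑-indicator-absent : ∀ {f : ℕ → ℕ} {y₀} n → n ≤ y₀ →
                     ∑ (downFrom n) (λ y → ⟦ y ≟ y₀ ⟧ * f y) ≡ 0
∑-indicator-absent     zero    _ = refl
∑-indicator-absent {f} {y₀} (suc n) n<y₀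
  rewrite ⟦⟧-false (n ≟ y₀) (<⇒≢ n<y₀) = ∑-indicator-absent n (<⇒≤ n<y₀)

∑-indicator : ∀ {f : ℕ → ℕ} {y₀ n} → y₀ < n → ∑ (downFrom n) (λ y → ⟦ y ≟ y₀ ⟧ * f y) ≡ f y₀
∑-indicator {f} {y₀} {suc n} y₀<1+n with n ≟ y₀
... | yes refl = trans (cong₂ _+_ (+-identityʳ (f n)) (∑-indicator-absent n ≤-refl)) (+-identityʳ _)
... | no n≢y₀  = ∑-indicator (≤∧≢⇒< (≤-pred y₀<1+n) (n≢y₀ ∘ sym))

-- A random seed is a vector of independent coordinates; coordinate c takes the value y < cap c
-- with probability proportional to wt c y, and 𝔼 is the unnormalised expectation.
seeds : ∀ {M} (cap : Fin M → ℕ) (wt : Fin M → ℕ → ℕ) → List (ℕ × Vec ℕ M)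
seeds {zero}  cap wt = (1 , []) ∷ []
seeds {suc M} cap wt =
  concatMap (λ y → map (λ o → wt zero y * proj₁ o , y ∷ proj₂ o) (seeds (cap ∘ suc) (wt ∘ suc)))
            (downFrom (cap zero))

𝔼 : ∀ {M} (cap : Fin M → ℕ) (wt : Fin M → ℕ → ℕ) → (Vec ℕ M → ℕ) → ℕ
𝔼 cap wt X = ∑ (seeds cap wt) (λ o → proj₁ o * X (proj₂ o))

𝔼-∷ : ∀ {M} (cap : Fin (suc M) → ℕ) wt X →
      𝔼 cap wt X ≡ ∑ (downFrom (cap zero)) (λ y → wt zero y * 𝔼 (cap ∘ suc) (wt ∘ suc) (X ∘ (y ∷_)))
𝔼-∷ cap wt X = trans (∑-concatMap (downFrom (cap zero)) _ _) (∑-cong (downFrom (cap zero)) λ {y} _ →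
  trans (∑-map tails _ _) (trans (∑-cong tails λ {o} _ → *-assoc (wt zero y) (proj₁ o) _)
                                 (∑-*ˡ tails (wt zero y) _)))
  where tails = seeds (cap ∘ suc) (wt ∘ suc)

seeds-bounded : ∀ {M} (cap : Fin M → ℕ) wt {o} → o ∈ seeds cap wt → ∀ c → lookup (proj₂ o) c < cap c
seeds-bounded {suc M} cap wt o∈ c
  = go (∈-concatMap⁻ _ {xs = downFrom (cap zero)} o∈) c
  where
  go : ∀ {o} → Any (λ y → o ∈ map (λ o → wt zero y * proj₁ o , y ∷ proj₂ o) (seeds (cap ∘ suc) (wt ∘ suc)))
                   (downFrom (cap zero)) →
       ∀ c → lookup (proj₂ o) c < cap c
  go any c with find any
  ... | y , y∈ , o∈′ with ∈-map⁻ _ o∈′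
  go any zero    | y , y∈ , o∈′ | o₁ , o₁∈ , refl = ∈-downFrom⁻ y∈
  go any (suc c) | y , y∈ , o∈′ | o₁ , o₁∈ , refl = seeds-bounded (cap ∘ suc) (wt ∘ suc) o₁∈ c

module _ {M} (cap : Fin M → ℕ) (wt : Fin M → ℕ → ℕ) where
  𝔼-mono : ∀ {X X′} → (∀ Y → (∀ c → lookup Y c < cap c) → X Y ≤ X′ Y) → 𝔼 cap wt X ≤ 𝔼 cap wt X′
  𝔼-mono h = ∑-mono (seeds cap wt) λ {o} o∈ → *-monoʳ-≤ (proj₁ o) (h _ (seeds-bounded cap wt o∈))

  𝔼-cong : ∀ {X X′} → (∀ Y → X Y ≡ X′ Y) → 𝔼 cap wt X ≡ 𝔼 cap wt X′
  𝔼-cong h = ∑-cong (seeds cap wt) λ {o} o∈ → cong (proj₁ o *_) (h _)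

  𝔼-+ : ∀ X X′ → 𝔼 cap wt (λ Y → X Y + X′ Y) ≡ 𝔼 cap wt X + 𝔼 cap wt X′
  𝔼-+ X X′ = trans (∑-cong (seeds cap wt) λ {o} _ → *-distribˡ-+ (proj₁ o) _ _)
                   (∑-distrib-+ (seeds cap wt) _ _)

  𝔼-*ˡ : ∀ a X → 𝔼 cap wt (λ Y → a * X Y) ≡ a * 𝔼 cap wt X
  𝔼-*ˡ a X = trans (∑-cong (seeds cap wt) λ {o} _ → shuffle (proj₁ o) a (X (proj₂ o)))
                   (∑-*ˡ (seeds cap wt) a _)
    where
    shuffle : ∀ w a x → w * (a * x) ≡ a * (w * x)
    shuffle = solve-∀

  𝔼-const : ∀ a → 𝔼 cap wt (λ _ → a) ≡ a * 𝔼 cap wt (λ _ → 1)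
  𝔼-const a = trans (𝔼-cong λ _ → sym (*-identityʳ a)) (𝔼-*ˡ a _)

  𝔼-∑ : ∀ {A : Set} (xs : List A) (X : A → Vec ℕ M → ℕ) →
        𝔼 cap wt (λ Y → ∑ xs (λ x → X x Y)) ≡ ∑ xs (λ x → 𝔼 cap wt (X x))
  𝔼-∑ xs X = trans (∑-cong (seeds cap wt) λ {o} _ → sym (∑-*ˡ xs (proj₁ o) _))
                   (∑-swap (seeds cap wt) xs _)

-- Conditioning on all coordinates but `u`: by independence the sum over `u` can be taken innermost,
-- so an inequality on every line parallel to axis `u` suffices.
resample-≤ : ∀ {M} (cap : Fin M → ℕ) wt (u : Fin M) {X X′ : Vec ℕ M → ℕ} →
  (∀ Y → ∑ (downFrom (cap u)) (λ y → wt u y * X (Y [ u ]≔ y))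
       ≤ ∑ (downFrom (cap u)) (λ y → wt u y * X′ (Y [ u ]≔ y))) →
  𝔼 cap wt X ≤ 𝔼 cap wt X′
resample-≤ cap wt zero {X} {X′} h = begin
  𝔼 cap wt X                                                   ≡⟨ exchange X ⟩
  𝔼 (cap ∘ suc) (wt ∘ suc) (λ Y → ∑ ys (λ y → wt zero y * X (y ∷ Y)))
    -- The head 0 is a placeholder that `_[_]≔_` overwrites.
    ≤⟨ 𝔼-mono (cap ∘ suc) (wt ∘ suc) (λ Y _ → h (0 ∷ Y)) ⟩
  𝔼 (cap ∘ suc) (wt ∘ suc) (λ Y → ∑ ys (λ y → wt zero y * X′ (y ∷ Y)))
    ≡⟨ exchange X′ ⟨
  𝔼 cap wt X′                                                  ∎
  where
  open ≤-Reasoning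
  ys = downFrom (cap zero)
  exchange : ∀ X → 𝔼 cap wt X ≡ 𝔼 (cap ∘ suc) (wt ∘ suc) (λ Y → ∑ ys (λ y → wt zero y * X (y ∷ Y)))
  exchange X = trans (𝔼-∷ cap wt X)
    (sym (trans (𝔼-∑ (cap ∘ suc) (wt ∘ suc) ys _)
                (∑-cong ys λ {y} _ → 𝔼-*ˡ (cap ∘ suc) (wt ∘ suc) (wt zero y) _)))
resample-≤ cap wt (suc u) {X} {X′} h = begin
  𝔼 cap wt X  ≡⟨ 𝔼-∷ cap wt X ⟩
  _           ≤⟨ ∑-mono (downFrom (cap zero)) (λ {y} _ →
                   *-monoʳ-≤ (wt zero y) (resample-≤ (cap ∘ suc) (wt ∘ suc) u (λ Y → h (y ∷ Y)))) ⟩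
  _           ≡⟨ 𝔼-∷ cap wt X′ ⟨
  𝔼 cap wt X′ ∎
  where open ≤-Reasoning

𝔼-positive : ∀ {M} (cap : Fin M → ℕ) wt → (∀ c → 1 ≤ ∑ (downFrom (cap c)) (wt c)) →
             1 ≤ 𝔼 cap wt (λ _ → 1)
𝔼-positive {zero}  cap wt h = ≤-refl
𝔼-positive {suc M} cap wt h = begin
  1                                                     ≤⟨ h zero ⟩
  ∑ (downFrom (cap zero)) (wt zero)                     ≤⟨ ∑-mono (downFrom (cap zero)) (λ {y} _ →
    ≤-trans (≤-reflexive (sym (*-identityʳ (wt zero y))))
            (*-monoʳ-≤ (wt zero y) (𝔼-positive (cap ∘ suc) (wt ∘ suc) (h ∘ suc)))) ⟩
  _                                                     ≡⟨ 𝔼-∷ cap wt (λ _ → 1) ⟨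
  𝔼 cap wt (λ _ → 1)                                    ∎
  where open ≤-Reasoning

-- At most one value y₀ of the coordinate is an exit; its weight is paid for by the values
-- below y₀, all of which witness a rise, and by the term m.
unique-exit-bound : ∀ n (w : ℕ → ℕ) m (e r c : ℕ → ℕ) →
  (∀ {y} → y < n → w y * m ≤ ∑ (downFrom y) w + m) →
  (∀ y → e y ≤ 1) →
  (∀ {y₀} → e y₀ ≢ 0 → (∀ y → 1 ≤ c y) × (∀ {y} → y < y₀ → 1 ≤ r y) × (∀ {y} → y < y₀ → e y ≡ 0)) →
  let tot = ∑ (downFrom n) w in
  ∑ (downFrom n) (λ y → w y * (m * tot * e y)) ≤ ∑ (downFrom n) (λ y → w y * (tot * r y + m * c y))
unique-exit-bound n w m e r c grows e≤1 exit with any? (λ y → 1 ≤? e y) (downFrom n)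
... | no none = ≤-trans (≤-reflexive (trans (∑-cong ys λ {y} y∈ → vanish y (n<1⇒n≡0 (≰⇒> λ p → none (lose y∈ p))))
                                            (∑-zero ys))) z≤n
  where
  ys = downFrom n
  vanish : ∀ y → e y ≡ 0 → w y * (m * ∑ ys w * e y) ≡ 0
  vanish y eq = trans (cong (λ z → w y * (m * ∑ ys w * z)) eq)
                      (trans (cong (w y *_) (*-zeroʳ (m * ∑ ys w))) (*-zeroʳ (w y)))
... | yes some with find some
...   | y₀ , y₀∈ , 1≤e = begin
  ∑ ys (λ y → w y * (m * tot * e y))               ≤⟨ ∑-mono ys (λ {y} _ → single y) ⟩
  ∑ ys (λ y → ⟦ y ≟ y₀ ⟧ * (w y * (m * tot)))      ≡⟨ ∑-indicator {λ y → w y * (m * tot)} (∈-downFrom⁻ y₀∈) ⟩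
  w y₀ * (m * tot)                                 ≡⟨ *-assoc (w y₀) m tot ⟨
  w y₀ * m * tot                                   ≤⟨ *-monoˡ-≤ tot (grows (∈-downFrom⁻ y₀∈)) ⟩
  (∑ (downFrom y₀) w + m) * tot                    ≡⟨ rearrange (∑ (downFrom y₀) w) m tot ⟩
  tot * ∑ (downFrom y₀) w + m * tot
    ≤⟨ +-mono-≤ (*-monoʳ-≤ tot (∑-prefix {g = λ y → w y * r y} (<⇒≤ (∈-downFrom⁻ y₀∈)) λ {y} y<y₀ → times (rises y<y₀)))
                (*-monoʳ-≤ m (∑-mono ys {g = λ y → w y * c y} λ {y} _ → times (raises y))) ⟩
  tot * ∑ ys (λ y → w y * r y) + m * ∑ ys (λ y → w y * c y)
    ≡⟨ sym (cong₂ _+_ (∑-*ˡ ys tot _) (∑-*ˡ ys m _)) ⟩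
  ∑ ys (λ y → tot * (w y * r y)) + ∑ ys (λ y → m * (w y * c y))
    ≡⟨ ∑-distrib-+ ys _ _ ⟨
  ∑ ys (λ y → tot * (w y * r y) + m * (w y * c y))
    ≡⟨ ∑-cong ys (λ {y} _ → collect tot (w y) (r y) m (c y)) ⟩
  ∑ ys (λ y → w y * (tot * r y + m * c y))         ∎
  where
  open ≤-Reasoning
  ys = downFrom n
  tot = ∑ ys w
  positive⇒≢0 : ∀ {a} → 1 ≤ a → a ≢ 0
  positive⇒≢0 1≤a a≡0 = <⇒≢ 1≤a (sym a≡0)
  raises = proj₁ (exit (positive⇒≢0 1≤e))
  rises  = λ {y} → proj₁ (proj₂ (exit (positive⇒≢0 1≤e))) {y}
  first  = λ {y} → proj₂ (proj₂ (exit (positive⇒≢0 1≤e))) {y}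
  times : ∀ {a b} → 1 ≤ b → a ≤ a * b
  times {a} 1≤b = ≤-trans (≤-reflexive (sym (*-identityʳ a))) (*-monoʳ-≤ a 1≤b)
  rearrange : ∀ a b c → (a + b) * c ≡ c * a + b * c
  rearrange = solve-∀
  collect : ∀ t w r m c → t * (w * r) + m * (w * c) ≡ w * (t * r + m * c)
  collect = solve-∀
  vanish : ∀ y → e y ≡ 0 → w y * (m * tot * e y) ≡ 0
  vanish y eq = trans (cong (λ z → w y * (m * tot * z)) eq)
                      (trans (cong (w y *_) (*-zeroʳ (m * tot))) (*-zeroʳ (w y)))
  last : ∀ {y} → y₀ < y → e y ≡ 0
  last {y} y₀<y with e y ≟ 0
  ... | yes eq = eq
  ... | no neq = contradiction (proj₂ (proj₂ (exit neq)) y₀<y) (positive⇒≢0 1≤e)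
  single : ∀ y → w y * (m * tot * e y) ≤ ⟦ y ≟ y₀ ⟧ * (w y * (m * tot))
  single y with y ≟ y₀
  ... | yes refl = ≤-trans (*-monoʳ-≤ (w y) (≤-trans (*-monoʳ-≤ (m * tot) (e≤1 y))
          (≤-reflexive (*-identityʳ (m * tot))))) (≤-reflexive (sym (+-identityʳ _)))
  ... | no y≢y₀ with <-cmp y y₀
  ...   | tri< y<y₀ _ _ = ≤-reflexive (vanish y (first y<y₀))
  ...   | tri≈ _ y≡y₀ _ = contradiction y≡y₀ y≢y₀
  ...   | tri> _ _ y₀<y = ≤-reflexive (vanish y (last y₀<y))

-- Work functions and tree metrics

module Climb {S : Set} (states : List S) (complete : ∀ s → s ∈ states)
  (rank : S → ℕ) (rank-injective : ∀ {s t} → rank s ≡ rank t → s ≡ t)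
  (_↝_ : (S → ℕ) → (S → ℕ) → Set)
  (↝-trans : ∀ {v v′ v″} → v ↝ v′ → v′ ↝ v″ → v ↝ v″)
  (↝-cong : ∀ {v v′} → (∀ s → v s ≡ v′ s) → v ↝ v′)
  {w w′ : S → ℕ}
  (unit : ∀ {v v′ ℓ} → v′ ℓ ≡ suc (v ℓ) → (∀ {s} → s ≢ ℓ → v′ s ≡ v s) →
          (∀ s → w s ≤ v s) → (∀ s → v s ≤ w′ s) → v ↝ v′)
  where

  raise : (S → ℕ) → S → S → ℕ
  raise v ℓ s = v s + ⟦ rank s ≟ rank ℓ ⟧

  raise-raised : ∀ v ℓ → raise v ℓ ℓ ≡ suc (v ℓ)
  raise-raised v ℓ = trans (cong (v ℓ +_) (⟦⟧-true (rank ℓ ≟ rank ℓ) refl)) (+-comm (v ℓ) 1)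

  raise-kept : ∀ v ℓ {s} → s ≢ ℓ → raise v ℓ s ≡ v s
  raise-kept v ℓ {s} s≢ℓ = trans (cong (v s +_) (⟦⟧-false (rank s ≟ rank ℓ) (s≢ℓ ∘ rank-injective)))
                                 (+-identityʳ (v s))

  raise≤ : ∀ {v ℓ} → (∀ s → v s ≤ w′ s) → v ℓ < w′ ℓ → ∀ s → raise v ℓ s ≤ w′ s
  raise≤ {v} {ℓ} v≤w′ vℓ< s with rank s ≟ rank ℓ
  ... | no  _  = ≤-trans (≤-reflexive (+-identityʳ (v s))) (v≤w′ s)
  ... | yes eq rewrite rank-injective eq = ≤-trans (≤-reflexive (+-comm (v ℓ) 1)) vℓ<

  -- Induction on the height still to be climbed; any state below its target may be raised next. The
  -- bounds by `w` and `w′` are carried along because `unit` is only available in between, where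
  -- functions are still Lipschitz up to one request.
  climb-within : ∀ n v → ∑ states (λ s → w′ s ∸ v s) ≤ n → (∀ s → w s ≤ v s) → (∀ s → v s ≤ w′ s) → v ↝ w′
  climb-within n v ∑≤n w≤v v≤w′ with any? (λ s → v s <? w′ s) states
  ... | no none = ↝-cong λ s → ≤-antisym (v≤w′ s) (≮⇒≥ λ vs< → none (lose (complete s) vs<))
  ... | yes some with find some
  climb-within zero v ∑≤n w≤v v≤w′ | yes some | ℓ , ℓ∈ , vℓ< =
    contradiction (≤-trans (∑-∈ (λ s → w′ s ∸ v s) ℓ∈) ∑≤n) (<⇒≱ (m<n⇒0<n∸m vℓ<))
  climb-within (suc n) v ∑≤n w≤v v≤w′ | yes some | ℓ , ℓ∈ , vℓ< = ↝-trans {v} {raise v ℓ} {w′}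
    (unit {v} {raise v ℓ} {ℓ} (raise-raised v ℓ) (raise-kept v ℓ) w≤v v≤w′)
    (climb-within n (raise v ℓ)
      (≤-pred (≤-trans (∑-mono-< ℓ∈ (λ {s} _ → ∸-monoʳ-≤ (w′ s) (m≤m+n (v s) _))
        (∸-monoʳ-< (≤-trans (n<1+n (v ℓ)) (≤-reflexive (sym (raise-raised v ℓ))))
                   (raise≤ v≤w′ vℓ< ℓ))) ∑≤n))
      (λ s → ≤-trans (w≤v s) (m≤m+n (v s) _))
      (raise≤ v≤w′ vℓ<))

  climb : (∀ s → w s ≤ w′ s) → w ↝ w′
  climb w≤w′ = climb-within _ w ≤-refl (λ _ → ≤-refl) w≤w′

module WorkFunction {S Q : Set} (states : List S) (dist : S → S → ℕ) (K : ℕ) (pays : S → Q → ℕ) where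

  initial : S → S → ℕ
  initial s₀ s = dist s s₀

  abstract
    source : (S → ℕ) → Q → S → S
    source w r s = argmin (λ t → w t + K * pays t r + dist s t) s states

    -- The work function update: the cheapest way to serve the past and then `r` and end in `s`. The
    -- hit is paid at the state occupied before the move.
    serve : (S → ℕ) → Q → S → ℕ
    serve w r s = w (source w r s) + K * pays (source w r s) r + dist s (source w r s)

    serve-attained : ∀ w r s → ∃ λ t → serve w r s ≡ w t + K * pays t r + dist s t
    serve-attained w r s = source w r s , refl

    serve-least : ∀ w r s {t} → t ∈ states → serve w r s ≤ w t + K * pays t r + dist s t
    serve-least w r s t∈ = All.lookup (f[argmin]≤f[xs] s states) t∈

  run : (S → ℕ) → List Q → S → ℕ
  run w []      = w
  run w (r ∷ σ) = run (serve w r) σ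

  online : ((S → ℕ) → S) → (S → ℕ) → List Q → ℕ
  online x w []      = 0
  online x w (r ∷ σ) = K * pays (x w) r + dist (x w) (x (serve w r)) + online x (serve w r) σ

  offline : S → (σ : List Q) → Vec S (length σ) → ℕ
  offline s []      []       = 0
  offline s (r ∷ σ) (t ∷ ts) = K * pays s r + dist t s + offline t σ ts

  -- What the analysis on one tree hands over: for a fixed seed the position is a function of the
  -- current work function alone. Both sides of `competitive` are unnormalised.
  record Solution (s₀ : S) (ratio : ℕ) : Set where
    field
      coordinates    : ℕ
      cap            : Fin coordinates → ℕ
      wt             : Fin coordinates → ℕ → ℕ
      state          : Vec ℕ coordinates → (S → ℕ) → S
      weight≥1       : 1 ≤ 𝔼 cap wt (λ _ → 1)
      state-initial  : ∀ Y → (∀ c → lookup Y c < cap c) → state Y (initial s₀) ≡ s₀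
      additive       : ℕ
      competitive    : ∀ σ ts → 𝔼 cap wt (λ Y → online (state Y) (initial s₀) σ)
                              ≤ 𝔼 cap wt (λ _ → 1) * (ratio * offline s₀ σ ts + additive)

module WorkFunctionProperties {S Q : Set} (states : List S) (complete : ∀ s → s ∈ states)
  (dist : S → S → ℕ) (dist-refl : ∀ s → dist s s ≡ 0)
  (dist-triangle : ∀ s t r → dist s r ≤ dist s t + dist t r)
  (K : ℕ) (pays : S → Q → ℕ) (pays≤1 : ∀ s r → pays s r ≤ 1)
  where
  open WorkFunction states dist K pays

  Contracting : (S → ℕ) → Set
  Contracting w = ∀ s t → w s ≤ w t + dist s t

  serve≤ : ∀ w r s t → serve w r s ≤ w t + K * pays t r + dist s t
  serve≤ w r s t = serve-least w r s (complete t)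

  serve-self : ∀ w r s → serve w r s ≤ w s + K * pays s r
  serve-self w r s = ≤-trans (serve≤ w r s s)
    (≤-reflexive (trans (cong (w s + K * pays s r +_) (dist-refl s)) (+-identityʳ _)))

  serve-≤+K : ∀ w r s → serve w r s ≤ w s + K
  serve-≤+K w r s = ≤-trans (serve-self w r s)
    (+-monoʳ-≤ (w s) (≤-trans (*-monoʳ-≤ K (pays≤1 s r)) (≤-reflexive (*-identityʳ K))))

  serve-Contracting : ∀ w r → Contracting (serve w r)
  serve-Contracting w r s t = begin
    serve w r s                                      ≤⟨ serve≤ w r s x ⟩
    w x + K * pays x r + dist s x                    ≤⟨ +-monoʳ-≤ (w x + K * pays x r) (dist-triangle s t x) ⟩
    w x + K * pays x r + (dist s t + dist t x)       ≡⟨ swap (w x + K * pays x r) (dist s t) (dist t x) ⟩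
    w x + K * pays x r + dist t x + dist s t         ≡⟨ cong (_+ dist s t) eq ⟨
    serve w r t + dist s t                           ∎
    where
    open ≤-Reasoning
    x = proj₁ (serve-attained w r t)
    eq = proj₂ (serve-attained w r t)
    swap : ∀ a b c → a + (b + c) ≡ a + c + b
    swap = solve-∀

  serve-grows : ∀ {w} → Contracting w → ∀ r s → w s ≤ serve w r s
  serve-grows {w} con r s = ≤-trans (con s x) (≤-trans (+-monoˡ-≤ (dist s x) (m≤m+n (w x) _)) (≤-reflexive (sym eq)))
    where
    x = proj₁ (serve-attained w r s)
    eq = proj₂ (serve-attained w r s)

  initial-Contracting : ∀ s₀ → Contracting (initial s₀)
  initial-Contracting s₀ s t = ≤-trans (dist-triangle s t s₀) (≤-reflexive (+-comm (dist s t) _))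

  run-Contracting : ∀ {w} → Contracting w → ∀ σ → Contracting (run w σ)
  run-Contracting con []      = con
  run-Contracting con (r ∷ σ) = run-Contracting (serve-Contracting _ r) σ

  offline-value : ∀ w s σ ts → ∃ λ t → run w σ t ≤ w s + offline s σ ts
  offline-value w s []      []       = s , ≤-reflexive (sym (+-identityʳ (w s)))
  offline-value w s (r ∷ σ) (t ∷ ts) with offline-value (serve w r) t σ ts
  ... | x , below = x , (begin
    run (serve w r) σ x                                   ≤⟨ below ⟩
    serve w r t + offline t σ ts                          ≤⟨ +-monoˡ-≤ (offline t σ ts) (serve≤ w r t s) ⟩
    w s + K * pays s r + dist t s + offline t σ ts        ≡⟨ regroup (w s) (K * pays s r) (dist t s) (offline t σ ts) ⟩
    w s + offline s (r ∷ σ) (t ∷ ts)                      ∎)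
    where
    open ≤-Reasoning
    regroup : ∀ a b c d → a + b + c + d ≡ a + (b + c + d)
    regroup = solve-∀

module Metric {S : Set} (H : ℕ) (cell : ℕ → S → ℕ) (lam : ℕ → ℕ) where

  differ? : ℕ → S → S → ℕ
  differ? i s t = ⟦ cell i s ≟ cell i t ⟧ᶜ

  -- The path metric of a tree with the level-0 cells as leaves: an edge from a level-`j` cell to
  -- its parent has length `lam j / 2`, and the path crosses two of them at every level that
  -- separates `s` from `t`.
  dist : S → S → ℕ
  dist s t = ∑ (downFrom H) (λ j → lam j * differ? j s t)

  differ?-refl : ∀ i s → differ? i s s ≡ 0
  differ?-refl i s = ⟦⟧ᶜ-true (cell i s ≟ cell i s) refl

  dist-refl : ∀ s → dist s s ≡ 0
  dist-refl s = trans (∑-cong (downFrom H) λ {j} _ → trans (cong (lam j *_) (differ?-refl j s)) (*-zeroʳ (lam j)))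
                      (∑-zero (downFrom H))

  differ?-sym : ∀ i s t → differ? i s t ≡ differ? i t s
  differ?-sym i s t with cell i s ≟ cell i t | cell i t ≟ cell i s
  ... | yes p | yes q = refl
  ... | yes p | no  q = contradiction (sym p) q
  ... | no  p | yes q = contradiction (sym q) p
  ... | no  p | no  q = refl

  dist-sym : ∀ s t → dist s t ≡ dist t s
  dist-sym s t = ∑-cong (downFrom H) λ {j} _ → cong (lam j *_) (differ?-sym j s t)

  differ?-triangle : ∀ i s t r → differ? i s r ≤ differ? i s t + differ? i t r
  differ?-triangle i s t r with cell i s ≟ cell i t | cell i t ≟ cell i r | cell i s ≟ cell i r
  ... | _     | _     | yes _ = z≤n
  ... | no  _ | _     | no  _ = s≤s z≤n
  ... | yes _ | no  _ | no  _ = ≤-refl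
  ... | yes p | yes q | no  n = contradiction (trans p q) n

  dist-triangle : ∀ s t r → dist s r ≤ dist s t + dist t r
  dist-triangle s t r = ≤-trans
    (∑-mono (downFrom H) λ {j} _ → ≤-trans (*-monoʳ-≤ (lam j) (differ?-triangle j s t r))
      (≤-reflexive (*-distribˡ-+ (lam j) _ _)))
    (≤-reflexive (∑-distrib-+ (downFrom H) _ _))

  module Nested (cell-nested : ∀ i {s t} → cell i s ≡ cell i t → cell (suc i) s ≡ cell (suc i) t) where

    differ?-nested : ∀ i s t → differ? i s t
      ≡ ⟦ cell (suc i) s ≟ cell (suc i) t ⟧ * differ? i s t + differ? (suc i) s t
    differ?-nested i s t with cell (suc i) s ≟ cell (suc i) t | cell i s ≟ cell i t
    ... | yes p | yes q = refl
    ... | yes p | no  q = refl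
    ... | no  p | yes q = contradiction (cell-nested i q) p
    ... | no  p | no  q = refl

    differ?-above : ∀ {i} j {s t} → i ≤ j → cell i s ≡ cell i t → differ? j s t ≡ 0
    differ?-above j {s} {t} i≤j eq = ⟦⟧ᶜ-true (cell j s ≟ cell j t) (go (≤⇒≤′ i≤j))
      where
      go : ∀ {j} → _ ≤′ j → cell j s ≡ cell j t
      go ≤′-refl         = eq
      go (≤′-step {j} p) = cell-nested j (go p)

    dist≤prefix : ∀ i {s t} → cell i s ≡ cell i t → dist s t ≤ ∑ (downFrom i) lam
    dist≤prefix i {s} {t} eq = go H
      where
      go : ∀ n → ∑ (downFrom n) (λ j → lam j * differ? j s t) ≤ ∑ (downFrom i) lam
      go zero    = z≤n
      go (suc n) with i ≤? n
      ... | yes i≤n = ≤-trans (+-monoˡ-≤ _ (≤-reflexive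
                        (trans (cong (lam n *_) (differ?-above n i≤n eq)) (*-zeroʳ (lam n))))) (go n)
      ... | no  i≰n = ∑-prefix (≰⇒> i≰n) λ {j} _ → ≤-trans (*-monoʳ-≤ (lam j) (⟦⟧ᶜ≤1 (cell j s ≟ cell j t)))
                                                     (≤-reflexive (*-identityʳ (lam j)))

    module Geometric (double : ∀ i → 2 * lam i ≤ lam (suc i)) (cell-top : ∀ s t → cell H s ≡ cell H t) where

      shift : ∀ (g : ℕ → ℕ) n → ∑ (downFrom n) (g ∘ suc) ≤ ∑ (downFrom n) g + g n
      shift g zero    = z≤n
      shift g (suc n) = ≤-trans (+-monoʳ-≤ (g (suc n)) (shift g n))
        (≤-reflexive (rotate (g (suc n)) (∑ (downFrom n) g) (g n)))
        where
        rotate : ∀ a b c → a + (b + c) ≡ c + b + a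
        rotate = solve-∀

      shifted-dist : ∀ s t → ∑ (downFrom H) (λ j → lam (suc j) * differ? (suc j) s t) ≤ dist s t
      shifted-dist s t = ≤-trans (shift (λ j → lam j * differ? j s t) H)
        (≤-reflexive (trans (cong (λ d → dist s t + lam H * d) (⟦⟧ᶜ-true (cell H s ≟ cell H t) (cell-top s t)))
                     (trans (cong (dist s t +_) (*-zeroʳ (lam H))) (+-identityʳ _))))

      -- Only the highest separating level survives on the right, being the one whose parents
      -- coincide. As `lam` at least doubles, the lower levels add at most as much again: with `e`
      -- for that level and `d′` for the rest, `d ≡ e + d′` and `2 * d′ ≤ d`.
      dist≤2*exits : ∀ s t → dist s t ≤
        2 * ∑ (downFrom H) (λ j → lam j * (⟦ cell (suc j) s ≟ cell (suc j) t ⟧ * differ? j s t))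
      dist≤2*exits s t = ≤-by above 0 (begin
        d + (2 * e + d) + 0     ≡⟨ split d e ⟩
        2 * e + 2 * d           ∎)
        where
        open ≡-Reasoning
        d = dist s t
        exit = λ j → ⟦ cell (suc j) s ≟ cell (suc j) t ⟧ * differ? j s t
        e = ∑ (downFrom H) (λ j → lam j * exit j)
        d′ = ∑ (downFrom H) (λ j → lam j * differ? (suc j) s t)
        split : ∀ d e → d + (2 * e + d) + 0 ≡ 2 * e + 2 * d
        split = solve-∀
        d≡ : d ≡ e + d′
        d≡ = trans (∑-cong (downFrom H) λ {j} _ → trans (cong (lam j *_) (differ?-nested j s t))
                     (*-distribˡ-+ (lam j) (exit j) (differ? (suc j) s t)))
                   (∑-distrib-+ (downFrom H) _ _)
        2d′≤d : 2 * d′ ≤ d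
        2d′≤d = ≤-trans (≤-reflexive (sym (∑-*ˡ (downFrom H) 2 _)))
          (≤-trans (∑-mono (downFrom H) λ {j} _ → ≤-trans (≤-reflexive (sym (*-assoc 2 (lam j) (differ? (suc j) s t))))
                      (*-monoˡ-≤ (differ? (suc j) s t) (double j)))
                   (shifted-dist s t))
        above : 2 * d ≤ 2 * e + d
        above = ≤-trans (≤-reflexive (trans (cong (2 *_) d≡) (*-distribˡ-+ 2 e d′))) (+-monoʳ-≤ (2 * e) 2d′≤d)

-- The minimiser of the perturbed work function

module Perturbed {S : Set} (states : List S) (complete : ∀ s → s ∈ states) (s₀ : S)
  (H : ℕ) (cell : ℕ → S → ℕ)
  (cell-injective : ∀ {s t} → cell 0 s ≡ cell 0 t → s ≡ t)
  (cell-mono : ∀ i {s t} → cell 0 s ≤ cell 0 t → cell i s ≤ cell i t)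
  (cell-nested : ∀ i {s t} → cell i s ≡ cell i t → cell (suc i) s ≡ cell (suc i) t)
  (R : ℕ) (cell<R : ∀ s → cell 0 s < R)
  {M : ℕ} (node : ℕ → S → Fin M)
  (node-injective : ∀ {i j s t} → i < H → j < H → node i s ≡ node j t → i ≡ j × cell i s ≡ cell i t)
  (node-cong : ∀ i {s t} → cell i s ≡ cell i t → node i s ≡ node i t)
  where

  noise : Vec ℕ M → S → ℕ
  noise Y s = ∑ (downFrom H) (λ j → lookup Y (node j s))

  score : Vec ℕ M → (S → ℕ) → S → ℕ
  score Y v s = v s + noise Y s

  -- The lexicographic order by value and then by rank, packed into one number since ranks are below
  -- `R`. By `cell-mono` every cell is an interval of the ranks; this is what makes ties harmless in
  -- `inside-raised`.
  tie : (S → ℕ) → S → ℕ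
  tie f s = f s * R + cell 0 s

  abstract
    best : Vec ℕ M → (S → ℕ) → S
    best Y v = argmin (tie (score Y v)) s₀ states

    best-least : ∀ Y v t → tie (score Y v) (best Y v) ≤ tie (score Y v) t
    best-least Y v t = All.lookup (f[argmin]≤f[xs] s₀ states) (complete t)

  low : Vec ℕ M → (S → ℕ) → ℕ
  low Y v = score Y v (best Y v)

  members : ℕ → ℕ → List S
  members i e = filter (λ t → cell i t ≟ e) states

  mates : ℕ → S → List S
  mates i s = members i (cell i s)

  abstract
    cellBest : Vec ℕ M → (S → ℕ) → ℕ → S → S
    cellBest Y v i s = argmin (score Y v) s (mates i s)

    cellBest-cell : ∀ Y v i s → cell i (cellBest Y v i s) ≡ cell i s
    cellBest-cell Y v i s with argmin-sel (score Y v) s (mates i s)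
    ... | inj₁ eq = cong (cell i) eq
    ... | inj₂ m∈ = proj₂ (∈-filter⁻ (λ t → cell i t ≟ cell i s) {xs = states} m∈)

    cellBest-least : ∀ Y v i s {t} → cell i t ≡ cell i s → score Y v (cellBest Y v i s) ≤ score Y v t
    cellBest-least Y v i s {t} eq =
      All.lookup (f[argmin]≤f[xs] s (mates i s)) (∈-filter⁺ (λ t → cell i t ≟ cell i s) (complete t) eq)

  cellLow : Vec ℕ M → (S → ℕ) → ℕ → S → ℕ
  cellLow Y v i s = score Y v (cellBest Y v i s)

  tie-≤⇒≤ : ∀ f {s t} → tie f s ≤ tie f t → f s ≤ f t
  tie-≤⇒≤ f {s} {t} p = ≮⇒≥ λ ft<fs → <⇒≱ (begin-strict
    f t * R + cell 0 t <⟨ +-monoʳ-< (f t * R) (cell<R t) ⟩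
    f t * R + R        ≡⟨ +-comm (f t * R) R ⟩
    suc (f t) * R      ≤⟨ *-monoˡ-≤ R ft<fs ⟩
    f s * R            ≤⟨ m≤m+n _ _ ⟩
    f s * R + cell 0 s ∎) p
    where open ≤-Reasoning

  tie-≤⇒rank : ∀ f {s t} → tie f s ≤ tie f t → f t ≤ f s → cell 0 s ≤ cell 0 t
  tie-≤⇒rank f {s} {t} p ft≤fs =
    +-cancelˡ-≤ (f t * R) _ _ (≤-trans (+-monoˡ-≤ (cell 0 s) (*-monoˡ-≤ R ft≤fs)) p)

  tie-injective : ∀ f {s t} → tie f s ≡ tie f t → s ≡ t
  tie-injective f {s} {t} eq = cell-injective (≤-antisym
    (tie-≤⇒rank f (≤-reflexive eq) (tie-≤⇒≤ f (≤-reflexive (sym eq))))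
    (tie-≤⇒rank f (≤-reflexive (sym eq)) (tie-≤⇒≤ f (≤-reflexive eq))))

  low≤ : ∀ Y v t → low Y v ≤ score Y v t
  low≤ Y v t = tie-≤⇒≤ (score Y v) (best-least Y v t)

  cellLow≤ : ∀ Y v i s {t} → cell i t ≡ cell i s → cellLow Y v i s ≤ score Y v t
  cellLow≤ = cellBest-least

  low≤cellLow : ∀ Y v i s → low Y v ≤ cellLow Y v i s
  low≤cellLow Y v i s = low≤ Y v _

  module Resample (i : ℕ) (i<H : i < H) (ℓ : S) (Y : Vec ℕ M) where
    u = node i ℓ

    inside : S → ℕ
    inside s = ⟦ cell i s ≟ cell i ℓ ⟧

    -- Different cells own different coordinates, so coordinate `u` enters the noise of `s` once, at
    -- level `i`, or not at all. Resampling it shifts one cell rigidly against its complement.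
    noise-resample : ∀ y s → noise (Y [ u ]≔ y) s ≡ noise (Y [ u ]≔ 0) s + inside s * y
    noise-resample y s = begin
      noise (Y [ u ]≔ y) s
        ≡⟨ ∑-cong (downFrom H) (λ {j} j∈ → coordinate j (∈-downFrom⁻ j∈)) ⟩
      ∑ (downFrom H) (λ j → lookup (Y [ u ]≔ 0) (node j s) + ⟦ j ≟ i ⟧ * (inside s * y))
        ≡⟨ ∑-distrib-+ (downFrom H) _ _ ⟩
      noise (Y [ u ]≔ 0) s + ∑ (downFrom H) (λ j → ⟦ j ≟ i ⟧ * (inside s * y))
        ≡⟨ cong (noise (Y [ u ]≔ 0) s +_) (∑-indicator {f = λ _ → inside s * y} i<H) ⟩
      noise (Y [ u ]≔ 0) s + inside s * y ∎
      where
      open ≡-Reasoning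
      unchanged : ∀ {c} → c ≢ u → lookup (Y [ u ]≔ y) c ≡ lookup (Y [ u ]≔ 0) c + 0
      unchanged c≢u = trans (lookup∘update′ c≢u Y y)
        (sym (trans (+-identityʳ _) (lookup∘update′ c≢u Y 0)))
      coordinate : ∀ j → j < H → lookup (Y [ u ]≔ y) (node j s)
                 ≡ lookup (Y [ u ]≔ 0) (node j s) + ⟦ j ≟ i ⟧ * (inside s * y)
      coordinate j j<H with j ≟ i
      ... | no j≢i = unchanged (j≢i ∘ proj₁ ∘ node-injective j<H i<H)
      ... | yes refl with cell i s ≟ cell i ℓ
      ...   | no s≢ℓ = unchanged (s≢ℓ ∘ proj₂ ∘ node-injective j<H i<H)
      ...   | yes s≡ℓ rewrite node-cong i s≡ℓ | lookup∘update u Y y | lookup∘update u Y 0 =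
              sym (trans (+-identityʳ _) (+-identityʳ y))

    base : (S → ℕ) → S → ℕ
    base = score (Y [ u ]≔ 0)

    score-inside : ∀ v y {s} → cell i s ≡ cell i ℓ → score (Y [ u ]≔ y) v s ≡ base v s + y
    score-inside v y {s} eq = trans (cong (v s +_) (trans (noise-resample y s)
      (cong (noise (Y [ u ]≔ 0) s +_) (trans (cong (_* y) (⟦⟧-true (cell i s ≟ cell i ℓ) eq)) (+-identityʳ y)))))
      (sym (+-assoc (v s) _ y))

    score-outside : ∀ v y {s} → cell i s ≢ cell i ℓ → score (Y [ u ]≔ y) v s ≡ base v s
    score-outside v y {s} neq = cong (v s +_) (trans (noise-resample y s)
      (trans (cong (λ b → noise (Y [ u ]≔ 0) s + b * y) (⟦⟧-false (cell i s ≟ cell i ℓ) neq)) (+-identityʳ _)))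

  -- Raising one value by one unit: when the minimiser leaves a cell.

  module Raise (v v′ : S → ℕ) (ℓ : S) (raised : v′ ℓ ≡ suc (v ℓ)) (kept : ∀ {s} → s ≢ ℓ → v′ s ≡ v s) where

    before after : Vec ℕ M → S
    before Y = best Y v
    after  Y = best Y v′

    v≤v′ : ∀ s → v s ≤ v′ s
    v≤v′ s with cell 0 s ≟ cell 0 ℓ
    ... | yes eq rewrite cell-injective eq = ≤-trans (n≤1+n _) (≤-reflexive (sym raised))
    ... | no neq = ≤-reflexive (sym (kept (neq ∘ cong (cell 0))))

    score≤score′ : ∀ Y s → score Y v s ≤ score Y v′ s
    score≤score′ Y s = +-monoˡ-≤ _ (v≤v′ s)

    score-kept : ∀ Y {s} → s ≢ ℓ → score Y v′ s ≡ score Y v s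
    score-kept Y s≢ℓ = cong (_+ noise Y _) (kept s≢ℓ)

    score-raised : ∀ Y → score Y v′ ℓ ≡ suc (score Y v ℓ)
    score-raised Y = cong (_+ noise Y ℓ) raised

    tie-kept : ∀ Y {s} → s ≢ ℓ → tie (score Y v′) s ≡ tie (score Y v) s
    tie-kept Y {s} s≢ℓ = cong (λ e → e * R + cell 0 s) (score-kept Y s≢ℓ)

    tie≤tie′ : ∀ Y s → tie (score Y v) s ≤ tie (score Y v′) s
    tie≤tie′ Y s = +-monoˡ-≤ (cell 0 s) (*-monoˡ-≤ R (score≤score′ Y s))

    -- A minimiser other than `ℓ` keeps its score while no competitor improves, and `tie` leaves no
    -- room for a second minimiser.
    moved⇒before≡ℓ : ∀ Y → before Y ≢ after Y → before Y ≡ ℓ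
    moved⇒before≡ℓ Y b≢a = by-cases (cell 0 (before Y) ≟ cell 0 ℓ) cell-injective
      λ n → contradiction (tie-injective (score Y v) (≤-antisym
      (best-least Y v (after Y))
      (≤-trans (tie≤tie′ Y (after Y))
      (≤-trans (best-least Y v′ (before Y)) (≤-reflexive (tie-kept Y (n ∘ cong (cell 0)))))))) b≢a

    rise : Vec ℕ M → ℕ
    rise Y = low Y v′ ∸ low Y v

    low≤low′ : ∀ Y → low Y v ≤ low Y v′
    low≤low′ Y = ≤-trans (low≤ Y v (after Y)) (score≤score′ Y (after Y))

    low′≡ : ∀ Y → low Y v′ ≡ rise Y + low Y v
    low′≡ Y = sym (m∸n+n≡m (low≤low′ Y))

    cellLow≤cellLow′ : ∀ Y i s → cellLow Y v i s ≤ cellLow Y v′ i s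
    cellLow≤cellLow′ Y i s = ≤-trans (cellLow≤ Y v i s (cellBest-cell Y v′ i s)) (score≤score′ Y _)

    cellRise : Vec ℕ M → ℕ → ℕ
    cellRise Y i = cellLow Y v′ i ℓ ∸ cellLow Y v i ℓ

    -- Requiring a common parent attributes each move to its highest separating level only, as
    -- `dist≤2*exits` allows.
    exit : ℕ → Vec ℕ M → ℕ
    exit i Y = ⟦ cell (suc i) (before Y) ≟ cell (suc i) (after Y) ⟧ * ⟦ cell i (before Y) ≟ cell i (after Y) ⟧ᶜ

    -- Weaker than `before Y ≡ ℓ`, and chosen so: once the other coordinates permit an exit, no
    -- value of the coordinate of the level-`i` cell of `ℓ` can falsify it (`stays-near`).
    near : ℕ → Vec ℕ M → ℕ
    near i Y = ⟦ cell (suc i) (before Y) ≟ cell (suc i) ℓ ⟧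

    exit≤1 : ∀ i Y → exit i Y ≤ 1
    exit≤1 i Y = *-mono-≤ (⟦⟧≤1 (cell (suc i) (before Y) ≟ cell (suc i) (after Y)))
                          (⟦⟧ᶜ≤1 (cell i (before Y) ≟ cell i (after Y)))

    exit≢0 : ∀ i Y → exit i Y ≢ 0 →
             cell (suc i) (before Y) ≡ cell (suc i) (after Y) × cell i (before Y) ≢ cell i (after Y)
    exit≢0 i Y = ⟦⟧*⟦⟧ᶜ≢0 (cell (suc i) (before Y) ≟ cell (suc i) (after Y)) (cell i (before Y) ≟ cell i (after Y))

    module Line (i : ℕ) (i<H : i < H) (Y : Vec ℕ M) where
      open Resample i i<H ℓ Y

      at : ℕ → Vec ℕ M
      at y = Y [ u ]≔ y

      record Exits (y : ℕ) : Set where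
        field
          before≡ℓ  : before (at y) ≡ ℓ
          outside   : cell i (after (at y)) ≢ cell i ℓ
          sameAbove : cell (suc i) (after (at y)) ≡ cell (suc i) ℓ

      exits : ∀ y → exit i (at y) ≢ 0 → Exits y
      exits y e≢0 = record
        { before≡ℓ  = b≡ℓ
        ; outside   = λ eq → proj₂ pq (trans (cong (cell i) b≡ℓ) (sym eq))
        ; sameAbove = trans (sym (proj₁ pq)) (cong (cell (suc i)) b≡ℓ) }
        where
        pq = exit≢0 i (at y) e≢0
        b≡ℓ = moved⇒before≡ℓ (at y) (proj₂ pq ∘ cong (cell i))

      base-raised : base v′ ℓ ≡ suc (base v ℓ)
      base-raised = score-raised (Y [ u ]≔ 0)

      outside≢ℓ : ∀ {s} → cell i s ≢ cell i ℓ → s ≢ ℓ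
      outside≢ℓ neq eq = neq (cong (cell i) eq)

      module _ {y₀} (ex : Exits y₀) where
        open Exits ex
        ℓ-least : ∀ t → tie (score (at y₀) v) ℓ ≤ tie (score (at y₀) v) t
        ℓ-least t = subst (λ x → tie (score (at y₀) v) x ≤ tie (score (at y₀) v) t) before≡ℓ (best-least (at y₀) v t)

        ℓ-low : ∀ t → base v ℓ + y₀ ≤ score (at y₀) v t
        ℓ-low t = subst (_≤ score (at y₀) v t) (score-inside v y₀ refl) (tie-≤⇒≤ (score (at y₀) v) (ℓ-least t))

        -- A tie inside the cell would force the new minimiser between two members of the cell.
        inside-raised : ∀ {t} → cell i t ≡ cell i ℓ → suc (base v ℓ) ≤ base v′ t
        inside-raised {t} t∈u with cell 0 t ≟ cell 0 ℓ
        ... | yes eq rewrite cell-injective eq = ≤-reflexive (sym base-raised)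
        ... | no neq = ≰⇒> λ bt≤bℓ → outside (≤-antisym
              (subst (cell i x ≤_) t∈u (cell-mono i (tie-≤⇒rank (score (at y₀) v′) (best-least (at y₀) v′ t)
                (≤-trans (ft≤fℓ bt≤bℓ) fℓ≤fx))))
              (cell-mono i (tie-≤⇒rank (score (at y₀) v) (ℓ-least x)
                (≤-trans (≤-reflexive (sym (score-kept (at y₀) (outside≢ℓ outside))))
                  (≤-trans (tie-≤⇒≤ (score (at y₀) v′) (best-least (at y₀) v′ t))
                    (≤-trans (ft≤fℓ bt≤bℓ) (≤-reflexive (sym (score-inside v y₀ refl)))))))))
          where
          x = after (at y₀)
          ft≤fℓ : base v′ t ≤ base v ℓ → score (at y₀) v′ t ≤ base v ℓ + y₀
          ft≤fℓ p = ≤-trans (≤-reflexive (score-inside v′ y₀ t∈u)) (+-monoˡ-≤ y₀ p)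
          fℓ≤fx : base v ℓ + y₀ ≤ score (at y₀) v′ x
          fℓ≤fx = ≤-trans (ℓ-low x) (score≤score′ (at y₀) x)

        -- The coordinate shifts all members of the cell alike, so the comparison of `ℓ` with its
        -- cell mates that an exit at `y₀` reveals is valid at every `y`.
        cellRise≥1 : ∀ y → 1 ≤ cellRise (at y) i
        cellRise≥1 y = m<n⇒0<n∸m (begin-strict
          cellLow (at y) v i ℓ                   ≤⟨ cellLow≤ (at y) v i ℓ refl ⟩
          score (at y) v ℓ                       ≡⟨ score-inside v y refl ⟩
          base v ℓ + y                           <⟨ +-monoˡ-≤ y (inside-raised eq) ⟩
          base v′ (cellBest (at y) v′ i ℓ) + y   ≡⟨ score-inside v′ y eq ⟨
          cellLow (at y) v′ i ℓ                  ∎)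
          where
          open ≤-Reasoning
          eq = cellBest-cell (at y) v′ i ℓ

        -- Neither the coordinate nor the raise touches states outside the cell, so their best one
        -- is where the exit at `y₀` leads, whatever `y` is.
        outside-best : ∀ y {t} → cell i t ≢ cell i ℓ →
                       tie (score (at y) v) (after (at y₀)) ≤ tie (score (at y) v) t
        outside-best y {t} t∉u = begin
          tie (score (at y) v) x      ≡⟨ cong (λ e → e * R + cell 0 x)
                                           (trans (score-outside v y outside) (sym (score-outside v y₀ outside))) ⟩
          tie (score (at y₀) v) x     ≡⟨ tie-kept (at y₀) (outside≢ℓ outside) ⟨
          tie (score (at y₀) v′) x    ≤⟨ best-least (at y₀) v′ t ⟩
          tie (score (at y₀) v′) t    ≡⟨ tie-kept (at y₀) (outside≢ℓ t∉u) ⟩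
          tie (score (at y₀) v) t     ≡⟨ cong (λ e → e * R + cell 0 t)
                                           (trans (score-outside v y₀ t∉u) (sym (score-outside v y t∉u))) ⟩
          tie (score (at y) v) t      ∎
          where
          open ≤-Reasoning
          x = after (at y₀)

        -- Inside the cell of `ℓ` nesting suffices; outside it the only candidate is
        -- `after (at y₀)`, which an exit keeps in the parent cell.
        stays-near : ∀ y → near i (at y) ≡ 1
        stays-near y = ⟦⟧-true (cell (suc i) b ≟ cell (suc i) ℓ) near′
          where
          b = before (at y)
          near′ : cell (suc i) b ≡ cell (suc i) ℓ
          near′ = by-cases (cell i b ≟ cell i ℓ) (cell-nested i)
            λ neq → trans (cong (cell (suc i)) (tie-injective (score (at y) v)
              (≤-antisym (best-least (at y) v (after (at y₀))) (outside-best y neq)))) sameAbove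

        -- At `y₀` the state `ℓ` is still minimal. Lowering the coordinate to `y` opens a gap of at
        -- least one between `ℓ` and everything outside the cell, and inside it `inside-raised`
        -- gives the same gap.
        rise≥1 : ∀ {y} → y < y₀ → 1 ≤ rise (at y)
        rise≥1 {y} y<y₀ = m<n⇒0<n∸m (begin-strict
          low (at y) v            ≤⟨ low≤ (at y) v ℓ ⟩
          score (at y) v ℓ        ≡⟨ score-inside v y refl ⟩
          base v ℓ + y            <⟨ bound ⟩
          low (at y) v′           ∎)
          where
          open ≤-Reasoning
          x = after (at y)
          bound : suc (base v ℓ + y) ≤ low (at y) v′
          bound = by-cases (cell i x ≟ cell i ℓ)
            (λ eq → subst (suc (base v ℓ + y) ≤_) (sym (score-inside v′ y eq)) (+-monoˡ-≤ y (inside-raised eq)))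
            λ neq → begin
            suc (base v ℓ + y)      ≡⟨ +-suc (base v ℓ) y ⟨
            base v ℓ + suc y        ≤⟨ +-monoʳ-≤ (base v ℓ) y<y₀ ⟩
            base v ℓ + y₀           ≤⟨ ℓ-low x ⟩
            score (at y₀) v x       ≡⟨ trans (score-outside v y₀ neq) (sym (score-outside v y neq)) ⟩
            score (at y) v x        ≤⟨ score≤score′ (at y) x ⟩
            score (at y) v′ x       ∎

        -- A second exit at `y < y₀`, leading to `x`, would force an exact tie: `x` has the score of
        -- the raised `ℓ` at `y` and of the old `ℓ` at `y₀`. The tie is broken for `x` in the first
        -- case and for `ℓ` in the second.
        no-earlier-exit : ∀ {y} → y < y₀ → ¬ Exits y
        no-earlier-exit {y} y<y₀ ex′ = outside≢ℓ x∉u (cell-injective (≤-antisym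
          (tie-≤⇒rank (score (at y) v′) (best-least (at y) v′ ℓ) fℓ≤fx)
          (tie-≤⇒rank (score (at y₀) v) (ℓ-least x) (≤-trans fx≤ (≤-reflexive (sym (score-inside v y₀ refl)))))))
          where
          open ≤-Reasoning
          x = after (at y)
          x∉u = Exits.outside ex′
          x-same : score (at y₀) v x ≡ score (at y) v′ x
          x-same = trans (score-outside v y₀ x∉u)
                         (trans (sym (score-outside v y x∉u)) (sym (score-kept (at y) (outside≢ℓ x∉u))))
          fℓ : score (at y) v′ ℓ ≡ base v ℓ + suc y
          fℓ = trans (score-inside v′ y refl) (trans (cong (_+ y) base-raised) (sym (+-suc _ y)))
          fℓ≤fx : score (at y) v′ ℓ ≤ score (at y) v′ x
          fℓ≤fx = begin
            score (at y) v′ ℓ   ≡⟨ fℓ ⟩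
            base v ℓ + suc y    ≤⟨ +-monoʳ-≤ (base v ℓ) y<y₀ ⟩
            base v ℓ + y₀       ≤⟨ ℓ-low x ⟩
            score (at y₀) v x   ≡⟨ x-same ⟩
            score (at y) v′ x   ∎
          fx≤ : score (at y₀) v x ≤ base v ℓ + y₀
          fx≤ = begin
            score (at y₀) v x   ≡⟨ x-same ⟩
            score (at y) v′ x   ≤⟨ low≤ (at y) v′ ℓ ⟩
            score (at y) v′ ℓ   ≡⟨ fℓ ⟩
            base v ℓ + suc y    ≤⟨ +-monoʳ-≤ (base v ℓ) y<y₀ ⟩
            base v ℓ + y₀       ∎

    -- Resample only the coordinate of the level-i cell of ℓ.
    exit-bound : ∀ (cap : Fin M → ℕ) (wt : Fin M → ℕ → ℕ) i → i < H → ∀ m →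
      (∀ {y} → y < cap (node i ℓ) → wt (node i ℓ) y * m ≤ ∑ (downFrom y) (wt (node i ℓ)) + m) →
      let tot = ∑ (downFrom (cap (node i ℓ))) (wt (node i ℓ)) in
      m * tot * 𝔼 cap wt (exit i) ≤ tot * 𝔼 cap wt rise + m * 𝔼 cap wt (λ Y → near i Y * cellRise Y i)
    exit-bound cap wt i i<H m grows = begin
      m * tot * 𝔼 cap wt (exit i)
        ≡⟨ 𝔼-*ˡ cap wt (m * tot) (exit i) ⟨
      𝔼 cap wt (λ Y → m * tot * exit i Y)
        ≤⟨ resample-≤ cap wt u line ⟩
      𝔼 cap wt (λ Y → tot * rise Y + m * (near i Y * cellRise Y i))
        ≡⟨ 𝔼-+ cap wt _ _ ⟩
      _ ≡⟨ cong₂ _+_ (𝔼-*ˡ cap wt tot rise) (𝔼-*ˡ cap wt m _) ⟩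
      tot * 𝔼 cap wt rise + m * 𝔼 cap wt (λ Y → near i Y * cellRise Y i) ∎
      where
      open ≤-Reasoning
      u = node i ℓ
      w = wt u
      ys = downFrom (cap u)
      tot = ∑ ys w
      line : ∀ Y → ∑ ys (λ y → w y * (m * tot * exit i (Y [ u ]≔ y)))
                 ≤ ∑ ys (λ y → w y * (tot * rise (Y [ u ]≔ y)
                                      + m * (near i (Y [ u ]≔ y) * cellRise (Y [ u ]≔ y) i)))
      line Y = unique-exit-bound (cap u) w m (λ y → exit i (at y)) (λ y → rise (at y))
        (λ y → near i (at y) * cellRise (at y) i) grows (λ y → exit≤1 i (at y))
        (λ {y₀} e≢0 → let ex = exits y₀ e≢0 in
            (λ y → ≤-trans (cellRise≥1 ex y)
                     (≤-reflexive (sym (trans (cong (_* cellRise (at y) i) (stays-near ex y)) (*-identityˡ _)))))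
          , rise≥1 ex
          , no-exit ex)
        where
        open Line i i<H Y
        no-exit : ∀ {y₀} → Exits y₀ → ∀ {y} → y < y₀ → exit i (at y) ≡ 0
        no-exit ex {y} y<y₀ = by-cases (exit i (at y) ≟ 0) id
          λ neq → contradiction (exits y neq) (no-earlier-exit ex y<y₀)

  cellLow-cong : ∀ Y v i {s t} → cell i s ≡ cell i t → cellLow Y v i s ≡ cellLow Y v i t
  cellLow-cong Y v i {s} {t} eq = ≤-antisym
    (cellLow≤ Y v i s (trans (cellBest-cell Y v i t) (sym eq)))
    (cellLow≤ Y v i t (trans (cellBest-cell Y v i s) eq))

  ∈-members⁻ : ∀ i e {s} → s ∈ members i e → cell i s ≡ e
  ∈-members⁻ i e s∈ = proj₂ (∈-filter⁻ (λ t → cell i t ≟ e) {xs = states} s∈)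

  count : ℕ → S → ℕ
  count i s = length (mates i s)

  count≤count-suc : ∀ i s → count i s ≤ count (suc i) s
  count≤count-suc i s rewrite length-filter (λ t → cell i t ≟ cell i s) states
                            | length-filter (λ t → cell (suc i) t ≟ cell (suc i) s) states =
    ∑-mono states λ {t} _ → step t
    where
    step : ∀ t → ⟦ cell i t ≟ cell i s ⟧ ≤ ⟦ cell (suc i) t ≟ cell (suc i) s ⟧
    step t with cell i t ≟ cell i s
    ... | no  _  = z≤n
    ... | yes eq = ≤-reflexive (sym (⟦⟧-true (cell (suc i) t ≟ cell (suc i) s) (cell-nested i eq)))

  -- The potential that pays for the truncation.

  module Potential (lam : ℕ → ℕ) (K W : ℕ) (q : ℕ → S → ℕ)
    (q-cong : ∀ i {s t} → cell (suc i) s ≡ cell (suc i) t → q i s ≡ q i t)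
    (q-count : ∀ i s → q i s * count (suc i) s ≤ W)
    where
    open Metric H cell lam
    open Nested cell-nested

    -- Limits how far a score in the level-`i` cell of the minimiser can exceed the minimum: the
    -- distance counts twice, for the work function and for the noise, and `K` is the slack of
    -- `Lipschitz`.
    width : ℕ → ℕ
    width i = K + 2 * ∑ (downFrom i) lam

    -- `q i` stands for `W` over the size of the parent cell, up to rounding. The average runs over
    -- states rather than child cells, so that a rise of one child cell counts by its share of the
    -- states.
    level : Vec ℕ M → (S → ℕ) → ℕ → ℕ
    level Y v i = q i (best Y v) * ∑ (mates (suc i) (best Y v)) (λ s → cellLow Y v i s ∸ low Y v)

    -- Pays for the error term of exit-bound: along the cells containing the current state, Ψ
    -- averages how far the minimum over each child cell lies above the global minimum.
    Ψ : Vec ℕ M → (S → ℕ) → ℕ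
    Ψ Y v = ∑ (downFrom H) (level Y v)

    -- The slack `K` admits every function between a work function and its update by one request.
    Lipschitz : (S → ℕ) → Set
    Lipschitz v = ∀ s t → v s ≤ v t + K + dist s t

    Small : Vec ℕ M → Set
    Small Y = ∀ {i} s → i < H → lookup Y (node i s) < lam i

    module _ {Y} (small : Small Y) where

      noise-step : ∀ {i} s t → i < H → lookup Y (node i s) ≤ lookup Y (node i t) + lam i * differ? i s t
      noise-step {i} s t i<H with cell i s ≟ cell i t
      ... | yes eq = ≤-trans (≤-reflexive (cong (lookup Y) (node-cong i eq))) (m≤m+n _ _)
      ... | no  _  = ≤-trans (<⇒≤ (small s i<H)) (≤-trans (≤-reflexive (sym (*-identityʳ (lam i)))) (m≤n+m _ _))

      noise-Lipschitz : ∀ s t → noise Y s ≤ noise Y t + dist s t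
      noise-Lipschitz s t = ≤-trans (∑-mono (downFrom H) λ {j} j∈ → noise-step s t (∈-downFrom⁻ j∈))
                                    (≤-reflexive (∑-distrib-+ (downFrom H) _ _))

      -- Distinct states are separated at level 0, and there the noise is strictly below `lam 0`.
      -- Strictness lets dominated states lose without recourse to tie-breaking.
      noise-strict : 0 < H → ∀ {s t} → s ≢ t → noise Y s < noise Y t + dist s t
      noise-strict 0<H {s} {t} s≢t = <-≤-trans
        (∑-mono-< (∈-downFrom⁺ 0<H) (λ {j} j∈ → noise-step s t (∈-downFrom⁻ j∈)) bottom)
        (≤-reflexive (∑-distrib-+ (downFrom H) _ _))
        where
        bottom : lookup Y (node 0 s) < lookup Y (node 0 t) + lam 0 * differ? 0 s t
        bottom with cell 0 s ≟ cell 0 t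
        ... | yes eq = contradiction (cell-injective eq) s≢t
        ... | no  _  = <-≤-trans (small s 0<H) (≤-trans (≤-reflexive (sym (*-identityʳ (lam 0)))) (m≤n+m _ _))

      range : ∀ {v} → Lipschitz v → ∀ i j {s} → cell j s ≡ cell j (best Y v) →
              cellLow Y v i s ∸ low Y v ≤ width j
      range {v} lip i j {s} eq = m≤n+o⇒m∸n≤o (cellLow Y v i s) (low Y v) (begin
        cellLow Y v i s                                ≤⟨ cellLow≤ Y v i s refl ⟩
        v s + noise Y s                                ≤⟨ +-mono-≤ (lip s x) (noise-Lipschitz s x) ⟩
        v x + K + dist s x + (noise Y x + dist s x)    ≤⟨ +-mono-≤ (+-monoʳ-≤ (v x + K) d≤) (+-monoʳ-≤ (noise Y x) d≤) ⟩
        v x + K + p + (noise Y x + p)                  ≡⟨ regroup (v x) K p (noise Y x) ⟩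
        v x + noise Y x + (K + 2 * p)                  ∎)
        where
        open ≤-Reasoning
        x = best Y v
        p = ∑ (downFrom j) lam
        d≤ : dist s x ≤ p
        d≤ = dist≤prefix j eq
        regroup : ∀ a k p n → a + k + p + (n + p) ≡ a + n + (k + 2 * p)
        regroup = solve-∀

      level≤ : ∀ {v} → Lipschitz v → ∀ i → level Y v i ≤ W * width (suc i)
      level≤ {v} lip i = begin
        q i x * ∑ ms (λ s → cellLow Y v i s ∸ low Y v)
          ≤⟨ *-monoʳ-≤ (q i x) (∑≤∑*ʳ ms λ {s} s∈ → range lip i (suc i) (∈-members⁻ (suc i) (cell (suc i) x) s∈)) ⟩
        q i x * (count (suc i) x * width (suc i))
          ≡⟨ *-assoc (q i x) _ _ ⟨
        q i x * count (suc i) x * width (suc i)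
          ≤⟨ *-monoˡ-≤ (width (suc i)) (q-count i x) ⟩
        W * width (suc i) ∎
        where
        open ≤-Reasoning
        x = best Y v
        ms = mates (suc i) x

    module Step (v v′ : S → ℕ) (ℓ : S) (raised : v′ ℓ ≡ suc (v ℓ)) (kept : ∀ {s} → s ≢ ℓ → v′ s ≡ v s) where
      open Raise v v′ ℓ raised kept

      cellRise≤1 : ∀ Y i → cellRise Y i ≤ 1
      cellRise≤1 Y i = m≤n+o⇒m∸n≤o (cellLow Y v′ i ℓ) (cellLow Y v i ℓ) (begin
        cellLow Y v′ i ℓ                     ≤⟨ cellLow≤ Y v′ i ℓ (cellBest-cell Y v i ℓ) ⟩
        score Y v′ b                         ≤⟨ bound ⟩
        suc (score Y v b)                    ≡⟨ +-comm 1 _ ⟩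
        cellLow Y v i ℓ + 1                  ∎)
        where
        open ≤-Reasoning
        b = cellBest Y v i ℓ
        bound : score Y v′ b ≤ suc (score Y v b)
        bound = by-cases (cell 0 b ≟ cell 0 ℓ)
          (λ eq → subst (λ x → score Y v′ x ≤ suc (score Y v x)) (sym (cell-injective eq)) (≤-reflexive (score-raised Y)))
          λ neq → ≤-trans (≤-reflexive (score-kept Y (neq ∘ cong (cell 0)))) (n≤1+n _)

      inside : ℕ → S → ℕ
      inside i s = ⟦ cell i s ≟ cell i ℓ ⟧

      gap : Vec ℕ M → ℕ → S → ℕ
      gap Y i s = cellLow Y v i s ∸ low Y v

      gap′ : Vec ℕ M → ℕ → S → ℕ
      gap′ Y i s = cellLow Y v′ i s ∸ low Y v′

      cellLow-rise : ∀ Y i s → cellLow Y v i s + inside i s * cellRise Y i ≤ cellLow Y v′ i s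
      cellLow-rise Y i s = by-cases (cell i s ≟ cell i ℓ)
        (λ eq → ≤-reflexive (trans (cong₂ (λ a b → a + b * cellRise Y i) (cellLow-cong Y v i eq)
                                          (⟦⟧-true (cell i s ≟ cell i ℓ) eq))
                (trans (cong (cellLow Y v i ℓ +_) (*-identityˡ (cellRise Y i)))
                (trans (m+[n∸m]≡n (cellLow≤cellLow′ Y i ℓ)) (sym (cellLow-cong Y v′ i eq))))))
        λ neq → ≤-trans (≤-reflexive (trans (cong (λ b → cellLow Y v i s + b * cellRise Y i)
                                                  (⟦⟧-false (cell i s ≟ cell i ℓ) neq)) (+-identityʳ _)))
                        (cellLow≤cellLow′ Y i s)

      gap-rise : ∀ Y i s → gap Y i s + inside i s * cellRise Y i ≤ gap′ Y i s + rise Y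
      gap-rise Y i s = +-cancelʳ-≤ (low Y v) _ _ (begin
        gap Y i s + c + low Y v              ≡⟨ swap (gap Y i s) c (low Y v) ⟩
        gap Y i s + low Y v + c              ≡⟨ cong (_+ c) (m∸n+n≡m (low≤cellLow Y v i s)) ⟩
        cellLow Y v i s + c                  ≤⟨ cellLow-rise Y i s ⟩
        cellLow Y v′ i s                     ≡⟨ m∸n+n≡m (low≤cellLow Y v′ i s) ⟨
        gap′ Y i s + low Y v′                ≡⟨ cong (gap′ Y i s +_) (low′≡ Y) ⟩
        gap′ Y i s + (rise Y + low Y v)      ≡⟨ +-assoc (gap′ Y i s) _ _ ⟨
        gap′ Y i s + rise Y + low Y v        ∎)
        where
        open ≤-Reasoning
        c = inside i s * cellRise Y i
        swap : ∀ a b c → a + b + c ≡ a + c + b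
        swap = solve-∀

      members-rise : ∀ Y i e → ∑ (members (suc i) e) (gap Y i) + ∑ (members (suc i) e) (inside i) * cellRise Y i
                             ≤ ∑ (members (suc i) e) (gap′ Y i) + length (members (suc i) e) * rise Y
      members-rise Y i e = begin
        ∑ ms (gap Y i) + ∑ ms (inside i) * cellRise Y i
          ≡⟨ cong (∑ ms (gap Y i) +_) (trans (*-comm (∑ ms (inside i)) _)
               (trans (sym (∑-*ˡ ms (cellRise Y i) (inside i)))
                      (∑-cong ms λ {s} _ → *-comm (cellRise Y i) (inside i s)))) ⟩
        ∑ ms (gap Y i) + ∑ ms (λ s → inside i s * cellRise Y i)
          ≡⟨ ∑-distrib-+ ms _ _ ⟨
        ∑ ms (λ s → gap Y i s + inside i s * cellRise Y i)
          ≤⟨ ∑-mono ms (λ {s} _ → gap-rise Y i s) ⟩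
        ∑ ms (λ s → gap′ Y i s + rise Y)
          ≡⟨ trans (∑-distrib-+ ms _ _) (cong (∑ ms (gap′ Y i) +_) (∑-const ms (rise Y))) ⟩
        ∑ ms (gap′ Y i) + length ms * rise Y ∎
        where
        open ≤-Reasoning
        ms = members (suc i) e

      count-inside : ∀ i e → e ≡ cell (suc i) ℓ → count i ℓ ≤ ∑ (members (suc i) e) (inside i)
      count-inside i .(cell (suc i) ℓ) refl
        rewrite length-filter (λ t → cell i t ≟ cell i ℓ) states
              | ∑-filter (λ t → cell (suc i) t ≟ cell (suc i) ℓ) states (inside i) =
        ∑-mono states λ {s} _ → pointwise s
        where
        pointwise : ∀ s → inside i s ≤ ⟦ cell (suc i) s ≟ cell (suc i) ℓ ⟧ * inside i s
        pointwise s with cell i s ≟ cell i ℓ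
        ... | no  _  = z≤n
        ... | yes eq = ≤-reflexive (sym (trans (*-identityʳ _)
                         (⟦⟧-true (cell (suc i) s ≟ cell (suc i) ℓ) (cell-nested i eq))))

      -- What `level` gains when the level-`i` cell of `ℓ` rises near the minimiser, once for each
      -- of its `count i ℓ` states. Its expectation is a multiple of the error term of `exit-bound`.
      credit : ℕ → Vec ℕ M → ℕ
      credit i Y = q i ℓ * count i ℓ * (near i Y * cellRise Y i)

      credit≤W : ∀ i Y → credit i Y ≤ W
      credit≤W i Y = begin
        q i ℓ * count i ℓ * (near i Y * cellRise Y i)
          ≤⟨ *-mono-≤ (*-monoʳ-≤ (q i ℓ) (count≤count-suc i ℓ))
               (*-mono-≤ (⟦⟧≤1 (cell (suc i) (before Y) ≟ cell (suc i) ℓ)) (cellRise≤1 Y i)) ⟩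
        q i ℓ * count (suc i) ℓ * 1
          ≡⟨ *-identityʳ _ ⟩
        q i ℓ * count (suc i) ℓ
          ≤⟨ q-count i ℓ ⟩
        W ∎
        where open ≤-Reasoning

      near-count : ∀ i Y → q i ℓ * count i ℓ * (near i Y * cellRise Y i)
                 ≤ q i (before Y) * (∑ (mates (suc i) (before Y)) (inside i) * cellRise Y i)
      near-count i Y = by-cases near? close
        λ neq → ≤-trans (≤-reflexive (trans (cong (λ b → q i ℓ * count i ℓ * (b * cellRise Y i)) (⟦⟧-false near? neq))
                                            (*-zeroʳ (q i ℓ * count i ℓ)))) z≤n
        where
        open ≤-Reasoning
        near? = cell (suc i) (before Y) ≟ cell (suc i) ℓ
        close : cell (suc i) (before Y) ≡ cell (suc i) ℓ → q i ℓ * count i ℓ * (near i Y * cellRise Y i)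
              ≤ q i (before Y) * (∑ (mates (suc i) (before Y)) (inside i) * cellRise Y i)
        close eq = begin
          q i ℓ * count i ℓ * (near i Y * cellRise Y i)
            ≡⟨ cong (λ b → q i ℓ * count i ℓ * (b * cellRise Y i)) (⟦⟧-true near? eq) ⟩
          q i ℓ * count i ℓ * (1 * cellRise Y i)
            ≡⟨ trans (cong (q i ℓ * count i ℓ *_) (*-identityˡ (cellRise Y i))) (*-assoc (q i ℓ) _ _) ⟩
          q i ℓ * (count i ℓ * cellRise Y i)
            ≤⟨ *-mono-≤ (≤-reflexive (q-cong i (sym eq)))
                 (*-monoˡ-≤ (cellRise Y i) (count-inside i (cell (suc i) (before Y)) eq)) ⟩
          q i (before Y) * (∑ (mates (suc i) (before Y)) (inside i) * cellRise Y i) ∎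

      -- With the parent cell unchanged, the same states are summed before and after. Those in the
      -- cell of `ℓ` gain `cellRise`, and a rise of the global minimum costs each state at most
      -- `rise`, in total `W * rise` by `q-count`.
      level-stays : ∀ Y i → cell (suc i) (before Y) ≡ cell (suc i) (after Y) →
                    level Y v i + credit i Y ≤ level Y v′ i + W * rise Y
      level-stays Y i eq = begin
        q i b * ∑ ms (gap Y i) + credit i Y
          ≤⟨ +-monoʳ-≤ (q i b * ∑ ms (gap Y i)) (near-count i Y) ⟩
        q i b * ∑ ms (gap Y i) + q i b * (∑ ms (inside i) * cellRise Y i)
          ≡⟨ *-distribˡ-+ (q i b) _ _ ⟨
        q i b * (∑ ms (gap Y i) + ∑ ms (inside i) * cellRise Y i)
          ≤⟨ *-monoʳ-≤ (q i b) (members-rise Y i (cell (suc i) b)) ⟩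
        q i b * (∑ ms (gap′ Y i) + length ms * rise Y)
          ≡⟨ *-distribˡ-+ (q i b) _ _ ⟩
        q i b * ∑ ms (gap′ Y i) + q i b * (length ms * rise Y)
          ≡⟨ cong₂ _+_ (cong₂ (λ c e → c * ∑ (members (suc i) e) (gap′ Y i)) (q-cong i eq) eq)
                       (sym (*-assoc (q i b) _ _)) ⟩
        level Y v′ i + q i b * length ms * rise Y
          ≤⟨ +-monoʳ-≤ (level Y v′ i) (*-monoˡ-≤ (rise Y) (q-count i b)) ⟩
        level Y v′ i + W * rise Y ∎
        where
        open ≤-Reasoning
        b = before Y
        ms = mates (suc i) b

      -- If the minimiser leaves the parent cell, the sum runs over other states and the old value
      -- may be lost entirely; its a priori bound is charged to the move.
      level-step : ∀ {Y} → Small Y → Lipschitz v → ∀ i →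
        level Y v i + credit i Y ≤ level Y v′ i + W * rise Y
                                   + differ? (suc i) (before Y) (after Y) * (W * (width (suc i) + 1))
      level-step {Y} small lip i = by-cases same?
        (λ eq → ≤-trans (level-stays Y i eq) (m≤m+n _ _))
        λ neq → begin
          level Y v i + credit i Y                      ≤⟨ +-mono-≤ (level≤ {Y} small lip i) (credit≤W i Y) ⟩
          W * width (suc i) + W                         ≡⟨ expand W (width (suc i)) ⟩
          1 * (W * (width (suc i) + 1))                 ≡⟨ cong (_* (W * (width (suc i) + 1))) (⟦⟧ᶜ-false same? neq) ⟨
          shifted                                       ≤⟨ m≤n+m shifted (level Y v′ i + W * rise Y) ⟩
          level Y v′ i + W * rise Y + shifted           ∎
        where
        open ≤-Reasoning
        same? = cell (suc i) (before Y) ≟ cell (suc i) (after Y)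
        shifted = differ? (suc i) (before Y) (after Y) * (W * (width (suc i) + 1))
        expand : ∀ w a → w * a + w ≡ 1 * (w * (a + 1))
        expand = solve-∀

    -- Expected movement per unit of growth.

    module Amortised
      (double : ∀ i → 2 * lam i ≤ lam (suc i))
      (cell-top : ∀ s t → cell H s ≡ cell H t)
      (spread : ∀ i → 4 * (width (suc i) + 1) ≤ lam (suc i))
      (cap : Fin M → ℕ) (wt : Fin M → ℕ → ℕ)
      (cap≤lam : ∀ {i} s → i < H → cap (node i s) ≤ lam i)
      (m L : ℕ → S → ℕ)
      (m≥1 : ∀ {i} s → i < H → 1 ≤ m i s)
      (tot≥1 : ∀ c → 1 ≤ ∑ (downFrom (cap c)) (wt c))
      (grows : ∀ {i} s → i < H → ∀ {y} → y < cap (node i s) →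
               wt (node i s) y * m i s ≤ ∑ (downFrom y) (wt (node i s)) + m i s)
      (lam≤ : ∀ {i} s → i < H → lam i ≤ 2 * (L i s * m i s))
      (tot≥ : ∀ {i} s → i < H →
              16 * (lam i * W) ≤ ∑ (downFrom (cap (node i s))) (wt (node i s)) * (q i s * count i s))
      (Λ : ℕ) (∑L≤ : ∀ s → ∑ (downFrom H) (λ i → L i s) ≤ Λ)
      where
      open Geometric double cell-top

      𝔼′ : (Vec ℕ M → ℕ) → ℕ
      𝔼′ = 𝔼 cap wt

      bounded⇒small : ∀ Y → (∀ c → lookup Y c < cap c) → Small Y
      bounded⇒small Y bounded s i<H = <-≤-trans (bounded _) (cap≤lam s i<H)

      rate : ℕ
      rate = 128 * Λ + 4 * H

      module _ {v v′ : S → ℕ} {ℓ : S} (raised : v′ ℓ ≡ suc (v ℓ)) (kept : ∀ {s} → s ≢ ℓ → v′ s ≡ v s) where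
        open Raise v v′ ℓ raised kept
        open Step v v′ ℓ raised kept

        move : Vec ℕ M → ℕ
        move Y = dist (before Y) (after Y)

        credits : Vec ℕ M → ℕ
        credits Y = ∑ (downFrom H) (λ i → credit i Y)

        -- A lost level `i` means a separation at level `suc i`, where the move pays `lam (suc i)`.
        -- By `spread` this is four times the loss divided by `W`.
        shifts≤ : ∀ Y → 4 * ∑ (downFrom H) (λ i → differ? (suc i) (before Y) (after Y) * (W * (width (suc i) + 1)))
                      ≤ W * move Y
        shifts≤ Y = begin
          4 * ∑ (downFrom H) (λ i → differ? (suc i) b a * (W * (width (suc i) + 1)))
            ≡⟨ ∑-*ˡ (downFrom H) 4 _ ⟨
          ∑ (downFrom H) (λ i → 4 * (differ? (suc i) b a * (W * (width (suc i) + 1))))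
            ≤⟨ ∑-mono (downFrom H) (λ {i} _ → ≤-trans
                 (≤-reflexive (regroup (differ? (suc i) b a) W (width (suc i) + 1)))
                 (*-monoʳ-≤ W (*-monoˡ-≤ (differ? (suc i) b a) (spread i)))) ⟩
          ∑ (downFrom H) (λ i → W * (lam (suc i) * differ? (suc i) b a))
            ≡⟨ ∑-*ˡ (downFrom H) W _ ⟩
          W * ∑ (downFrom H) (λ i → lam (suc i) * differ? (suc i) b a)
            ≤⟨ *-monoʳ-≤ W (shifted-dist b a) ⟩
          W * dist b a ∎
          where
          open ≤-Reasoning
          b = before Y
          a = after Y
          regroup : ∀ d w x → 4 * (d * (w * x)) ≡ w * (4 * x * d)
          regroup = solve-∀

        potential-step : ∀ {Y} → Small Y → Lipschitz v →
          4 * Ψ Y v + 4 * credits Y ≤ 4 * Ψ Y v′ + 4 * (H * (W * rise Y)) + W * move Y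
        potential-step {Y} small lip = begin
          4 * Ψ Y v + 4 * credits Y
            ≡⟨ *-distribˡ-+ 4 (Ψ Y v) (credits Y) ⟨
          4 * (Ψ Y v + credits Y)
            ≡⟨ cong (4 *_) (∑-distrib-+ (downFrom H) _ _) ⟨
          4 * ∑ (downFrom H) (λ i → level Y v i + credit i Y)
            ≤⟨ *-monoʳ-≤ 4 (∑-mono (downFrom H) λ {i} _ → level-step {Y} small lip i) ⟩
          4 * ∑ (downFrom H) (λ i → level Y v′ i + W * rise Y + shifted i)
            ≡⟨ cong (4 *_) (trans (∑-distrib-+ (downFrom H) _ _) (cong (_+ ∑ (downFrom H) shifted)
                 (trans (∑-distrib-+ (downFrom H) _ _)
                   (cong (Ψ Y v′ +_) (trans (∑-const (downFrom H) (W * rise Y)) (cong (_* (W * rise Y)) (length-downFrom H))))))) ⟩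
          4 * (Ψ Y v′ + H * (W * rise Y) + ∑ (downFrom H) shifted)
            ≡⟨ distribute (Ψ Y v′) (H * (W * rise Y)) (∑ (downFrom H) shifted) ⟩
          4 * Ψ Y v′ + 4 * (H * (W * rise Y)) + 4 * ∑ (downFrom H) shifted
            ≤⟨ +-monoʳ-≤ (4 * Ψ Y v′ + 4 * (H * (W * rise Y))) (shifts≤ Y) ⟩
          4 * Ψ Y v′ + 4 * (H * (W * rise Y)) + W * move Y ∎
          where
          open ≤-Reasoning
          shifted : ℕ → ℕ
          shifted i = differ? (suc i) (before Y) (after Y) * (W * (width (suc i) + 1))
          distribute : ∀ a b c → 4 * (a + b + c) ≡ 4 * a + 4 * b + 4 * c
          distribute = solve-∀

        𝔼-potential-step : Lipschitz v →
          4 * 𝔼′ (λ Y → Ψ Y v) + 4 * 𝔼′ credits ≤ 4 * 𝔼′ (λ Y → Ψ Y v′) + 4 * (H * (W * 𝔼′ rise)) + W * 𝔼′ move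
        𝔼-potential-step lip = begin
          4 * 𝔼′ (λ Y → Ψ Y v) + 4 * 𝔼′ credits
            ≡⟨ sym (trans (𝔼-+ cap wt _ _) (cong₂ _+_ (𝔼-*ˡ cap wt 4 _) (𝔼-*ˡ cap wt 4 _))) ⟩
          𝔼′ (λ Y → 4 * Ψ Y v + 4 * credits Y)
            ≤⟨ 𝔼-mono cap wt (λ Y bounded → potential-step {Y} (bounded⇒small Y bounded) lip) ⟩
          𝔼′ (λ Y → 4 * Ψ Y v′ + 4 * (H * (W * rise Y)) + W * move Y)
            ≡⟨ trans (𝔼-+ cap wt _ _) (cong₂ _+_ (trans (𝔼-+ cap wt _ _)
                 (cong₂ _+_ (𝔼-*ˡ cap wt 4 _) (trans (𝔼-*ˡ cap wt 4 _)
                   (cong (4 *_) (trans (𝔼-*ˡ cap wt H _) (cong (H *_) (𝔼-*ˡ cap wt W rise)))))))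
                 (𝔼-*ˡ cap wt W move)) ⟩
          4 * 𝔼′ (λ Y → Ψ Y v′) + 4 * (H * (W * 𝔼′ rise)) + W * 𝔼′ move ∎
          where open ≤-Reasoning

        -- `exit-bound` divided by `m * tot`. The rise then costs `lam / m`, at most `2 * L` by
        -- `lam≤`, and `tot≥` makes the truncation error no larger than the credit. The division is
        -- postponed to the cancellation of `mᵢ * tot`.
        exit-credit : ∀ {i} → i < H →
          16 * (W * (lam i * 𝔼′ (exit i))) ≤ 32 * (W * (L i ℓ * 𝔼′ rise)) + 𝔼′ (credit i)
        exit-credit {i} i<H = *-cancelˡ-≤ (mᵢ * tot) {{>-nonZero (*-mono-≤ (m≥1 ℓ i<H) (tot≥1 (node i ℓ)))}} (begin
          mᵢ * tot * (16 * (W * (lam i * e)))                 ≡⟨ front mᵢ tot W (lam i) e ⟩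
          16 * (W * lam i) * (mᵢ * tot * e)                   ≤⟨ *-monoʳ-≤ (16 * (W * lam i))
                                                                   (exit-bound cap wt i i<H mᵢ (grows ℓ i<H)) ⟩
          16 * (W * lam i) * (tot * r + mᵢ * n)               ≡⟨ spread-out W (lam i) tot r mᵢ n ⟩
          16 * (W * (tot * r)) * lam i + 16 * (lam i * W) * (mᵢ * n)
            ≤⟨ +-mono-≤ (*-monoʳ-≤ (16 * (W * (tot * r))) (lam≤ ℓ i<H)) (*-monoˡ-≤ (mᵢ * n) (tot≥ ℓ i<H)) ⟩
          16 * (W * (tot * r)) * (2 * (L i ℓ * mᵢ)) + tot * (q i ℓ * count i ℓ) * (mᵢ * n)
                                                              ≡⟨ back W tot r (L i ℓ) mᵢ (q i ℓ * count i ℓ) n ⟩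
          mᵢ * tot * (32 * (W * (L i ℓ * r)) + q i ℓ * count i ℓ * n)
                                                              ≡⟨ cong (λ c → mᵢ * tot * (32 * (W * (L i ℓ * r)) + c))
                                                                   (𝔼-*ˡ cap wt (q i ℓ * count i ℓ) _) ⟨
          mᵢ * tot * (32 * (W * (L i ℓ * r)) + 𝔼′ (credit i)) ∎)
          where
          open ≤-Reasoning
          mᵢ = m i ℓ
          tot = ∑ (downFrom (cap (node i ℓ))) (wt (node i ℓ))
          e = 𝔼′ (exit i)
          r = 𝔼′ rise
          n = 𝔼′ (λ Y → near i Y * cellRise Y i)
          front : ∀ m t w l e → m * t * (16 * (w * (l * e))) ≡ 16 * (w * l) * (m * t * e)
          front = solve-∀
          spread-out : ∀ w l t r m n → 16 * (w * l) * (t * r + m * n) ≡ 16 * (w * (t * r)) * l + 16 * (l * w) * (m * n)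
          spread-out = solve-∀
          back : ∀ w t r l m g n → 16 * (w * (t * r)) * (2 * (l * m)) + t * g * (m * n)
                                 ≡ m * t * (32 * (w * (l * r)) + g * n)
          back = solve-∀

        𝔼-move : 8 * (W * 𝔼′ move) ≤ 32 * (W * (Λ * 𝔼′ rise)) + 𝔼′ credits
        𝔼-move = begin
          8 * (W * 𝔼′ move)
            ≤⟨ *-monoʳ-≤ 8 (*-monoʳ-≤ W (𝔼-mono cap wt λ Y _ → dist≤2*exits (before Y) (after Y))) ⟩
          8 * (W * 𝔼′ (λ Y → 2 * ∑ (downFrom H) (λ i → lam i * exit i Y)))
            ≡⟨ cong (λ e → 8 * (W * e)) (trans (𝔼-*ˡ cap wt 2 _) (cong (2 *_)
                 (trans (𝔼-∑ cap wt (downFrom H) _) (∑-cong (downFrom H) λ {i} _ → 𝔼-*ˡ cap wt (lam i) (exit i))))) ⟩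
          8 * (W * (2 * ∑ (downFrom H) (λ i → lam i * 𝔼′ (exit i))))
            ≡⟨ trans (sixteen W _) (trans (cong (16 *_) (sym (∑-*ˡ (downFrom H) W _))) (sym (∑-*ˡ (downFrom H) 16 _))) ⟩
          ∑ (downFrom H) (λ i → 16 * (W * (lam i * 𝔼′ (exit i))))
            ≤⟨ ∑-mono (downFrom H) (λ {i} i∈ → exit-credit (∈-downFrom⁻ i∈)) ⟩
          ∑ (downFrom H) (λ i → 32 * (W * (L i ℓ * 𝔼′ rise)) + 𝔼′ (credit i))
            ≡⟨ trans (∑-distrib-+ (downFrom H) _ _) (cong₂ _+_
                 (trans (∑-cong (downFrom H) λ {i} _ → regroup W (L i ℓ) (𝔼′ rise))
                   (trans (∑-*ˡ (downFrom H) (32 * (W * 𝔼′ rise)) _) (ungroup W (𝔼′ rise) (∑ (downFrom H) λ i → L i ℓ))))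
                 (sym (𝔼-∑ cap wt (downFrom H) _))) ⟩
          32 * (W * (∑ (downFrom H) (λ i → L i ℓ) * 𝔼′ rise)) + 𝔼′ credits
            ≤⟨ +-monoˡ-≤ (𝔼′ credits) (*-monoʳ-≤ 32 (*-monoʳ-≤ W (*-monoˡ-≤ (𝔼′ rise) (∑L≤ ℓ)))) ⟩
          32 * (W * (Λ * 𝔼′ rise)) + 𝔼′ credits ∎
          where
          open ≤-Reasoning
          sixteen : ∀ w x → 8 * (w * (2 * x)) ≡ 16 * (w * x)
          sixteen = solve-∀
          regroup : ∀ w l r → 32 * (w * (l * r)) ≡ 32 * (w * r) * l
          regroup = solve-∀
          ungroup : ∀ w r l → 32 * (w * r) * l ≡ 32 * (w * (l * r))
          ungroup = solve-∀

        unit-step : Lipschitz v →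
          W * 𝔼′ move + (4 * 𝔼′ (λ Y → Ψ Y v) + W * (rate * 𝔼′ (λ Y → low Y v)))
          ≤ 4 * 𝔼′ (λ Y → Ψ Y v′) + W * (rate * 𝔼′ (λ Y → low Y v′))
        unit-step lip = subst (λ z → W * 𝔼′ move + (4 * p + W * (rate * l)) ≤ 4 * p′ + W * (rate * z)) (sym low′)
          (assemble W Λ H (𝔼′ move) p p′ r l (𝔼′ credits) (𝔼-potential-step lip) 𝔼-move)
          where
          p = 𝔼′ (λ Y → Ψ Y v)
          p′ = 𝔼′ (λ Y → Ψ Y v′)
          r = 𝔼′ rise
          l = 𝔼′ (λ Y → low Y v)
          low′ : 𝔼′ (λ Y → low Y v′) ≡ r + l
          low′ = trans (𝔼-cong cap wt low′≡) (𝔼-+ cap wt rise _)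
          assemble : ∀ W Λ H d p p′ r l c →
            4 * p + 4 * c ≤ 4 * p′ + 4 * (H * (W * r)) + W * d →
            8 * (W * d) ≤ 32 * (W * (Λ * r)) + c →
            W * d + (4 * p + W * ((128 * Λ + 4 * H) * l)) ≤ 4 * p′ + W * ((128 * Λ + 4 * H) * (r + l))
          -- `h₁` plus four times `h₂`: the credits cancel and `32 * (W * d)` stands against
          -- `W * d`. Of the 31 copies left one is the claim and 30 are slack.
          assemble W Λ H d p p′ r l c h₁ h₂ =
            ≤-by (+-mono-≤ h₁ (*-monoʳ-≤ 4 h₂)) (30 * (W * d)) (identity W Λ H d p p′ r l c)
            where
            identity : ∀ W Λ H d p p′ r l c →
              W * d + (4 * p + W * ((128 * Λ + 4 * H) * l))
                + (4 * p′ + 4 * (H * (W * r)) + W * d + 4 * (32 * (W * (Λ * r)) + c)) + 30 * (W * d)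
              ≡ 4 * p′ + W * ((128 * Λ + 4 * H) * (r + l)) + (4 * p + 4 * c + 4 * (8 * (W * d)))
            identity = solve-∀

      pot : (S → ℕ) → ℕ
      pot v = 4 * 𝔼′ (λ Y → Ψ Y v) + W * (rate * 𝔼′ (λ Y → low Y v))

      travel : (S → ℕ) → (S → ℕ) → ℕ
      travel v v′ = 𝔼′ (λ Y → dist (best Y v) (best Y v′))

      -- A telescoping form of the movement bound, so that `Climb` can chain unit steps. The detour
      -- through intermediate minimisers only overestimates the real move.
      _↝_ : (S → ℕ) → (S → ℕ) → Set
      v ↝ v′ = W * travel v v′ + pot v ≤ pot v′

      ↝-trans : ∀ {v v′ v″} → v ↝ v′ → v′ ↝ v″ → v ↝ v″
      ↝-trans {v} {v′} {v″} p p′ = ≤-trans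
        (+-monoˡ-≤ (pot v) (*-monoʳ-≤ W (≤-trans
          (𝔼-mono cap wt λ Y _ → dist-triangle (best Y v) (best Y v′) (best Y v″))
          (≤-reflexive (𝔼-+ cap wt _ _)))))
        (≤-by (+-mono-≤ p p′) 0 (identity W (travel v v′) (travel v′ v″) (pot v) (pot v′) (pot v″)))
        where
        identity : ∀ w d d′ a b c → w * (d + d′) + a + (b + c) + 0 ≡ c + (w * d + a + (w * d′ + b))
        identity = solve-∀

      module _ {v v′ : S → ℕ} (v≗v′ : ∀ s → v s ≡ v′ s) where
        score-cong : ∀ Y s → score Y v s ≡ score Y v′ s
        score-cong Y s = cong (_+ noise Y s) (v≗v′ s)

        tie-cong : ∀ Y s → tie (score Y v) s ≡ tie (score Y v′) s
        tie-cong Y s = cong (λ e → e * R + cell 0 s) (score-cong Y s)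

        best-cong : ∀ Y → best Y v ≡ best Y v′
        best-cong Y = tie-injective (score Y v) (≤-antisym (best-least Y v (best Y v′))
          (≤-trans (≤-reflexive (tie-cong Y (best Y v′)))
          (≤-trans (best-least Y v′ (best Y v)) (≤-reflexive (sym (tie-cong Y (best Y v)))))))

        low-cong : ∀ Y → low Y v ≡ low Y v′
        low-cong Y = trans (score-cong Y _) (cong (score Y v′) (best-cong Y))

        cellLow-cong′ : ∀ Y i s → cellLow Y v i s ≡ cellLow Y v′ i s
        cellLow-cong′ Y i s = ≤-antisym
          (≤-trans (cellLow≤ Y v i s (cellBest-cell Y v′ i s)) (≤-reflexive (score-cong Y _)))
          (≤-trans (cellLow≤ Y v′ i s (cellBest-cell Y v i s)) (≤-reflexive (sym (score-cong Y _))))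

        level-cong : ∀ Y i → level Y v i ≡ level Y v′ i
        level-cong Y i = trans
          (cong (λ x → q i x * ∑ (mates (suc i) x) (λ s → cellLow Y v i s ∸ low Y v)) (best-cong Y))
          (cong (q i (best Y v′) *_) (∑-cong (mates (suc i) (best Y v′)) λ {s} _ →
            cong₂ _∸_ (cellLow-cong′ Y i s) (low-cong Y)))

        ↝-cong : v ↝ v′
        ↝-cong = ≤-reflexive (trans
          (cong (λ d → W * d + pot v) (trans (𝔼-cong cap wt λ Y →
            trans (cong (dist (best Y v)) (sym (best-cong Y))) (dist-refl (best Y v))) (𝔼-const cap wt 0)))
          (trans (cong (_+ pot v) (*-zeroʳ W))
            (cong₂ (λ a b → 4 * a + W * (rate * b))
              (𝔼-cong cap wt λ Y → ∑-cong (downFrom H) λ {i} _ → level-cong Y i)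
              (𝔼-cong cap wt low-cong))))

      between-Lipschitz : ∀ (w v : S → ℕ) → (∀ s t → w s ≤ w t + dist s t) → (∀ s → w s ≤ v s) → (∀ s → v s ≤ w s + K) → Lipschitz v
      between-Lipschitz w v con w≤v v≤w s t = begin
        v s               ≤⟨ v≤w s ⟩
        w s + K           ≤⟨ +-monoˡ-≤ K (≤-trans (con s t) (+-monoˡ-≤ (dist s t) (w≤v t))) ⟩
        v t + dist s t + K ≡⟨ swap (v t) (dist s t) K ⟩
        v t + K + dist s t ∎
        where
        open ≤-Reasoning
        swap : ∀ a b c → a + b + c ≡ a + c + b
        swap = solve-∀

      -- Serving whole requests.

      module Service {Q : Set} (pays : S → Q → ℕ) (pays≤1 : ∀ s r → pays s r ≤ 1)
        (K≤lam : K ≤ lam 0) (0<H : 0 < H) where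
        open WorkFunction states dist K pays
        open WorkFunctionProperties states complete dist dist-refl dist-triangle K pays pays≤1

        serve-↝ : ∀ {w} → Contracting w → ∀ r → w ↝ serve w r
        serve-↝ {w} con r = Climb.climb states complete (cell 0) cell-injective _↝_
          (λ {v} {v′} {v″} → ↝-trans {v} {v′} {v″}) ↝-cong
          (λ {v} {v′} raised kept w≤v v≤w′ → unit-step {v} {v′} raised kept
            (between-Lipschitz w v con w≤v λ s → ≤-trans (v≤w′ s) (serve-≤+K w r s)))
          (serve-grows con r)

        -- The noise is too small to make a state attractive whose value is dictated by another state.
        saturated : ∀ {Y} → Small Y → ∀ w {s t} → s ≢ t → w t + dist s t ≤ w s → best Y w ≢ s
        saturated {Y} small w {s} {t} s≢t tight refl = <⇒≱ (begin-strict
          w t + noise Y t                 <⟨ +-monoʳ-< (w t) (noise-strict {Y} small 0<H (s≢t ∘ sym)) ⟩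
          w t + (noise Y s + dist t s)    ≡⟨ regroup (w t) (noise Y s) (dist t s) ⟩
          w t + dist t s + noise Y s      ≡⟨ cong (λ d → w t + d + noise Y s) (dist-sym t s) ⟩
          w t + dist s t + noise Y s      ≤⟨ +-monoˡ-≤ (noise Y s) tight ⟩
          w s + noise Y s                 ∎) (low≤ Y w t)
          where
          open ≤-Reasoning
          regroup : ∀ a n d → a + (n + d) ≡ a + d + n
          regroup = solve-∀

        best-initial : ∀ {Y} → Small Y → best Y (initial s₀) ≡ s₀
        best-initial {Y} small = by-cases (cell 0 (best Y (initial s₀)) ≟ cell 0 s₀) cell-injective
          λ neq → contradiction refl (saturated small (initial s₀) {best Y (initial s₀)} {s₀} (neq ∘ cong (cell 0))
            (≤-reflexive (cong (_+ dist (best Y (initial s₀)) s₀) (dist-refl s₀))))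

        K≤dist : ∀ {s t} → s ≢ t → K ≤ dist s t
        K≤dist {s} {t} s≢t = ≤-trans K≤lam (≤-trans (≤-reflexive (sym (trans
          (cong (lam 0 *_) (⟦⟧ᶜ-false (cell 0 s ≟ cell 0 t) (s≢t ∘ cell-injective))) (*-identityʳ (lam 0)))))
          (∑-∈ (λ j → lam j * differ? j s t) (∈-downFrom⁺ 0<H)))

        -- If the minimiser moves, the distance is at least `K` and covers the hit. If it stays, its
        -- new value is not dictated by another state, by `saturated`; so that value contains the
        -- hit, and the minimum grows by as much.
        service : ∀ {Y w} → Small Y → Contracting w → ∀ r →
          K * pays (best Y w) r + low Y w ≤ low Y (serve w r) + dist (best Y w) (best Y (serve w r))
        service {Y} {w} small con r = by-cases (cell 0 b ≟ cell 0 a) (stay ∘ cell-injective) (go ∘ (_∘ cong (cell 0)))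
          where
          open ≤-Reasoning
          b = best Y w
          a = best Y (serve w r)
          low≤low : low Y w ≤ low Y (serve w r)
          low≤low = ≤-trans (low≤ Y w a) (+-monoˡ-≤ (noise Y a) (serve-grows con r a))
          go : b ≢ a → K * pays b r + low Y w ≤ low Y (serve w r) + dist b a
          go b≢a = begin
            K * pays b r + low Y w       ≤⟨ +-mono-≤ (≤-trans (*-monoʳ-≤ K (pays≤1 b r)) (≤-reflexive (*-identityʳ K))) low≤low ⟩
            K + low Y (serve w r)        ≤⟨ +-monoˡ-≤ (low Y (serve w r)) (K≤dist b≢a) ⟩
            dist b a + low Y (serve w r) ≡⟨ +-comm (dist b a) _ ⟩
            low Y (serve w r) + dist b a ∎
          unsaturated : b ≡ a → ∀ x → serve w r b ≡ w x + K * pays x r + dist b x → w b + K * pays b r ≤ serve w r b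
          unsaturated b≡a x eq = by-cases (cell 0 b ≟ cell 0 x)
            (λ e → subst (λ z → w z + K * pays z r ≤ serve w r b) (sym (cell-injective e))
                     (≤-trans (m≤m+n _ _) (≤-reflexive (sym eq))))
            (λ neq → contradiction (sym b≡a) (saturated small (serve w r) {b} {x} (neq ∘ cong (cell 0))
                       (≤-trans (+-monoˡ-≤ (dist b x) (serve-self w r x)) (≤-reflexive (sym eq)))))
          stay : b ≡ a → K * pays b r + low Y w ≤ low Y (serve w r) + dist b a
          stay b≡a = begin
            K * pays b r + (w b + noise Y b)   ≡⟨ regroup (K * pays b r) (w b) (noise Y b) ⟩
            w b + K * pays b r + noise Y b     ≤⟨ +-monoˡ-≤ (noise Y b)
                                                    (unsaturated b≡a _ (proj₂ (serve-attained w r b))) ⟩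
            serve w r b + noise Y b            ≡⟨ cong (score Y (serve w r)) b≡a ⟩
            low Y (serve w r)                  ≤⟨ m≤m+n _ _ ⟩
            low Y (serve w r) + dist b a       ∎
            where
            regroup : ∀ c v n → c + (v + n) ≡ v + c + n
            regroup = solve-∀

        -- `pot` occurs twice because each move is paid twice: as online cost, and for the distance
        -- that `service` uses to cover a hit.
        total : (S → ℕ) → ℕ
        total w = W * 𝔼′ (λ Y → low Y w) + 2 * pot w

        online≤ : ∀ {w} → Contracting w → ∀ σ → W * 𝔼′ (λ Y → online (best Y) w σ) + total w ≤ total (run w σ)
        online≤ {w} con [] = ≤-reflexive (cong (_+ total w) (trans (cong (W *_) (𝔼-const cap wt 0)) (*-zeroʳ W)))
        online≤ {w} con (r ∷ σ) = ≤-trans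
          (≤-reflexive (cong (λ e → W * e + total w) (trans (𝔼-+ cap wt _ _) (cong (_+ o) (𝔼-+ cap wt _ _)))))
          (≤-by (+-mono-≤ (online≤ (serve-Contracting w r) σ) (+-mono-≤ (*-monoʳ-≤ W paid) (*-monoʳ-≤ 2 (serve-↝ con r)))) 0
            (identity W h d o (𝔼′ (λ Y → low Y w)) (pot w) (𝔼′ (λ Y → low Y w′)) (pot w′) (total (run w′ σ))))
          where
          w′ = serve w r
          h = 𝔼′ (λ Y → K * pays (best Y w) r)
          d = travel w w′
          o = 𝔼′ (λ Y → online (best Y) w′ σ)
          paid : h + 𝔼′ (λ Y → low Y w) ≤ 𝔼′ (λ Y → low Y w′) + d
          paid = ≤-trans (≤-reflexive (sym (𝔼-+ cap wt _ _)))
            (≤-trans (𝔼-mono cap wt λ Y bounded → service {Y} {w} (bounded⇒small Y bounded) con r) (≤-reflexive (𝔼-+ cap wt _ _)))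
          identity : ∀ W h d o l p l′ p′ e →
            W * (h + d + o) + (W * l + 2 * p) + (e + (W * (l′ + d) + 2 * p′)) + 0
            ≡ e + (W * o + (W * l′ + 2 * p′) + (W * (h + l) + 2 * (W * d + p)))
          identity = solve-∀

        noise-total width-total T : ℕ
        noise-total = ∑ (downFrom H) lam
        width-total = ∑ (downFrom H) (width ∘ suc)
        T = 𝔼′ (λ _ → 1)

        low-run≤ : ∀ σ ts → 𝔼′ (λ Y → low Y (run (initial s₀) σ)) ≤ (offline s₀ σ ts + noise-total) * T
        low-run≤ σ ts = ≤-trans (𝔼-mono cap wt pointwise) (≤-reflexive (𝔼-const cap wt (offline s₀ σ ts + noise-total)))
          where
          pointwise : ∀ Y → (∀ c → lookup Y c < cap c) → low Y (run (initial s₀) σ) ≤ offline s₀ σ ts + noise-total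
          pointwise Y bounded = ≤-trans (low≤ Y (run (initial s₀) σ) x) (+-mono-≤
            (≤-trans below (≤-reflexive (cong (_+ offline s₀ σ ts) (dist-refl s₀))))
            (∑-mono (downFrom H) λ {j} j∈ → <⇒≤ (bounded⇒small Y bounded x (∈-downFrom⁻ j∈))))
            where
            x = proj₁ (offline-value (initial s₀) s₀ σ ts)
            below = proj₂ (offline-value (initial s₀) s₀ σ ts)

        Ψ≤ : ∀ {v} → Lipschitz v → 𝔼′ (λ Y → Ψ Y v) ≤ W * width-total * T
        Ψ≤ {v} lip = ≤-trans (𝔼-mono cap wt pointwise) (≤-reflexive (𝔼-const cap wt (W * width-total)))
          where
          pointwise : ∀ Y → (∀ c → lookup Y c < cap c) → Ψ Y v ≤ W * width-total
          pointwise Y bounded = ≤-trans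
            (∑-mono (downFrom H) λ {i} _ → level≤ {Y} (bounded⇒small Y bounded) {v} lip i)
            (≤-reflexive (∑-*ˡ (downFrom H) W _))

        run-Lipschitz : ∀ σ → Lipschitz (run (initial s₀) σ)
        run-Lipschitz σ = between-Lipschitz (run (initial s₀) σ) (run (initial s₀) σ) (run-Contracting {initial s₀} (initial-Contracting s₀) σ)
          (λ _ → ≤-refl) (λ s → m≤m+n (run (initial s₀) σ s) K)

        competitive : 1 ≤ W → ∀ σ ts → 𝔼′ (λ Y → online (best Y) (initial s₀) σ)
          ≤ T * ((1 + 2 * rate) * (offline s₀ σ ts + noise-total) + 8 * width-total)
        competitive 1≤W σ ts = assemble W T rate (offline s₀ σ ts + noise-total) width-total
          (𝔼′ (λ Y → low Y (run (initial s₀) σ))) (𝔼′ (λ Y → Ψ Y (run (initial s₀) σ)))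
          1≤W (≤-trans (m≤m+n _ (total (initial s₀))) (online≤ {initial s₀} (initial-Contracting s₀) σ))
          (low-run≤ σ ts) (Ψ≤ (run-Lipschitz σ))
          where
          assemble : ∀ W T ρ x y l p {o} → 1 ≤ W → W * o ≤ W * l + 2 * (4 * p + W * (ρ * l)) →
                    l ≤ x * T → p ≤ W * y * T → o ≤ T * ((1 + 2 * ρ) * x + 8 * y)
          assemble W T ρ x y l p {o} 1≤W o≤ l≤ p≤ = *-cancelˡ-≤ W {{>-nonZero 1≤W}} (begin
            W * o
              ≤⟨ o≤ ⟩
            W * l + 2 * (4 * p + W * (ρ * l))
              ≤⟨ +-mono-≤ (*-monoʳ-≤ W l≤) (*-monoʳ-≤ 2 (+-mono-≤ (*-monoʳ-≤ 4 p≤)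
                   (*-monoʳ-≤ W (*-monoʳ-≤ ρ l≤)))) ⟩
            W * (x * T) + 2 * (4 * (W * y * T) + W * (ρ * (x * T)))
              ≡⟨ identity W T ρ x y ⟩
            W * (T * ((1 + 2 * ρ) * x + 8 * y)) ∎)
            where
            open ≤-Reasoning
            identity : ∀ W T ρ x y → W * (x * T) + 2 * (4 * (W * y * T) + W * (ρ * (x * T)))
                                   ≡ W * (T * ((1 + 2 * ρ) * x + 8 * y))
            identity = solve-∀

-- Choice of the noise

2*⌊n/2⌋≤n : ∀ n → 2 * ⌊ n /2⌋ ≤ n
2*⌊n/2⌋≤n n = begin
  2 * ⌊ n /2⌋           ≡⟨ cong (⌊ n /2⌋ +_) (+-identityʳ ⌊ n /2⌋) ⟩
  ⌊ n /2⌋ + ⌊ n /2⌋     ≤⟨ +-monoʳ-≤ ⌊ n /2⌋ (⌊n/2⌋≤⌈n/2⌉ n) ⟩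
  ⌊ n /2⌋ + ⌈ n /2⌉     ≡⟨ ⌊n/2⌋+⌈n/2⌉≡n n ⟩
  n                     ∎
  where open ≤-Reasoning

n≤2*⌈n/2⌉ : ∀ n → n ≤ 2 * ⌈ n /2⌉
n≤2*⌈n/2⌉ n = begin
  n                     ≡⟨ ⌊n/2⌋+⌈n/2⌉≡n n ⟨
  ⌊ n /2⌋ + ⌈ n /2⌉     ≤⟨ +-monoˡ-≤ ⌈ n /2⌉ (⌊n/2⌋≤⌈n/2⌉ n) ⟩
  ⌈ n /2⌉ + ⌈ n /2⌉     ≡⟨ cong (⌈ n /2⌉ +_) (+-identityʳ ⌈ n /2⌉) ⟨
  2 * ⌈ n /2⌉           ∎
  where open ≤-Reasoning

2^⌊log₂n⌋≤n : ∀ n → 1 ≤ n → 2 ^ ⌊log₂ n ⌋ ≤ n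
2^⌊log₂n⌋≤n = <-rec (λ n → 1 ≤ n → 2 ^ ⌊log₂ n ⌋ ≤ n) step
  where
  step : ∀ n → (∀ {m} → m < n → 1 ≤ m → 2 ^ ⌊log₂ m ⌋ ≤ m) → 1 ≤ n → 2 ^ ⌊log₂ n ⌋ ≤ n
  step 1 rec _ = ≤-refl
  step n@(suc (suc n′)) rec _ = begin
    2 ^ ⌊log₂ n ⌋                     ≡⟨ cong (2 ^_) (m+[n∸m]≡n 1≤log) ⟨
    2 * 2 ^ (⌊log₂ n ⌋ ∸ 1)           ≡⟨ cong (λ e → 2 * 2 ^ e) (⌊log₂⌊n/2⌋⌋≡⌊log₂n⌋∸1 n) ⟨
    2 * 2 ^ ⌊log₂ ⌊ n /2⌋ ⌋           ≤⟨ *-monoʳ-≤ 2 (rec (⌊n/2⌋<n (suc n′)) (s≤s z≤n)) ⟩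
    2 * ⌊ n /2⌋                       ≤⟨ 2*⌊n/2⌋≤n n ⟩
    n                                 ∎
    where
    open ≤-Reasoning
    1≤log : 1 ≤ ⌊log₂ n ⌋
    1≤log = ⌊log₂⌋-mono-≤ {2} {n} (s≤s (s≤s z≤n))

n<2^1+⌊log₂n⌋ : ∀ n → n < 2 ^ suc ⌊log₂ n ⌋
n<2^1+⌊log₂n⌋ = <-rec (λ n → n < 2 ^ suc ⌊log₂ n ⌋) step
  where
  step : ∀ n → (∀ {m} → m < n → m < 2 ^ suc ⌊log₂ m ⌋) → n < 2 ^ suc ⌊log₂ n ⌋
  step 0 rec = s≤s z≤n
  step 1 rec = ≤-refl
  step n@(suc (suc n′)) rec = begin
    suc n                             ≤⟨ n≤2*⌈n/2⌉ (suc n) ⟩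
    2 * suc ⌊ n /2⌋                   ≤⟨ *-monoʳ-≤ 2 (rec (⌊n/2⌋<n (suc n′))) ⟩
    2 * 2 ^ suc ⌊log₂ ⌊ n /2⌋ ⌋       ≡⟨ cong (λ e → 2 * 2 ^ suc e) (⌊log₂⌊n/2⌋⌋≡⌊log₂n⌋∸1 n) ⟩
    2 * 2 ^ (1 + (⌊log₂ n ⌋ ∸ 1))     ≡⟨ cong (λ e → 2 * 2 ^ e) (m+[n∸m]≡n 1≤log) ⟩
    2 ^ suc ⌊log₂ n ⌋                 ∎
    where
    open ≤-Reasoning
    1≤log : 1 ≤ ⌊log₂ n ⌋
    1≤log = ⌊log₂⌋-mono-≤ {2} {n} (s≤s (s≤s z≤n))

n≤2^⌈log₂n⌉ : ∀ n → n ≤ 2 ^ ⌈log₂ n ⌉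
n≤2^⌈log₂n⌉ = <-rec (λ n → n ≤ 2 ^ ⌈log₂ n ⌉) step
  where
  step : ∀ n → (∀ {m} → m < n → m ≤ 2 ^ ⌈log₂ m ⌉) → n ≤ 2 ^ ⌈log₂ n ⌉
  step 0 rec = z≤n
  step 1 rec = ≤-refl
  step n@(suc (suc n′)) rec = begin
    n                                 ≤⟨ n≤2*⌈n/2⌉ n ⟩
    2 * ⌈ n /2⌉                       ≤⟨ *-monoʳ-≤ 2 (rec (⌈n/2⌉<n n′)) ⟩
    2 * 2 ^ ⌈log₂ ⌈ n /2⌉ ⌉           ≡⟨ cong (λ e → 2 * 2 ^ e) (⌈log₂⌈n/2⌉⌉≡⌈log₂n⌉∸1 n) ⟩
    2 * 2 ^ (⌈log₂ n ⌉ ∸ 1)           ≡⟨ cong (2 ^_) (m+[n∸m]≡n 1≤log) ⟩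
    2 ^ ⌈log₂ n ⌉                     ∎
    where
    open ≤-Reasoning
    1≤log : 1 ≤ ⌈log₂ n ⌉
    1≤log = ⌈log₂⌉-mono-≤ {2} {n} (s≤s (s≤s z≤n))

n≤2^n : ∀ n → n ≤ 2 ^ n
n≤2^n zero    = z≤n
n≤2^n (suc n) = +-mono-≤ (m^n>0 2 n) (≤-trans (n≤2^n n) (m≤m+n _ 0))

-- A discretised truncated exponential law: the weight doubles every m steps.
module Doubling (m′ : ℕ) where
  m = suc m′

  wt : ℕ → ℕ
  wt y = 2 ^ (y / m)

  below : ℕ → ℕ
  below y = ∑ (downFrom y) wt

  within-block : ∀ r q → r ≤ m → below (r + q * m) ≡ r * 2 ^ q + below (q * m)
  within-block zero    q _   = refl
  within-block (suc r) q r<m = trans (cong₂ _+_ (cong (2 ^_) quotient) (within-block r q (<⇒≤ r<m)))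
                                     (sym (+-assoc (2 ^ q) _ _))
    where
    quotient : (r + q * m) / m ≡ q
    quotient = trans (+-distrib-/-∣ʳ r (n∣m*n q)) (cong₂ _+_ (m<n⇒m/n≡0 r<m) (m*n/n≡m q m))

  below-blocks : ∀ q → below (q * m) + m ≡ m * 2 ^ q
  below-blocks zero    = sym (*-identityʳ m)
  below-blocks (suc q) = begin
    below (m + q * m) + m             ≡⟨ cong (_+ m) (within-block m q ≤-refl) ⟩
    m * 2 ^ q + below (q * m) + m     ≡⟨ +-assoc (m * 2 ^ q) _ _ ⟩
    m * 2 ^ q + (below (q * m) + m)   ≡⟨ cong (m * 2 ^ q +_) (below-blocks q) ⟩
    m * 2 ^ q + m * 2 ^ q             ≡⟨ double m (2 ^ q) ⟩
    m * (2 * 2 ^ q)                   ∎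
    where
    open ≡-Reasoning
    double : ∀ m p → m * p + m * p ≡ m * (2 * p)
    double = solve-∀

  -- Discrete memorylessness: the complete blocks below `y` already have mass `m * (wt y ∸ 1)`, so
  -- only the term `m`, the effect of starting at 0, is missing.
  wt-grows : ∀ y → wt y * m ≤ below y + m
  wt-grows y = begin
    2 ^ (y / m) * m             ≡⟨ *-comm (2 ^ (y / m)) m ⟩
    m * 2 ^ (y / m)             ≡⟨ below-blocks (y / m) ⟨
    below (y / m * m) + m       ≤⟨ +-monoˡ-≤ m (∑-prefix {wt} {wt} (m/n*n≤m y m) (λ _ → ≤-refl)) ⟩
    below y + m                 ∎
    where open ≤-Reasoning

-- The origin of the depth `12 + 2 * d`: one factor `2 ^ d` answers the size drop, the other absorbs
-- the linear factor, and `2 ^ 12` exceeds `64 * 14 + 1`.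
depth-suffices : ∀ d → 64 * ((2 * d + 12) * 2 ^ d) + 1 ≤ 2 ^ (2 * d + 12)
depth-suffices d = begin
  64 * ((2 * d + 12) * p) + 1             ≤⟨ +-mono-≤ (*-monoʳ-≤ 64 (*-monoˡ-≤ p (+-mono-≤ (*-monoʳ-≤ 2 (n≤2^n d))
                                               (*-monoʳ-≤ 12 1≤p)))) (*-mono-≤ 1≤p 1≤p) ⟩
  64 * ((2 * p + 12 * p) * p) + p * p     ≤⟨ ≤-by z≤n (3199 * (p * p)) (identity p) ⟩
  p * p * 4096                            ≡⟨ cong (_* 4096) (trans (sym (^-distribˡ-+-* 2 d d))
                                               (cong (λ e → 2 ^ (d + e)) (sym (+-identityʳ d)))) ⟩
  2 ^ (2 * d) * 2 ^ 12                    ≡⟨ ^-distribˡ-+-* 2 (2 * d) 12 ⟨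
  2 ^ (2 * d + 12)                        ∎
  where
  open ≤-Reasoning
  p = 2 ^ d
  1≤p : 1 ≤ p
  1≤p = m^n>0 2 d
  identity : ∀ p → 64 * ((2 * p + 12 * p) * p) + p * p + 0 + 3199 * (p * p) ≡ p * p * 4096 + 0
  identity = solve-∀

module RandomTree {S : Set} (states : List S) (complete : ∀ s → s ∈ states) (s₀ : S)
  (h : ℕ) (cell : ℕ → S → ℕ) (parent : ℕ → ℕ)
  (cell-suc : ∀ i s → cell (suc i) s ≡ parent (cell i s))
  (parent-mono : ∀ {x y} → x ≤ y → parent x ≤ parent y)
  (cell-injective : ∀ {s t} → cell 0 s ≡ cell 0 t → s ≡ t)
  (cell-top : ∀ s t → cell (suc h) s ≡ cell (suc h) t)
  (R : ℕ) (cell<R : ∀ i s → cell i s < R)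
  (base : ℕ) (1≤base : 1 ≤ base)
  where

  H : ℕ
  H = suc h

  cell-nested : ∀ i {s t} → cell i s ≡ cell i t → cell (suc i) s ≡ cell (suc i) t
  cell-nested i {s} {t} eq = trans (cell-suc i s) (trans (cong parent eq) (sym (cell-suc i t)))

  cell-mono : ∀ i {s t} → cell 0 s ≤ cell 0 t → cell i s ≤ cell i t
  cell-mono zero    p = p
  cell-mono (suc i) {s} {t} p =
    subst₂ _≤_ (sym (cell-suc i s)) (sym (cell-suc i t)) (parent-mono (cell-mono i p))

  M : ℕ
  M = H * R

  -- The cap at `h` makes `node` total; below `H` the level is kept.
  level-index : ℕ → Fin H
  level-index i = fromℕ< (s≤s (m⊓n≤n i h))

  toℕ-level-index : ∀ {i} → i < H → toℕ (level-index i) ≡ i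
  toℕ-level-index {i} (s≤s i≤h) = trans (toℕ-fromℕ< (s≤s (m⊓n≤n i h))) (m≤n⇒m⊓n≡m i≤h)

  abstract
    node : ℕ → S → Fin M
    node i s = combine (level-index i) (fromℕ< (cell<R i s))

    coord : Fin M → ℕ × ℕ
    coord c = toℕ (proj₁ (remQuot {H} R c)) , toℕ (proj₂ (remQuot {H} R c))

    coord-node : ∀ {i} s → i < H → coord (node i s) ≡ (i , cell i s)
    coord-node {i} s i<H = trans (cong (λ p → toℕ (proj₁ p) , toℕ (proj₂ p))
      (remQuot-combine (level-index i) (fromℕ< (cell<R i s))))
      (cong₂ _,_ (toℕ-level-index i<H) (toℕ-fromℕ< (cell<R i s)))

    node-injective : ∀ {i j s t} → i < H → j < H → node i s ≡ node j t → i ≡ j × cell i s ≡ cell i t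
    node-injective {i} {j} {s} {t} i<H j<H eq = i≡j , trans (cong proj₂ both) (cong (λ k → cell k t) (sym i≡j))
      where
      both : (i , cell i s) ≡ (j , cell j t)
      both = trans (sym (coord-node s i<H)) (trans (cong coord eq) (coord-node t j<H))
      i≡j : i ≡ j
      i≡j = cong proj₁ both

    node-cong : ∀ i {s t} → cell i s ≡ cell i t → node i s ≡ node i t
    node-cong i {s} {t} eq = cong (combine (level-index i)) (fromℕ<-cong _ _ eq (cell<R i s) (cell<R i t))

  open Perturbed states complete s₀ H cell cell-injective cell-mono cell-nested R (cell<R 0)
    node node-injective node-cong

  size : ℕ → ℕ → ℕ
  size i e = length (members i e)

  bits : ℕ → ℕ → ℕ
  bits i e = suc ⌊log₂ size i e ⌋

  A : ℕ
  A = suc ⌊log₂ length states ⌋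

  bits≤A : ∀ i e → bits i e ≤ A
  bits≤A i e = s≤s (⌊log₂⌋-mono-≤ (List.length-filter (λ t → cell i t ≟ e) states))

  bits-mono : ∀ i s → bits i (cell i s) ≤ bits (suc i) (cell (suc i) s)
  bits-mono i s = s≤s (⌊log₂⌋-mono-≤ (count≤count-suc i s))

  drop : ℕ → ℕ → ℕ
  drop i e = bits (suc i) (parent e) ∸ bits i e

  -- Twice the logarithmic drop in size, so that the depths along a path telescope to O(H + A).
  depth : ℕ → ℕ → ℕ
  depth i e = 12 + 2 * drop i e

  Λ : ℕ
  Λ = 12 * H + 2 * A

  -- `K` is the unit of cost. Being at least every depth, it leaves room in `lam i` for `depth`
  -- blocks of at least one integral step. `W` is a common denominator for the averages in the
  -- potential.
  K W : ℕ
  K = Λ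
  W = 2 ^ A

  lam : ℕ → ℕ
  lam i = base * 16 ^ i * K

  m′ : ℕ → ℕ → ℕ
  m′ i e = pred (lam i / depth i e)

  -- `W` over the size of the parent cell, with the size rounded up to `2 ^ bits` so that the
  -- quotient is integral.
  q : ℕ → S → ℕ
  q i s = 2 ^ (A ∸ bits (suc i) (cell (suc i) s))

  wtAt : ℕ × ℕ → ℕ → ℕ
  wtAt p = Doubling.wt (m′ (proj₁ p) (proj₂ p))

  capAt : ℕ × ℕ → ℕ
  capAt p = depth (proj₁ p) (proj₂ p) * suc (m′ (proj₁ p) (proj₂ p))

  wt : Fin M → ℕ → ℕ
  wt c = wtAt (coord c)

  cap : Fin M → ℕ
  cap c = capAt (coord c)

  wt-node : ∀ {i} s → i < H → wt (node i s) ≡ Doubling.wt (m′ i (cell i s))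
  wt-node s i<H = cong wtAt (coord-node s i<H)

  cap-node : ∀ {i} s → i < H → cap (node i s) ≡ depth i (cell i s) * suc (m′ i (cell i s))
  cap-node s i<H = cong capAt (coord-node s i<H)

  q-cong : ∀ i {s t} → cell (suc i) s ≡ cell (suc i) t → q i s ≡ q i t
  q-cong i eq = cong (λ e → 2 ^ (A ∸ bits (suc i) e)) eq

  q-count : ∀ i s → q i s * count (suc i) s ≤ W
  q-count i s = begin
    2 ^ (A ∸ b) * count (suc i) s ≤⟨ *-monoʳ-≤ (2 ^ (A ∸ b)) (<⇒≤ (n<2^1+⌊log₂n⌋ (count (suc i) s))) ⟩
    2 ^ (A ∸ b) * 2 ^ b           ≡⟨ ^-distribˡ-+-* 2 (A ∸ b) b ⟨
    2 ^ (A ∸ b + b)               ≡⟨ cong (2 ^_) (m∸n+n≡m (bits≤A (suc i) _)) ⟩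
    2 ^ A                         ∎
    where
    open ≤-Reasoning
    b = bits (suc i) (cell (suc i) s)

  drop≡ : ∀ i s → drop i (cell i s) ≡ bits (suc i) (cell (suc i) s) ∸ bits i (cell i s)
  drop≡ i s = cong (λ e → bits (suc i) e ∸ bits i (cell i s)) (sym (cell-suc i s))

  count≥1 : ∀ i s → 1 ≤ count i s
  count≥1 i s = nonempty (∈-filter⁺ (λ t → cell i t ≟ cell i s) (complete s) refl)
    where
    nonempty : ∀ {A : Set} {x : A} {xs} → x ∈ xs → 1 ≤ length xs
    nonempty (here _)  = s≤s z≤n
    nonempty (there _) = s≤s z≤n

  -- The share `q * count / W` that a rise of the cell earns is at least half of `2 ^ (- drop)`; the
  -- truncation error is measured against it.
  W≤ : ∀ i s → W ≤ 2 * (q i s * count i s) * 2 ^ drop i (cell i s)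
  W≤ i s = begin
    2 ^ A
      ≡⟨ cong (2 ^_) (trans (m∸n+n≡m (bits≤A (suc i) (cell (suc i) s))) refl) ⟨
    2 ^ (A ∸ b′ + b′)
      ≡⟨ cong (λ e → 2 ^ (A ∸ b′ + e)) (m+[n∸m]≡n (bits-mono i s)) ⟨
    2 ^ (A ∸ b′ + (b + (b′ ∸ b)))
      ≡⟨ trans (^-distribˡ-+-* 2 (A ∸ b′) _) (cong (2 ^ (A ∸ b′) *_) (^-distribˡ-+-* 2 b (b′ ∸ b))) ⟩
    q i s * (2 ^ b * 2 ^ (b′ ∸ b))
      ≤⟨ *-monoʳ-≤ (q i s) (*-monoˡ-≤ (2 ^ (b′ ∸ b)) (*-monoʳ-≤ 2 (2^⌊log₂n⌋≤n (count i s) (count≥1 i s)))) ⟩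
    q i s * (2 * count i s * 2 ^ (b′ ∸ b))
      ≡⟨ regroup (q i s) (count i s) (2 ^ (b′ ∸ b)) ⟩
    2 * (q i s * count i s) * 2 ^ (b′ ∸ b)
      ≡⟨ cong (λ d → 2 * (q i s * count i s) * 2 ^ d) (drop≡ i s) ⟨
    2 * (q i s * count i s) * 2 ^ drop i (cell i s) ∎
    where
    open ≤-Reasoning
    b = bits i (cell i s)
    b′ = bits (suc i) (cell (suc i) s)
    regroup : ∀ q c p → q * (2 * c * p) ≡ 2 * (q * c) * p
    regroup = solve-∀

  depth≤Λ : ∀ i e → depth i e ≤ Λ
  depth≤Λ i e = +-mono-≤ (≤-trans (≤-reflexive (sym (*-identityʳ 12))) (*-monoʳ-≤ 12 (s≤s z≤n)))
    (*-monoʳ-≤ 2 (≤-trans (m∸n≤m (bits (suc i) (parent e)) (bits i e)) (bits≤A (suc i) (parent e))))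

  1≤K : 1 ≤ K
  1≤K = ≤-trans (s≤s z≤n) (depth≤Λ 0 0)

  K≤lam : ∀ i → K ≤ lam i
  K≤lam i = ≤-trans (≤-reflexive (sym (*-identityˡ K)))
    (*-monoˡ-≤ K (*-mono-≤ 1≤base (m^n>0 16 i)))

  depth≤lam : ∀ i e → depth i e ≤ lam i
  depth≤lam i e = ≤-trans (depth≤Λ i e) (K≤lam i)

  m≡ : ∀ i e → suc (m′ i e) ≡ lam i / depth i e
  m≡ i e = suc-pred (lam i / depth i e) {{>-nonZero (m≥n⇒m/n>0 (depth≤lam i e))}}

  cap≤lam : ∀ {i} s → i < H → cap (node i s) ≤ lam i
  cap≤lam {i} s i<H = begin
    cap (node i s)                                      ≡⟨ cap-node s i<H ⟩
    depth i (cell i s) * suc (m′ i (cell i s))          ≡⟨ *-comm (depth i (cell i s)) _ ⟩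
    suc (m′ i (cell i s)) * depth i (cell i s)          ≡⟨ cong (_* depth i (cell i s)) (m≡ i (cell i s)) ⟩
    lam i / depth i (cell i s) * depth i (cell i s)     ≤⟨ m/n*n≤m (lam i) (depth i (cell i s)) ⟩
    lam i                                               ∎
    where open ≤-Reasoning

  lam≤ : ∀ {i} s → i < H → lam i ≤ 2 * (depth i (cell i s) * suc (m′ i (cell i s)))
  lam≤ {i} s i<H = begin
    lam i                                 ≡⟨ m≡m%n+[m/n]*n (lam i) L ⟩
    lam i % L + lam i / L * L             ≡⟨ cong (λ x → lam i % L + x * L) (m≡ i (cell i s)) ⟨
    lam i % L + m * L                     ≤⟨ +-monoˡ-≤ (m * L) (<⇒≤ (m%n<n (lam i) L)) ⟩
    L + m * L                             ≤⟨ +-monoˡ-≤ (m * L) (m≤m+n L _) ⟩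
    m * L + m * L                         ≡⟨ double m L ⟩
    2 * (L * m)                           ∎
    where
    open ≤-Reasoning
    L = depth i (cell i s)
    m = suc (m′ i (cell i s))
    double : ∀ m l → m * l + m * l ≡ 2 * (l * m)
    double = solve-∀

  grows : ∀ {i} s → i < H → ∀ {y} → y < cap (node i s) →
          wt (node i s) y * suc (m′ i (cell i s)) ≤ ∑ (downFrom y) (wt (node i s)) + suc (m′ i (cell i s))
  grows {i} s i<H {y} _ = subst (λ w → w y * suc (m′ i (cell i s)) ≤ ∑ (downFrom y) w + suc (m′ i (cell i s)))
    (sym (wt-node s i<H)) (Doubling.wt-grows (m′ i (cell i s)) y)

  total-weight : ∀ d m → 64 * ((12 + 2 * d) * 2 ^ d) * suc m ≤ Doubling.below m ((12 + 2 * d) * suc m)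
  total-weight d m = +-cancelʳ-≤ (suc m) _ _ (begin
    64 * ((12 + 2 * d) * 2 ^ d) * suc m + suc m     ≡⟨ factor (64 * ((12 + 2 * d) * 2 ^ d)) (suc m) ⟩
    suc m * (64 * ((12 + 2 * d) * 2 ^ d) + 1)       ≤⟨ *-monoʳ-≤ (suc m) (subst
      (λ l → 64 * (l * 2 ^ d) + 1 ≤ 2 ^ l) (+-comm (2 * d) 12) (depth-suffices d)) ⟩
    suc m * 2 ^ (12 + 2 * d)                        ≡⟨ Doubling.below-blocks m (12 + 2 * d) ⟨
    Doubling.below m ((12 + 2 * d) * suc m) + suc m ∎)
    where
    open ≤-Reasoning
    factor : ∀ a m → a * m + m ≡ m * (a + 1)
    factor = solve-∀

  tot≥1 : ∀ c → 1 ≤ ∑ (downFrom (cap c)) (wt c)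
  tot≥1 c = ≤-trans (*-mono-≤ {1} {64 * ((12 + 2 * d) * 2 ^ d)} {1} (*-mono-≤ {1} {64} {1} (s≤s z≤n)
    (*-mono-≤ {1} {12 + 2 * d} {1} (s≤s z≤n) (m^n>0 2 d))) (s≤s z≤n)) (total-weight d (m′ (proj₁ (coord c)) (proj₂ (coord c))))
    where d = drop (proj₁ (coord c)) (proj₂ (coord c))

  tot≥ : ∀ {i} s → i < H → 16 * (lam i * W) ≤ ∑ (downFrom (cap (node i s))) (wt (node i s)) * (q i s * count i s)
  tot≥ {i} s i<H = subst₂ (λ c w → 16 * (lam i * W) ≤ ∑ (downFrom c) w * (q i s * count i s))
    (sym (cap-node s i<H)) (sym (wt-node s i<H)) (begin
    16 * (lam i * W)
      -- The 64 arises here: 16, times 2 for rounding `lam i / depth` down, times 2 for rounding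
      -- sizes to powers of two.
      ≤⟨ *-monoʳ-≤ 16 (*-mono-≤ (lam≤ s i<H) (W≤ i s)) ⟩
    16 * (2 * (L * m) * (2 * g * 2 ^ d))
      ≡⟨ regroup L m g (2 ^ d) ⟩
    64 * (L * 2 ^ d) * m * g
      ≤⟨ *-monoˡ-≤ g (total-weight d (m′ i (cell i s))) ⟩
    Doubling.below (m′ i (cell i s)) (L * m) * g ∎)
    where
    open ≤-Reasoning
    L = depth i (cell i s)
    m = suc (m′ i (cell i s))
    d = drop i (cell i s)
    g = q i s * count i s
    regroup : ∀ l m g p → 16 * (2 * (l * m) * (2 * g * p)) ≡ 64 * (l * p) * m * g
    regroup = solve-∀

  ∑depth≤ : ∀ s → ∑ (downFrom H) (λ i → depth i (cell i s)) ≤ Λ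
  ∑depth≤ s = ≤-trans (telescope H) (+-monoʳ-≤ (12 * H) (*-monoʳ-≤ 2 (bits≤A H (cell H s))))
    where
    telescope : ∀ n → ∑ (downFrom n) (λ i → depth i (cell i s)) ≤ 12 * n + 2 * bits n (cell n s)
    telescope zero    = z≤n
    telescope (suc n) = begin
      12 + 2 * drop n (cell n s) + ∑ (downFrom n) (λ i → depth i (cell i s))
        ≤⟨ +-monoʳ-≤ (12 + 2 * drop n (cell n s)) (telescope n) ⟩
      12 + 2 * drop n (cell n s) + (12 * n + 2 * b)
        ≡⟨ regroup (drop n (cell n s)) n b ⟩
      12 * suc n + 2 * (b + drop n (cell n s))
        ≡⟨ cong (λ e → 12 * suc n + 2 * e) (trans (cong (b +_) (drop≡ n s)) (m+[n∸m]≡n (bits-mono n s))) ⟩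
      12 * suc n + 2 * bits (suc n) (cell (suc n) s) ∎
      where
      open ≤-Reasoning
      b = bits n (cell n s)
      regroup : ∀ d n b → 12 + 2 * d + (12 * n + 2 * b) ≡ 12 * (1 + n) + 2 * (b + d)
      regroup = solve-∀

  lam-suc : ∀ i → lam (suc i) ≡ 16 * lam i
  lam-suc i = regroup base (16 ^ i) K
    where
    regroup : ∀ b p k → b * (16 * p) * k ≡ 16 * (b * p * k)
    regroup = solve-∀

  double : ∀ i → 2 * lam i ≤ lam (suc i)
  double i = ≤-trans (*-monoˡ-≤ (lam i) {2} {16} (s≤s (s≤s z≤n))) (≤-reflexive (sym (lam-suc i)))

  open Potential lam K W q q-cong q-count

  spread : ∀ i → 4 * (width (suc i) + 1) ≤ lam (suc i)
  spread i = ≤-trans (stronger i) (≤-reflexive (sym (lam-suc i)))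
    where
    stronger : ∀ i → 4 * (width (suc i) + 1) ≤ 16 * lam i
    -- The bottom level exhausts the growth factor 16: `lam 0` is used 4 times for `K`, 8 times for
    -- itself and 4 times for the 1.
    stronger zero = ≤-by (+-mono-≤ (*-monoʳ-≤ 4 (K≤lam 0)) (*-monoʳ-≤ 4 (≤-trans 1≤K (K≤lam 0)))) 0
      (identity K (lam 0))
      where
      identity : ∀ k l → 4 * (k + 2 * (l + 0) + 1) + (4 * l + 4 * l) + 0 ≡ 16 * l + (4 * k + 4 * 1)
      identity = solve-∀
    stronger (suc i) = ≤-by (stronger i) (7 * lam (suc i)) (identity K (lam (suc i)) (lam i) (∑ (downFrom (suc i)) lam) (lam-suc i))
      where
      identity : ∀ k l l′ x → l ≡ 16 * l′ →
        4 * (k + 2 * (l + x) + 1) + 16 * l′ + 7 * l ≡ 16 * l + 4 * (k + 2 * x + 1)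
      identity k l l′ x eq rewrite sym eq = ring k l x
        where
        ring : ∀ k l x → 4 * (k + 2 * (l + x) + 1) + l + 7 * l ≡ 16 * l + 4 * (k + 2 * x + 1)
        ring = solve-∀

  open Amortised double cell-top spread cap wt cap≤lam (λ i s → suc (m′ i (cell i s))) (λ i s → depth i (cell i s))
    (λ _ _ → s≤s z≤n) tot≥1 grows lam≤ tot≥ Λ ∑depth≤

  ratio : ℕ
  ratio = 1 + 2 * (128 * Λ + 4 * H)

  solution : ∀ {Q : Set} (pays : S → Q → ℕ) → (∀ s r → pays s r ≤ 1) →
             WorkFunction.Solution states (Metric.dist H cell lam) K pays s₀ ratio
  solution pays pays≤1 = record
    { coordinates   = M
    ; cap           = cap
    ; wt            = wt
    ; state         = best
    ; weight≥1      = 𝔼-positive cap wt tot≥1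
    ; state-initial = λ Y bounded → best-initial {Y} (bounded⇒small Y bounded)
    ; additive      = ratio * noise-total + 8 * width-total
    ; competitive   = λ σ ts → ≤-trans (competitive (m^n>0 2 A) σ ts) (≤-reflexive (cong (T *_)
        (regroup ratio (WorkFunction.offline states (Metric.dist H cell lam) K pays s₀ σ ts) noise-total (8 * width-total))))
    }
    where
    open Service pays pays≤1 (K≤lam 0) (s≤s z≤n)
    regroup : ∀ ρ x b c → ρ * (x + b) + c ≡ ρ * x + (ρ * b + c)
    regroup = solve-∀

-- Colorings and sampled positions

∑-allFin-suc : ∀ {n} (f : Fin (suc n) → ℕ) → ∑ (allFin (suc n)) f ≡ f zero + ∑ (allFin n) (f ∘ suc)
∑-allFin-suc {n} f = cong (λ l → f zero + sum l)
  (trans (map-tabulate suc f) (sym (map-tabulate id (f ∘ suc))))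

∑-allFin-inject₁ : ∀ {n} (f : Fin (suc n) → ℕ) → ∑ (allFin n) (f ∘ inject₁) ≤ ∑ (allFin (suc n)) f
∑-allFin-inject₁ {zero}  f = z≤n
∑-allFin-inject₁ {suc n} f = begin
  ∑ (allFin (suc n)) (f ∘ inject₁)                    ≡⟨ ∑-allFin-suc (f ∘ inject₁) ⟩
  f zero + ∑ (allFin n) (f ∘ suc ∘ inject₁)           ≤⟨ +-monoʳ-≤ (f zero) (∑-allFin-inject₁ (f ∘ suc)) ⟩
  f zero + ∑ (allFin (suc n)) (f ∘ suc)               ≡⟨ ∑-allFin-suc f ⟨
  ∑ (allFin (suc (suc n))) f                          ∎
  where open ≤-Reasoning

∑-downFrom-+ : ∀ a b (f : ℕ → ℕ) → ∑ (downFrom (a + b)) f ≡ ∑ (downFrom a) (λ x → f (x + b)) + ∑ (downFrom b) f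
∑-downFrom-+ zero    b f = refl
∑-downFrom-+ (suc a) b f = trans (cong (f (a + b) +_) (∑-downFrom-+ a b f)) (sym (+-assoc (f (a + b)) _ _))

differ-refl : ∀ x → differ x x ≡ 0
differ-refl true  = refl
differ-refl false = refl

differ-sym : ∀ x y → differ x y ≡ differ y x
differ-sym true  true  = refl
differ-sym true  false = refl
differ-sym false true  = refl
differ-sym false false = refl

differ≤1 : ∀ x y → differ x y ≤ 1
differ≤1 true  true  = z≤n
differ≤1 true  false = ≤-refl
differ≤1 false true  = ≤-refl
differ≤1 false false = z≤n

differ≡0 : ∀ x y → differ x y ≡ 0 → x ≡ y
differ≡0 true  true  _ = refl
differ≡0 false false _ = refl

differ-triangle : ∀ x y z → differ x z ≤ differ x y + differ y z
differ-triangle true  true  z     = ≤-refl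
differ-triangle true  false true  = z≤n
differ-triangle true  false false = ≤-refl
differ-triangle false false z     = ≤-refl
differ-triangle false true  true  = ≤-refl
differ-triangle false true  false = z≤n

hamming-∷ : ∀ {n} x y (v w : Coloring n) → hamming (x ∷ v) (y ∷ w) ≡ differ x y + hamming v w
hamming-∷ x y v w = ∑-allFin-suc (λ i → differ (lookup (x ∷ v) i) (lookup (y ∷ w) i))

hamming-sym : ∀ {n} (v w : Coloring n) → hamming v w ≡ hamming w v
hamming-sym {n} v w = ∑-cong (allFin n) λ {i} _ → differ-sym (lookup v i) (lookup w i)

hamming-refl : ∀ {n} (v : Coloring n) → hamming v v ≡ 0
hamming-refl {n} v = trans (∑-cong (allFin n) λ {i} _ → differ-refl (lookup v i)) (∑-zero (allFin n))

hamming≤n : ∀ {n} (v w : Coloring n) → hamming v w ≤ n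
hamming≤n []      []      = z≤n
hamming≤n (x ∷ v) (y ∷ w) = ≤-trans (≤-reflexive (hamming-∷ x y v w)) (+-mono-≤ (differ≤1 x y) (hamming≤n v w))

hit≤1 : ∀ {n} (c : Coloring n) i → hit c i ≤ 1
hit≤1 c i = differ≤1 (lookup c i) (lookup c (next i))

changes : ∀ {n} → Bool → Vec Bool n → ℕ
changes b []      = 0
changes b (x ∷ v) = differ b x + changes x v

changes-sum : ∀ {n} x (v : Vec Bool n) →
              changes x v ≡ ∑ (allFin n) (λ i → differ (lookup (x ∷ v) (inject₁ i)) (lookup (x ∷ v) (suc i)))
changes-sum x []      = refl
changes-sum x (y ∷ v) = trans (cong (differ x y +_) (changes-sum y v)) (sym (∑-allFin-suc
  (λ i → differ (lookup (x ∷ y ∷ v) (inject₁ i)) (lookup (y ∷ v) i))))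

next-inject₁ : ∀ {n} (i : Fin n) → next (inject₁ i) ≡ suc i
next-inject₁ {n} i = toℕ-injective (trans (toℕ-fromℕ< (m%n<n (suc (toℕ (inject₁ i))) (suc n)))
  (trans (cong (λ e → suc e % suc n) (toℕ-inject₁ i)) (m<n⇒m%n≡m (s≤s (toℕ<n i)))))

changes≤numCuts : ∀ {n} x (v : Vec Bool n) → changes x v ≤ numCuts (x ∷ v)
changes≤numCuts {n} x v = ≤-trans (≤-reflexive (trans (changes-sum x v) (∑-cong (allFin n) λ {i} _ →
    cong (λ j → differ (lookup (x ∷ v) (inject₁ i)) (lookup (x ∷ v) j)) (sym (next-inject₁ i)))))
  (∑-allFin-inject₁ (hit (x ∷ v)))

allVecs : ∀ n → List (Vec Bool n)
allVecs zero    = [] ∷ []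
allVecs (suc n) = map (true ∷_) (allVecs n) ++ map (false ∷_) (allVecs n)

∈-allVecs : ∀ {n} (v : Vec Bool n) → v ∈ allVecs n
∈-allVecs []          = here refl
∈-allVecs (true  ∷ v) = ∈-++⁺ˡ (∈-map⁺ (true ∷_) (∈-allVecs v))
∈-allVecs (false ∷ v) = ∈-++⁺ʳ (map (true ∷_) (allVecs _)) (∈-map⁺ (false ∷_) (∈-allVecs v))

∑-allVecs-suc : ∀ n (f : Vec Bool (suc n) → ℕ) →
                ∑ (allVecs (suc n)) f ≡ ∑ (allVecs n) (f ∘ (true ∷_)) + ∑ (allVecs n) (f ∘ (false ∷_))
∑-allVecs-suc n f = trans (∑-++ (map (true ∷_) (allVecs n)) _ f)
  (cong₂ _+_ (∑-map (allVecs n) (true ∷_) f) (∑-map (allVecs n) (false ∷_) f))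

fewChanges : ℕ → Bool → ℕ → ℕ
fewChanges n b j = ∑ (allVecs n) (λ v → ⟦ changes b v ≤? j ⟧)

-- The first node keeps the color `b` or spends one change, and the recursion closes with
-- `(n+1)^j + (n+1)^(j-1) ≤ (n+2)^j`.
fewChanges≤ : ∀ n b j → fewChanges n b j ≤ suc n ^ j
fewChanges≤ zero    b     j = ≤-trans (≤-reflexive (+-identityʳ _)) (≤-trans (⟦⟧≤1 (0 ≤? j)) (m^n>0 1 j))
fewChanges≤ (suc n) b j = ≤-trans (≤-reflexive (∑-allVecs-suc n _)) (both b)
  where
  flipped : ∀ x j → ∑ (allVecs n) (λ v → ⟦ suc (changes x v) ≤? j ⟧) + suc n ^ j ≤ suc (suc n) ^ j
  flipped x zero    = ≤-reflexive (cong (_+ 1) (trans (∑-cong (allVecs n) λ {v} _ →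
    ⟦⟧-false (suc (changes x v) ≤? 0) λ ()) (∑-zero (allVecs n))))
  flipped x (suc j) = begin
    ∑ (allVecs n) (λ v → ⟦ suc (changes x v) ≤? suc j ⟧) + suc n ^ suc j
      ≤⟨ +-monoˡ-≤ (suc n ^ suc j) (≤-trans (∑-mono (allVecs n) λ {v} _ → weaken v) (fewChanges≤ n x j)) ⟩
    suc n ^ j + suc n ^ suc j
      ≤⟨ *-monoʳ-≤ (suc (suc n)) (^-monoˡ-≤ j (n≤1+n (suc n))) ⟩
    suc (suc n) ^ suc j ∎
    where
    open ≤-Reasoning
    weaken : ∀ v → ⟦ suc (changes x v) ≤? suc j ⟧ ≤ ⟦ changes x v ≤? j ⟧
    weaken v = by-cases (suc (changes x v) ≤? suc j)
      (λ p → ≤-trans (⟦⟧≤1 (suc (changes x v) ≤? suc j)) (≤-reflexive (sym (⟦⟧-true (changes x v ≤? j) (≤-pred p)))))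
      (λ p → ≤-trans (≤-reflexive (⟦⟧-false (suc (changes x v) ≤? suc j) p)) z≤n)
  both : ∀ b → ∑ (allVecs n) (λ v → ⟦ changes b (true ∷ v) ≤? j ⟧)
             + ∑ (allVecs n) (λ v → ⟦ changes b (false ∷ v) ≤? j ⟧) ≤ suc (suc n) ^ j
  both true  = ≤-trans (≤-reflexive (+-comm (fewChanges n true j) _))
                 (≤-trans (+-monoʳ-≤ _ (fewChanges≤ n true j)) (flipped false j))
  both false = ≤-trans (+-monoʳ-≤ _ (fewChanges≤ n false j)) (flipped true j)

sampled? : (r g : ℕ) .{{_ : NonZero g}} (p : ℕ) → Dec (r % g ≡ p % g)
sampled? r g p = r % g ≟ p % g

-- A stretch of disagreement starts at a color change of v or w and ends at the next sample,
-- which is c positions ahead of p.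
hamming-between-samples : ∀ r g .{{_ : NonZero g}} {n} c p a b (v w : Vec Bool n) →
  c < g → r % g ≡ (p + c) % g →
  (∀ i → r % g ≡ (p + toℕ i) % g → lookup v i ≡ lookup w i) →
  hamming v w ≤ differ a b * c + (changes a v + changes b w) * g
hamming-between-samples r g c p a b []      []      _ _ _ = z≤n
hamming-between-samples r g zero p a b (x ∷ v) (y ∷ w) c<g here-sampled agree = begin
  hamming (x ∷ v) (y ∷ w)                                 ≡⟨ hamming-∷ x y v w ⟩
  differ x y + hamming v w                                ≡⟨ cong (_+ hamming v w) x≡y ⟩
  hamming v w                                             ≤⟨ hamming-between-samples r g (pred g) (suc p) x y v w
                                                               (≤-reflexive (suc-pred g)) next-sampled
                                                               (λ i s → agree (suc i) (trans s (cong (_% g) (sym (+-suc p (toℕ i)))))) ⟩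
  differ x y * pred g + (changes x v + changes y w) * g   ≡⟨ cong (λ d → d * pred g + (changes x v + changes y w) * g) x≡y ⟩
  (changes x v + changes y w) * g                         ≤⟨ *-monoˡ-≤ g (+-mono-≤ (m≤n+m _ (differ a x)) (m≤n+m _ (differ b y))) ⟩
  (changes a (x ∷ v) + changes b (y ∷ w)) * g             ≤⟨ m≤n+m _ _ ⟩
  differ a b * 0 + (changes a (x ∷ v) + changes b (y ∷ w)) * g ∎
  where
  open ≤-Reasoning
  x≡y : differ x y ≡ 0
  x≡y = trans (cong (λ z → differ z y) (agree zero here-sampled)) (differ-refl y)
  next-sampled : r % g ≡ (suc p + pred g) % g
  next-sampled = trans here-sampled (trans (cong (_% g) (+-identityʳ p)) (trans (sym ([m+n]%n≡m%n p g))
    (cong (_% g) (trans (cong (p +_) (sym (suc-pred g))) (+-suc p (pred g))))))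
hamming-between-samples r g (suc c) p a b (x ∷ v) (y ∷ w) c<g ahead agree = begin
  hamming (x ∷ v) (y ∷ w)
    ≡⟨ hamming-∷ x y v w ⟩
  differ x y + hamming v w
    ≤⟨ +-monoʳ-≤ (differ x y) (hamming-between-samples r g c (suc p) x y v w (<-trans (n<1+n c) c<g)
         (trans ahead (cong (_% g) (+-suc p c)))
         (λ i s → agree (suc i) (trans s (cong (_% g) (sym (+-suc p (toℕ i))))))) ⟩
  differ x y + (differ x y * c + rest)
    ≡⟨ factor (differ x y) c rest ⟩
  differ x y * suc c + rest
    ≤⟨ +-monoˡ-≤ rest (*-monoˡ-≤ (suc c) (≤-trans (differ-triangle x a y)
         (+-mono-≤ (≤-reflexive (differ-sym x a)) (differ-triangle a b y)))) ⟩
  (differ a x + (differ a b + differ b y)) * suc c + rest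
    ≡⟨ spread (differ a x) (differ a b) (differ b y) (suc c) rest ⟩
  differ a b * suc c + (differ a x + differ b y) * suc c + rest
    ≤⟨ +-monoˡ-≤ rest (+-monoʳ-≤ (differ a b * suc c) (*-monoʳ-≤ (differ a x + differ b y) (<⇒≤ c<g))) ⟩
  differ a b * suc c + (differ a x + differ b y) * g + rest
    ≡⟨ collect (differ a b * suc c) (differ a x) (differ b y) (changes x v) (changes y w) g ⟩
  differ a b * suc c + (changes a (x ∷ v) + changes b (y ∷ w)) * g ∎
  where
  open ≤-Reasoning
  rest = (changes x v + changes y w) * g
  factor : ∀ d c z → d + (d * c + z) ≡ d * (1 + c) + z
  factor = solve-∀
  spread : ∀ a b d c z → (a + (b + d)) * c + z ≡ b * c + (a + d) * c + z
  spread = solve-∀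
  collect : ∀ z a b s t g → z + (a + b) * g + (s + t) * g ≡ z + (a + s + (b + t)) * g
  collect = solve-∀

-- Each of the at most `4 * k` changes of the two colorings costs at most `g`. The stretch before
-- the first sample, at position `r % g`, costs one more `g`, rounded up to `k * g`; hence the 5.
agree⇒hamming≤ : ∀ r g .{{_ : NonZero g}} {n} k → 1 ≤ k → (v w : Coloring n) →
  numCuts v ≤ 2 * k → numCuts w ≤ 2 * k →
  (∀ i → r % g ≡ toℕ i % g → lookup v i ≡ lookup w i) → hamming v w ≤ 5 * k * g
agree⇒hamming≤ r g k 1≤k []        []        _ _ _ = z≤n
agree⇒hamming≤ r g k 1≤k (x ∷ v) (y ∷ w) cv cw agree = begin
  hamming (x ∷ v) (y ∷ w)
    ≤⟨ hamming-between-samples r g (r % g) 0 x y (x ∷ v) (y ∷ w) (m%n<n r g) (sym (m%n%n≡m%n r g)) agree ⟩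
  differ x y * (r % g) + (changes x (x ∷ v) + changes y (y ∷ w)) * g
    ≤⟨ +-mono-≤ (*-mono-≤ (differ≤1 x y) (<⇒≤ (m%n<n r g))) (*-monoˡ-≤ g (+-mono-≤ (few x v cv) (few y w cw))) ⟩
  1 * g + (2 * k + 2 * k) * g
    ≤⟨ +-monoˡ-≤ ((2 * k + 2 * k) * g) (*-monoˡ-≤ g 1≤k) ⟩
  k * g + (2 * k + 2 * k) * g
    ≡⟨ identity k g ⟩
  5 * k * g ∎
  where
  open ≤-Reasoning
  few : ∀ {n} x (v : Vec Bool n) → numCuts (x ∷ v) ≤ 2 * k → changes x (x ∷ v) ≤ 2 * k
  few x v p = ≤-trans (≤-reflexive (cong (_+ changes x v) (differ-refl x))) (≤-trans (changes≤numCuts x v) p)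
  identity : ∀ k g → k * g + (2 * k + 2 * k) * g ≡ 5 * k * g
  identity = solve-∀

bit : Bool → ℕ
bit true  = 1
bit false = 0

bit<2 : ∀ b → bit b < 2
bit<2 true  = ≤-refl
bit<2 false = s≤s z≤n

bit-injective : ∀ x y → bit x ≡ bit y → x ≡ y
bit-injective true  true  _ = refl
bit-injective false false _ = refl

module Sampling (r g : ℕ) .{{_ : NonZero g}} where

  digit : ℕ → Bool → ℕ
  digit p x = ⟦ sampled? r g p ⟧ * bit x

  digit<2 : ∀ p x → digit p x < 2
  digit<2 p x with sampled? r g p
  ... | yes _ = subst (_< 2) (sym (+-identityʳ (bit x))) (bit<2 x)
  ... | no  _ = s≤s z≤n

  -- Unsampled nodes keep a binary place with digit 0, so `% 2` and `/ 2` decode position by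
  -- position regardless of the sample.
  encode : ∀ {n} → ℕ → Vec Bool n → ℕ
  encode p []      = 0
  encode p (x ∷ v) = digit p x + encode (suc p) v * 2

  encode< : ∀ {n} p (v : Vec Bool n) → encode p v < 2 ^ n
  encode< p []            = s≤s z≤n
  encode< {suc n} p (x ∷ v) = begin-strict
    digit p x + encode (suc p) v * 2     <⟨ +-monoˡ-< (encode (suc p) v * 2) (digit<2 p x) ⟩
    suc (encode (suc p) v) * 2           ≤⟨ *-monoˡ-≤ 2 (encode< (suc p) v) ⟩
    2 ^ n * 2                            ≡⟨ *-comm (2 ^ n) 2 ⟩
    2 * 2 ^ n                            ∎
    where open ≤-Reasoning

  encode-agree : ∀ {n} p (v w : Vec Bool n) → encode p v ≡ encode p w →
                 ∀ i → r % g ≡ (p + toℕ i) % g → lookup v i ≡ lookup w i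
  encode-agree p (x ∷ v) (y ∷ w) eq zero s = bit-injective x y (trans (sym (digit≡ x)) (trans low (digit≡ y)))
    where
    s′ : r % g ≡ p % g
    s′ = trans s (cong (_% g) (+-identityʳ p))
    digit≡ : ∀ z → digit p z ≡ bit z
    digit≡ z = trans (cong (_* bit z) (⟦⟧-true (sampled? r g p) s′)) (*-identityˡ (bit z))
    lowest : ∀ z (u : Vec Bool _) → encode p (z ∷ u) % 2 ≡ digit p z
    lowest z u = trans ([m+kn]%n≡m%n (digit p z) (encode (suc p) u) 2) (m<n⇒m%n≡m (digit<2 p z))
    low : digit p x ≡ digit p y
    low = trans (sym (lowest x v)) (trans (cong (_% 2) eq) (lowest y w))
  encode-agree p (x ∷ v) (y ∷ w) eq (suc i) s =
    encode-agree (suc p) v w (trans (sym (half x v)) (trans (cong (_/ 2) eq) (half y w))) i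
      (trans s (cong (_% g) (+-suc p (toℕ i))))
    where
    half : ∀ z (u : Vec Bool _) → encode p (z ∷ u) / 2 ≡ encode (suc p) u
    half z u = trans (+-distrib-/-∣ʳ (digit p z) (divides (encode (suc p) u) refl))
      (cong₂ _+_ (m<n⇒m/n≡0 (digit<2 p z)) (m*n/n≡m (encode (suc p) u) 2))

  disagreement : ∀ {n} → Vec Bool n → Vec Bool n → ℕ
  disagreement {n} v w = ∑ (allFin n) (λ i → ⟦ sampled? r g (toℕ i) ⟧ * differ (lookup v i) (lookup w i))

  agree⇒encode : ∀ {n} p (v w : Vec Bool n) →
    (∀ i → r % g ≡ (p + toℕ i) % g → lookup v i ≡ lookup w i) → encode p v ≡ encode p w
  agree⇒encode p []      []      agree = refl
  agree⇒encode p (x ∷ v) (y ∷ w) agree = cong₂ (λ a b → a + b * 2) first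
    (agree⇒encode (suc p) v w λ i s → agree (suc i) (trans s (cong (_% g) (sym (+-suc p (toℕ i))))))
    where
    first : digit p x ≡ digit p y
    first with sampled? r g p
    ... | no  _ = refl
    ... | yes s = cong (λ z → 1 * bit z) (agree zero (trans s (cong (_% g) (sym (+-identityʳ p)))))

  no-disagreement : ∀ {n} (v w : Vec Bool n) → disagreement v w ≡ 0 →
                    ∀ i → r % g ≡ toℕ i % g → lookup v i ≡ lookup w i
  no-disagreement v w none i s = differ≡0 _ _ (n≤0⇒n≡0 (begin
    differ (lookup v i) (lookup w i)             ≡⟨ *-identityˡ _ ⟨
    1 * differ (lookup v i) (lookup w i)         ≡⟨ cong (_* differ (lookup v i) (lookup w i)) (⟦⟧-true (sampled? r g (toℕ i)) s) ⟨
    ⟦ sampled? r g (toℕ i) ⟧ * differ (lookup v i) (lookup w i)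
                                                 ≤⟨ ∑-∈ (λ i → ⟦ sampled? r g (toℕ i) ⟧ * differ (lookup v i) (lookup w i)) (∈-allFin i) ⟩
    disagreement v w                             ≡⟨ none ⟩
    0                                            ∎))
    where open ≤-Reasoning

-- Every block of `g` consecutive offsets contains exactly one that is congruent to `p`.
sample-count : ∀ g .{{_ : NonZero g}} q p → ∑ (downFrom (q * g)) (λ r → ⟦ sampled? r g p ⟧) ≡ q
sample-count g zero    p = refl
sample-count g (suc q) p = begin
  ∑ (downFrom (g + q * g)) (λ r → ⟦ sampled? r g p ⟧)
    ≡⟨ ∑-downFrom-+ g (q * g) _ ⟩
  ∑ (downFrom g) (λ x → ⟦ sampled? (x + q * g) g p ⟧) + ∑ (downFrom (q * g)) (λ r → ⟦ sampled? r g p ⟧)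
    ≡⟨ cong₂ _+_ (trans (∑-cong (downFrom g) λ {x} x∈ → trans (unfold x (∈-downFrom⁻ x∈)) (sym (*-identityʳ _)))
                        (∑-indicator {λ _ → 1} (m%n<n p g)))
                 (sample-count g q p) ⟩
  suc q ∎
  where
  open ≡-Reasoning
  unfold : ∀ x → x < g → ⟦ sampled? (x + q * g) g p ⟧ ≡ ⟦ x ≟ p % g ⟧
  unfold x x<g = cong (λ e → ⟦ e ≟ p % g ⟧) (trans ([m+kn]%n≡m%n x q g) (m<n⇒m%n≡m x<g))

-- Rational averages

toℚᵘ-ℕtoℚ : ∀ m → toℚᵘ (ℕtoℚ m) ≃ mkℚᵘ (ℤ.+ m) 0
toℚᵘ-ℕtoℚ m = ℚ.toℚᵘ-fromℚᵘ (mkℚᵘ (ℤ.+ m) 0)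

ℕtoℚ-+ : ∀ a b → ℕtoℚ (a ℕ.+ b) ≡ ℕtoℚ a ℚ.+ ℕtoℚ b
ℕtoℚ-+ a b = ℚ.toℚᵘ-injective (begin
  toℚᵘ (ℕtoℚ (a ℕ.+ b))                   ≈⟨ toℚᵘ-ℕtoℚ (a ℕ.+ b) ⟩
  mkℚᵘ (ℤ.+ (a ℕ.+ b)) 0                    ≈⟨ *≡* (cong (ℤ._* ℤ.+ 1) (cong₂ ℤ._+_ (sym (ℤ.*-identityʳ (ℤ.+ a))) (sym (ℤ.*-identityʳ (ℤ.+ b))))) ⟩
  mkℚᵘ (ℤ.+ a) 0 ℚᵘ.+ mkℚᵘ (ℤ.+ b) 0          ≈⟨ ℚᵘ.+-cong (toℚᵘ-ℕtoℚ a) (toℚᵘ-ℕtoℚ b) ⟨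
  toℚᵘ (ℕtoℚ a) ℚᵘ.+ toℚᵘ (ℕtoℚ b)        ≈⟨ ℚ.toℚᵘ-homo-+ (ℕtoℚ a) (ℕtoℚ b) ⟨
  toℚᵘ (ℕtoℚ a ℚ.+ ℕtoℚ b)                ∎)
  where open ℚᵘ.≃-Reasoning

ℕtoℚ-* : ∀ a b → ℕtoℚ (a ℕ.* b) ≡ ℕtoℚ a ℚ.* ℕtoℚ b
ℕtoℚ-* a b = ℚ.toℚᵘ-injective (begin
  toℚᵘ (ℕtoℚ (a ℕ.* b))                   ≈⟨ toℚᵘ-ℕtoℚ (a ℕ.* b) ⟩
  mkℚᵘ (ℤ.+ (a ℕ.* b)) 0                    ≈⟨ *≡* (cong (ℤ._* ℤ.+ 1) (ℤ.pos-* a b)) ⟩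
  mkℚᵘ (ℤ.+ a) 0 ℚᵘ.* mkℚᵘ (ℤ.+ b) 0          ≈⟨ ℚᵘ.*-cong (toℚᵘ-ℕtoℚ a) (toℚᵘ-ℕtoℚ b) ⟨
  toℚᵘ (ℕtoℚ a) ℚᵘ.* toℚᵘ (ℕtoℚ b)        ≈⟨ ℚ.toℚᵘ-homo-* (ℕtoℚ a) (ℕtoℚ b) ⟨
  toℚᵘ (ℕtoℚ a ℚ.* ℕtoℚ b)                ∎)
  where open ℚᵘ.≃-Reasoning

ℕtoℚ-mono : ∀ {a b} → a ℕ.≤ b → ℕtoℚ a ℚ.≤ ℕtoℚ b
ℕtoℚ-mono {a} {b} a≤b = ℚ.toℚᵘ-cancel-≤ (ℚᵘ.≤-respˡ-≃ (ℚᵘ.≃-sym (toℚᵘ-ℕtoℚ a))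
  (ℚᵘ.≤-respʳ-≃ (ℚᵘ.≃-sym (toℚᵘ-ℕtoℚ b)) (*≤* (ℤ.*-monoʳ-≤-nonNeg (ℤ.+ 1) (ℤ.+≤+ a≤b)))))

ℕtoℚ≥0 : ∀ m → 0ℚ ℚ.≤ ℕtoℚ m
ℕtoℚ≥0 m = ℕtoℚ-mono {0} {m} ℕ.z≤n

module Weighted {A : Set} (T : ℕ) (1≤T : 1 ℕ.≤ T) where

  T≢0 : ℚ.NonZero (ℕtoℚ T)
  T≢0 = ℚ.>-nonZero (ℚ.<-≤-trans (ℚ.positive⁻¹ 1ℚ) (ℕtoℚ-mono 1≤T))

  inv : ℚ
  inv = (ℚ.1/ ℕtoℚ T) {{T≢0}}

  inv≥0 : ℚ.NonNegative inv
  inv≥0 = ℚ.pos⇒nonNeg inv {{ℚ.1/pos⇒pos (ℕtoℚ T) {{ℚ.positive (ℚ.<-≤-trans (ℚ.positive⁻¹ 1ℚ) (ℕtoℚ-mono 1≤T))}}}}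

  inv-T : inv ℚ.* ℕtoℚ T ≡ 1ℚ
  inv-T = ℚ.*-inverseˡ (ℕtoℚ T) {{T≢0}}

  normalise : List (ℕ × A) → List (ℚ × A)
  normalise = map (λ o → inv ℚ.* ℕtoℚ (proj₁ o) , proj₂ o)

  normalise-nonneg : ∀ os → All (λ o → 0ℚ ℚ.≤ proj₁ o) (normalise os)
  normalise-nonneg []       = []
  normalise-nonneg (o ∷ os) = subst (ℚ._≤ inv ℚ.* ℕtoℚ (proj₁ o)) (ℚ.*-zeroʳ inv)
    (ℚ.*-monoˡ-≤-nonNeg inv {{inv≥0}} (ℕtoℚ≥0 (proj₁ o))) ∷ normalise-nonneg os

  sum-normalise : ∀ os → sumℚ (map proj₁ (normalise os)) ≡ inv ℚ.* ℕtoℚ (∑ os proj₁)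
  sum-normalise []       = sym (ℚ.*-zeroʳ inv)
  sum-normalise (o ∷ os) = trans (cong (inv ℚ.* ℕtoℚ (proj₁ o) ℚ.+_) (sum-normalise os))
    (trans (sym (ℚ.*-distribˡ-+ inv _ _)) (cong (inv ℚ.*_) (sym (ℕtoℚ-+ (proj₁ o) _))))

  dist : ∀ os → ∑ os proj₁ ≡ T → Dist A
  dist os eq = record
    { outcomes = normalise os
    ; nonneg   = normalise-nonneg os
    ; total    = trans (sum-normalise os) (trans (cong (λ t → inv ℚ.* ℕtoℚ t) eq) inv-T) }

  average≤ : ∀ {x y} → x ℕ.≤ T ℕ.* y → inv ℚ.* ℕtoℚ x ℚ.≤ ℕtoℚ y
  average≤ {x} {y} x≤ = begin
    inv ℚ.* ℕtoℚ x                  ≤⟨ ℚ.*-monoˡ-≤-nonNeg inv {{inv≥0}} (ℕtoℚ-mono x≤) ⟩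
    inv ℚ.* ℕtoℚ (T ℕ.* y)          ≡⟨ cong (inv ℚ.*_) (ℕtoℚ-* T y) ⟩
    inv ℚ.* (ℕtoℚ T ℚ.* ℕtoℚ y)     ≡⟨ ℚ.*-assoc inv (ℕtoℚ T) (ℕtoℚ y) ⟨
    inv ℚ.* ℕtoℚ T ℚ.* ℕtoℚ y       ≡⟨ cong (ℚ._* ℕtoℚ y) inv-T ⟩
    1ℚ ℚ.* ℕtoℚ y                   ≡⟨ ℚ.*-identityˡ (ℕtoℚ y) ⟩
    ℕtoℚ y                          ∎
    where open ℚ.≤-Reasoning

dirac : {A : Set} → A → Dist A
dirac a = record { outcomes = (1ℚ , a) ∷ [] ; nonneg = ℕtoℚ≥0 1 ∷ [] ; total = refl }

-- The tree of a random offset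

module Digits {S : Set} (digit : ℕ → S → ℕ) (B : ℕ) .{{_ : NonZero B}} (digit<B : ∀ j s → digit j s < B) (H : ℕ) where

  value : ℕ → ℕ → S → ℕ
  value zero    j s = 0
  value (suc c) j s = digit j s + value c (suc j) s * B

  -- The base-`B` number with the digits of levels `j` to `H ∸ 1`, level `j` lowest. Equal cells
  -- mean equal digits at all these levels, and the parent is the quotient by `B`; as division is
  -- monotone, cells are intervals of the ranks.
  cell : ℕ → S → ℕ
  cell j = value (H ∸ j) j

  value-/ : ∀ c j s → value (suc c) j s / B ≡ value c (suc j) s
  value-/ c j s = trans (+-distrib-/-∣ʳ (digit j s) (divides (value c (suc j) s) refl))
    (cong₂ _+_ (m<n⇒m/n≡0 (digit<B j s)) (m*n/n≡m (value c (suc j) s) B))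

  value-% : ∀ c j s → value (suc c) j s % B ≡ digit j s
  value-% c j s = trans ([m+kn]%n≡m%n (digit j s) (value c (suc j) s) B) (m<n⇒m%n≡m (digit<B j s))

  H∸j : ∀ {j} → j < H → H ∸ j ≡ suc (H ∸ suc j)
  H∸j {j} j<H = trans (cong (_∸ j) (sym (m+[n∸m]≡n j<H)))
    (trans (cong (_∸ j) (sym (+-suc j (H ∸ suc j)))) (m+n∸m≡n j _))

  cell-suc : ∀ j s → cell (suc j) s ≡ cell j s / B
  cell-suc j s with j <? H
  ... | yes j<H = sym (trans (cong (λ c → value c j s / B) (H∸j j<H)) (value-/ (H ∸ suc j) j s))
  ... | no  j≮H = trans (cong (λ c → value c (suc j) s) (m≤n⇒m∸n≡0 (≤-trans (≮⇒≥ j≮H) (n≤1+n j))))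
    (sym (trans (cong (λ c → value c j s / B) (m≤n⇒m∸n≡0 (≮⇒≥ j≮H))) (0/n≡0 B)))

  cell⇒digit : ∀ {j s t} → j < H → cell j s ≡ cell j t → digit j s ≡ digit j t
  cell⇒digit {j} {s} {t} j<H eq = trans (sym (last s)) (trans (cong (_% B) eq) (last t))
    where
    last : ∀ s → cell j s % B ≡ digit j s
    last s = trans (cong (λ c → value c j s % B) (H∸j j<H)) (value-% (H ∸ suc j) j s)

  digits⇒value : ∀ c j {s t} → (∀ i → j ≤ i → digit i s ≡ digit i t) → value c j s ≡ value c j t
  digits⇒value zero    j same = refl
  digits⇒value (suc c) j same =
    cong₂ (λ a b → a + b * B) (same j ≤-refl) (digits⇒value c (suc j) λ i j<i → same i (<⇒≤ j<i))

  value< : ∀ c j s → value c j s < B ^ c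
  value< zero    j s = s≤s z≤n
  value< (suc c) j s = begin-strict
    digit j s + value c (suc j) s * B   <⟨ +-monoˡ-< (value c (suc j) s * B) (digit<B j s) ⟩
    suc (value c (suc j) s) * B         ≤⟨ *-monoˡ-≤ B (value< c (suc j) s) ⟩
    B ^ c * B                           ≡⟨ *-comm (B ^ c) B ⟩
    B ^ suc c                           ∎
    where open ≤-Reasoning

  cell< : ∀ j s → cell j s < B ^ H
  cell< j s = <-≤-trans (value< (H ∸ j) j s) (^-monoʳ-≤ B (m∸n≤m H j))

module Colorings (n : ℕ) (1≤n : 1 ≤ n) (k : ℕ) (1≤k : 1 ≤ k)
  (P : Coloring n → Set) (P? : ∀ c → Dec (P c)) (P⇒cuts : ∀ c → P c → numCuts c ≤ 2 * k) where

  -- `True` is proof-irrelevant, so states with the same coloring are equal whatever `P` is.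
  S : Set
  S = Σ (Coloring n) (λ c → True (P? c))

  color-injective : {s t : S} → proj₁ s ≡ proj₁ t → s ≡ t
  color-injective {c , p} {.c , p′} refl = cong (c ,_) (T-irrelevant p p′)

  cuts≤ : ∀ (s : S) → numCuts (proj₁ s) ≤ 2 * k
  cuts≤ (c , p) = P⇒cuts c (toWitness {a? = P? c} p)

  pick : ∀ c → Dec (P c) → List S
  pick c (yes p) = (c , fromWitness {a? = P? c} p) ∷ []
  pick c (no _)  = []

  states : List S
  states = concatMap (λ c → pick c (P? c)) (allVecs n)

  complete : ∀ s → s ∈ states
  complete (c , p) = ∈-concatMap⁺ (λ c → pick c (P? c)) (lose (∈-allVecs c) (∈-pick (P? c)))
    where
    ∈-pick : ∀ d → (c , p) ∈ pick c d
    ∈-pick (yes _)  = here (color-injective refl)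
    ∈-pick (no ¬pc) = contradiction (toWitness {a? = P? c} p) ¬pc

  length-states : length states ≤ 2 * n ^ (2 * k)
  length-states = ≤-trans (≤-reflexive (trans (sym (*-identityʳ (length states)))
    (trans (sym (∑-const states 1)) (∑-concatMap (allVecs n) (λ c → pick c (P? c)) (λ _ → 1)))))
    (bound n 1≤n (λ c → pick c (P? c)) λ c → pick≤ c (P? c))
    where
    pick≤ : ∀ c d → ∑ (pick c d) (λ _ → 1) ≤ ⟦ numCuts c ≤? 2 * k ⟧
    pick≤ c (yes p) = ≤-reflexive (sym (⟦⟧-true (numCuts c ≤? 2 * k) (P⇒cuts c p)))
    pick≤ c (no _)  = z≤n
    bound : ∀ n → 1 ≤ n → (pick : Coloring n → List S) →
            (∀ c → ∑ (pick c) (λ _ → 1) ≤ ⟦ numCuts c ≤? 2 * k ⟧) →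
            ∑ (allVecs n) (λ c → ∑ (pick c) (λ _ → 1)) ≤ 2 * n ^ (2 * k)
    bound (suc n) _ pick pick≤ = begin
      ∑ (allVecs (suc n)) (λ c → ∑ (pick c) (λ _ → 1))
        ≡⟨ ∑-allVecs-suc n _ ⟩
      ∑ (allVecs n) (λ v → ∑ (pick (true ∷ v)) (λ _ → 1)) + ∑ (allVecs n) (λ v → ∑ (pick (false ∷ v)) (λ _ → 1))
        ≤⟨ +-mono-≤ (half true) (half false) ⟩
      suc n ^ (2 * k) + suc n ^ (2 * k)
        ≡⟨ cong (suc n ^ (2 * k) +_) (+-identityʳ _) ⟨
      2 * suc n ^ (2 * k) ∎
      where
      open ≤-Reasoning
      fewer : ∀ x v → ⟦ numCuts (x ∷ v) ≤? 2 * k ⟧ ≤ ⟦ changes x v ≤? 2 * k ⟧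
      fewer x v = by-cases (numCuts (x ∷ v) ≤? 2 * k)
        (λ p → ≤-trans (⟦⟧≤1 (numCuts (x ∷ v) ≤? 2 * k))
          (≤-reflexive (sym (⟦⟧-true (changes x v ≤? 2 * k) (≤-trans (changes≤numCuts x v) p)))))
        (λ p → ≤-trans (≤-reflexive (⟦⟧-false (numCuts (x ∷ v) ≤? 2 * k) p)) z≤n)
      half : ∀ x → ∑ (allVecs n) (λ v → ∑ (pick (x ∷ v)) (λ _ → 1)) ≤ suc n ^ (2 * k)
      half x = ≤-trans (∑-mono (allVecs n) λ {v} _ → ≤-trans (pick≤ (x ∷ v)) (fewer x v)) (fewChanges≤ n x (2 * k))

  -- `G` is a multiple of every modulus `16 ^ j` with `j ≤ H`, so averages over the offsets below
  -- `G` are exact. In `base`, 80 is 5 from `agree⇒hamming≤` times 16 for the step from level `i` to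
  -- `i + 1`.
  lg H G base A K : ℕ
  lg = ⌈log₂ n ⌉
  H = suc lg
  G = 16 ^ H
  base = 80 * k
  A = suc ⌊log₂ length states ⌋
  K = 12 * H + 2 * A

  -- K times the bound 5 k 16^(i+1) on the diameter of a cell at level i + 1.
  lam : ℕ → ℕ
  lam i = base * 16 ^ i * K

  residue : ℕ → ℕ → ℕ
  residue j p = (p % 16 ^ j) {{m^n≢0 16 j}}

  1≤base : 1 ≤ base
  1≤base = *-mono-≤ {1} {80} (s≤s z≤n) 1≤k

  n≤16^H : n ≤ 16 ^ H
  n≤16^H = begin
    n          ≤⟨ n≤2^⌈log₂n⌉ n ⟩
    2 ^ lg     ≤⟨ ^-monoˡ-≤ lg (s≤s (s≤s z≤n)) ⟩
    16 ^ lg    ≤⟨ ^-monoʳ-≤ 16 (n≤1+n lg) ⟩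
    16 ^ H     ∎
    where open ≤-Reasoning

  A≤ : A ≤ 2 + 2 * k * lg
  A≤ = s≤s (begin
    ⌊log₂ length states ⌋               ≤⟨ ⌊log₂⌋-mono-≤ (≤-trans length-states (*-monoʳ-≤ 2 (begin
      n ^ (2 * k)          ≤⟨ ^-monoˡ-≤ (2 * k) (n≤2^⌈log₂n⌉ n) ⟩
      (2 ^ lg) ^ (2 * k)   ≡⟨ ^-*-assoc 2 lg (2 * k) ⟩
      2 ^ (lg * (2 * k))   ≡⟨ cong (2 ^_) (*-comm lg (2 * k)) ⟩
      2 ^ (2 * k * lg)     ∎))) ⟩
    ⌊log₂ 2 ^ suc (2 * k * lg) ⌋        ≡⟨ ⌊log₂[2^n]⌋≡n (suc (2 * k * lg)) ⟩
    suc (2 * k * lg)                    ∎)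
    where open ≤-Reasoning

  module Shift (s₀ : S) (r : ℕ) where

    open module Smp (j : ℕ) = Sampling r (16 ^ j) {{m^n≢0 16 j}}
      using (encode; encode<; encode-agree; disagreement; agree⇒encode; no-disagreement)

    digit : ℕ → S → ℕ
    digit j s = encode j 0 (proj₁ s)

    open Digits digit (2 ^ n) {{m^n≢0 2 n}} (λ j s → encode< j 0 (proj₁ s)) H

    vec-ext : ∀ {m} {v w : Vec Bool m} → (∀ i → lookup v i ≡ lookup w i) → v ≡ w
    vec-ext {v = []}    {[]}    _  = refl
    vec-ext {v = x ∷ v} {y ∷ w} eq = cong₂ _∷_ (eq zero) (vec-ext (eq ∘ suc))

    -- The modulus at level 0 is 1, so every node is sampled.
    cell-injective : ∀ {s t} → cell 0 s ≡ cell 0 t → s ≡ t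
    cell-injective {s} {t} eq = color-injective (vec-ext λ i →
      encode-agree 0 0 (proj₁ s) (proj₁ t) (cell⇒digit {0} {s} {t} (s≤s z≤n) eq) i
        (trans (n%1≡0 r) (sym (n%1≡0 (toℕ i)))))

    cell-top : ∀ s t → cell H s ≡ cell H t
    cell-top s t = trans (cong (λ c → value c H s) (n∸n≡0 H)) (sym (cong (λ c → value c H t) (n∸n≡0 H)))

    open Metric H cell lam public

    cell⇒hamming : ∀ j {s t} → j ≤ H → cell j s ≡ cell j t → hamming (proj₁ s) (proj₁ t) ≤ 5 * k * 16 ^ j
    cell⇒hamming j {s} {t} j≤H eq with m≤n⇒m<n∨m≡n j≤H
    ... | inj₁ j<H = agree⇒hamming≤ r (16 ^ j) {{m^n≢0 16 j}} k 1≤k (proj₁ s) (proj₁ t) (cuts≤ s) (cuts≤ t)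
                       (encode-agree j 0 (proj₁ s) (proj₁ t) (cell⇒digit {j} {s} {t} j<H eq))
    ... | inj₂ refl = begin
      hamming (proj₁ s) (proj₁ t)  ≤⟨ hamming≤n (proj₁ s) (proj₁ t) ⟩
      n                            ≤⟨ n≤16^H ⟩
      16 ^ H                       ≡⟨ *-identityˡ (16 ^ H) ⟨
      1 * 16 ^ H                   ≤⟨ *-monoˡ-≤ (16 ^ H) (*-mono-≤ {1} {5} (s≤s z≤n) 1≤k) ⟩
      5 * k * 16 ^ H               ∎
      where open ≤-Reasoning

    -- Descends to the lowest level at which the cells agree. The level `j` just below separates the
    -- states, and its `lam j` alone is `K` times the diameter bound of the common cell.
    hamming≤dist′ : ∀ j {s t} → j ≤ H → cell j s ≡ cell j t → K * hamming (proj₁ s) (proj₁ t) ≤ dist s t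
    hamming≤dist′ zero {s} {t} _ eq = ≤-trans (≤-reflexive (trans (cong (λ x → K * hamming (proj₁ s) (proj₁ x))
      (sym (cell-injective {s} {t} eq))) (trans (cong (K *_) (hamming-refl (proj₁ s))) (*-zeroʳ K)))) z≤n
    hamming≤dist′ (suc j) {s} {t} j<H eq = by-cases (cell j s ≟ cell j t)
      (hamming≤dist′ j (<⇒≤ j<H))
      λ neq → begin
        K * hamming (proj₁ s) (proj₁ t)  ≤⟨ *-monoʳ-≤ K (cell⇒hamming (suc j) j<H eq) ⟩
        K * (5 * k * (16 * 16 ^ j))      ≡⟨ regroup K k (16 ^ j) ⟩
        lam j                            ≡⟨ *-identityʳ (lam j) ⟨
        lam j * 1                        ≡⟨ cong (lam j *_) (⟦⟧ᶜ-false (cell j s ≟ cell j t) neq) ⟨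
        lam j * differ? j s t            ≤⟨ ∑-∈ (λ j → lam j * differ? j s t) (∈-downFrom⁺ j<H) ⟩
        dist s t                         ∎
      where
      open ≤-Reasoning
      regroup : ∀ K k p → K * (5 * k * (16 * p)) ≡ 80 * k * p * K
      regroup = solve-∀

    hamming≤dist : ∀ s t → K * hamming (proj₁ s) (proj₁ t) ≤ dist s t
    hamming≤dist s t = hamming≤dist′ H ≤-refl (cell-top s t)

    -- Samples are nested: a node congruent to `r` modulo `16 ^ i` is so modulo `16 ^ j` for
    -- `j ≤ i`. Agreement on the level-`j` sample thus gives agreement on all coarser ones, and a
    -- separation can be charged to a single sampled node.
    differ?≤disagreement : ∀ j s t → differ? j s t ≤ disagreement j (proj₁ s) (proj₁ t)
    differ?≤disagreement j s t with disagreement j (proj₁ s) (proj₁ t) ≟ 0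
    ... | no  some = ≤-trans (⟦⟧ᶜ≤1 (cell j s ≟ cell j t)) (n≢0⇒n>0 some)
    ... | yes none = ≤-trans (≤-reflexive (⟦⟧ᶜ-true (cell j s ≟ cell j t) same)) z≤n
      where
      coarser : ∀ i p → j ≤ i → residue i r ≡ residue i p → residue j r ≡ residue j p
      coarser i p j≤i eq = trans (sym (refine r)) (trans (cong (residue j) eq) (refine p))
        where
        refine : ∀ x → residue j (residue i x) ≡ residue j x
        refine x = m∣n⇒o%n%m≡o%m (16 ^ j) (16 ^ i) x {{m^n≢0 16 j}} {{m^n≢0 16 i}}
          (divides (16 ^ (i ∸ j)) (trans (cong (16 ^_) (sym (m∸n+n≡m j≤i))) (^-distribˡ-+-* 16 (i ∸ j) j)))
      same : cell j s ≡ cell j t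
      same = digits⇒value (H ∸ j) j {s} {t} λ i j≤i → agree⇒encode i 0 (proj₁ s) (proj₁ t) λ x smp →
        no-disagreement j (proj₁ s) (proj₁ t) none x (coarser i (toℕ x) j≤i smp)

    pays : S → Fin n → ℕ
    pays s = hit (proj₁ s)

    pays≤1 : ∀ s e → pays s e ≤ 1
    pays≤1 s = hit≤1 (proj₁ s)

    open WorkFunction states dist K pays public

    ratio : ℕ
    ratio = 1 + 2 * (128 * K + 4 * H)

    solution : Solution s₀ ratio
    solution = RandomTree.solution states complete s₀ lg cell (λ x → (x / (2 ^ n)) {{m^n≢0 2 n}}) cell-suc
      (/-monoˡ-≤ (2 ^ n) {{m^n≢0 2 n}}) cell-injective cell-top ((2 ^ n) ^ H) cell< base 1≤base pays pays≤1

    open Solution solution public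

    cost : ((S → ℕ) → S) → (S → ℕ) → List (Fin n) → ℕ
    cost x w []      = 0
    cost x w (e ∷ σ) = hit (proj₁ (x w)) e + (hamming (proj₁ (x w)) (proj₁ (x (serve w e))) + cost x (serve w e) σ)

    cost≤online : ∀ x w σ → K * cost x w σ ≤ online x w σ
    cost≤online x w []      = ≤-reflexive (*-zeroʳ K)
    cost≤online x w (e ∷ σ) = begin
      K * (h + (m + cost x w′ σ))         ≡⟨ distribute K h m (cost x w′ σ) ⟩
      K * h + K * m + K * cost x w′ σ     ≤⟨ +-mono-≤ (+-monoʳ-≤ (K * h) (hamming≤dist (x w) (x w′)))
                                               (cost≤online x w′ σ) ⟩
      online x w (e ∷ σ)                  ∎
      where
      open ≤-Reasoning
      w′ = serve w e
      h = hit (proj₁ (x w)) e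
      m = hamming (proj₁ (x w)) (proj₁ (x w′))
      distribute : ∀ k a b c → k * (a + (b + c)) ≡ k * a + k * b + k * c
      distribute = solve-∀

  module Average (s₀ : S) where

    separation : ℕ → ℕ → S → S → ℕ
    separation r j s t = Sampling.disagreement r (16 ^ j) {{m^n≢0 16 j}} (proj₁ s) (proj₁ t)

    ∑separation : ∀ j s t → j < H →
      ∑ (downFrom G) (λ r → separation r j s t) ≡ 16 ^ (H ∸ j) * hamming (proj₁ s) (proj₁ t)
    ∑separation j s t j<H = begin
      ∑ (downFrom G) (λ r → ∑ (allFin n) (λ i → sample r i * d i))
        ≡⟨ ∑-swap (downFrom G) (allFin n) _ ⟩
      ∑ (allFin n) (λ i → ∑ (downFrom G) (λ r → sample r i * d i))
        ≡⟨ ∑-cong (allFin n) (λ {i} _ → trans (∑-cong (downFrom G) λ {r} _ → *-comm (sample r i) (d i))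
             (trans (∑-*ˡ (downFrom G) (d i) _) (trans (cong (d i *_) (samples i)) (*-comm (d i) _)))) ⟩
      ∑ (allFin n) (λ i → 16 ^ (H ∸ j) * d i)
        ≡⟨ ∑-*ˡ (allFin n) (16 ^ (H ∸ j)) d ⟩
      16 ^ (H ∸ j) * hamming (proj₁ s) (proj₁ t) ∎
      where
      open ≡-Reasoning
      sample : ℕ → Fin n → ℕ
      sample r i = ⟦ sampled? r (16 ^ j) {{m^n≢0 16 j}} (toℕ i) ⟧
      d : Fin n → ℕ
      d i = differ (lookup (proj₁ s) i) (lookup (proj₁ t) i)
      samples : ∀ i → ∑ (downFrom G) (λ r → sample r i) ≡ 16 ^ (H ∸ j)
      samples i = trans (cong (λ m → ∑ (downFrom m) (λ r → sample r i))
          (trans (cong (16 ^_) (sym (m∸n+n≡m (<⇒≤ j<H)))) (^-distribˡ-+-* 16 (H ∸ j) j)))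
        (sample-count (16 ^ j) {{m^n≢0 16 j}} (16 ^ (H ∸ j)) (toℕ i))

    stretch : ℕ
    stretch = H * (base * K * G)

    -- `lam j` grows like `16 ^ j` and the density of the sample falls like `16 ^ (- j)`, so all `H`
    -- levels contribute equally.
    ∑dist≤ : ∀ s t → ∑ (downFrom G) (λ r → Shift.dist s₀ r s t) ≤ stretch * hamming (proj₁ s) (proj₁ t)
    ∑dist≤ s t = begin
      ∑ (downFrom G) (λ r → Shift.dist s₀ r s t)
        ≤⟨ ∑-mono (downFrom G) (λ {r} _ → ∑-mono (downFrom H) λ {j} _ →
             *-monoʳ-≤ (lam j) (Shift.differ?≤disagreement s₀ r j s t)) ⟩
      ∑ (downFrom G) (λ r → ∑ (downFrom H) (λ j → lam j * separation r j s t))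
        ≡⟨ ∑-swap (downFrom G) (downFrom H) _ ⟩
      ∑ (downFrom H) (λ j → ∑ (downFrom G) (λ r → lam j * separation r j s t))
        ≡⟨ ∑-cong (downFrom H) (λ {j} j∈ → trans (∑-*ˡ (downFrom G) (lam j) _)
             (trans (cong (lam j *_) (∑separation j s t (∈-downFrom⁻ j∈))) (level j (∈-downFrom⁻ j∈)))) ⟩
      ∑ (downFrom H) (λ _ → base * K * G * ham)
        ≡⟨ trans (∑-const (downFrom H) _) (cong (_* (base * K * G * ham)) (length-downFrom H)) ⟩
      H * (base * K * G * ham)
        ≡⟨ *-assoc H (base * K * G) ham ⟨
      stretch * ham ∎
      where
      open ≤-Reasoning
      ham = hamming (proj₁ s) (proj₁ t)
      level : ∀ j → j < H → lam j * (16 ^ (H ∸ j) * ham) ≡ base * K * G * ham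
      level j j<H = trans (regroup base (16 ^ j) K (16 ^ (H ∸ j)) ham)
        (cong (λ g → base * K * g * ham) (trans (sym (^-distribˡ-+-* 16 (H ∸ j) j)) (cong (16 ^_) (m∸n+n≡m (<⇒≤ j<H)))))
        where
        regroup : ∀ b p k p′ h → b * p * k * (p′ * h) ≡ b * k * (p′ * p) * h
        regroup = solve-∀

    ∑offline≤ : ∀ s σ (ts : Vec S (length σ)) →
      ∑ (downFrom G) (λ r → Shift.offline s₀ r s σ ts) ≤ stretch * offCostFrom (proj₁ s) σ (Vec.map proj₁ ts)
    ∑offline≤ s []      []       = ≤-trans (≤-reflexive (∑-zero (downFrom G))) z≤n
    ∑offline≤ s (e ∷ σ) (t ∷ ts) = begin
      ∑ (downFrom G) (λ r → K * h + Shift.dist s₀ r t s + Shift.offline s₀ r t σ ts)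
        ≡⟨ trans (∑-distrib-+ (downFrom G) _ _) (cong (_+ later) (trans (∑-distrib-+ (downFrom G) _ _)
             (cong (_+ ∑ (downFrom G) (λ r → Shift.dist s₀ r t s))
               (trans (∑-const (downFrom G) (K * h)) (cong (_* (K * h)) (length-downFrom G)))))) ⟩
      G * (K * h) + ∑ (downFrom G) (λ r → Shift.dist s₀ r t s) + later
        ≤⟨ +-mono-≤ (+-mono-≤ hit≤ (≤-trans (∑dist≤ t s) (≤-reflexive (cong (stretch *_) (hamming-sym (proj₁ t) (proj₁ s))))))
             (∑offline≤ t σ ts) ⟩
      stretch * h + stretch * hamming (proj₁ s) (proj₁ t) + stretch * offCostFrom (proj₁ t) σ (Vec.map proj₁ ts)
        ≡⟨ factor stretch h (hamming (proj₁ s) (proj₁ t)) _ ⟩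
      stretch * offCostFrom (proj₁ s) (e ∷ σ) (Vec.map proj₁ (t ∷ ts)) ∎
      where
      open ≤-Reasoning
      h = hit (proj₁ s) e
      later = ∑ (downFrom G) (λ r → Shift.offline s₀ r t σ ts)
      hit≤ : G * (K * h) ≤ stretch * h
      hit≤ = ≤-trans (≤-reflexive (regroup G K h)) (*-monoˡ-≤ h (≤-trans
        (≤-trans (≤-reflexive (cong (_* G) (sym (*-identityˡ K)))) (*-monoˡ-≤ G (*-monoˡ-≤ K 1≤base)))
        (m≤m+n _ _)))
        where
        regroup : ∀ g k h → g * (k * h) ≡ k * g * h
        regroup = solve-∀
      factor : ∀ c a b d → c * a + c * b + c * d ≡ c * (a + b + d)
      factor = solve-∀

-- The online algorithm

module Mixture (n : ℕ) (1≤n : 1 ≤ n) (k : ℕ) (1≤k : 1 ≤ k)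
  (P : Coloring n → Set) (P? : ∀ c → Dec (P c)) (P⇒cuts : ∀ c → P c → numCuts c ≤ 2 * k)
  (c₀ : Coloring n) (Pc₀ : P c₀) where

  open Colorings n 1≤n k 1≤k P P? P⇒cuts public

  s₀ : S
  s₀ = c₀ , fromWitness {a? = P? c₀} Pc₀

  open Average s₀

  ratio : ℕ
  ratio = 1 + 2 * (128 * K + 4 * H)

  open module Sol (r : ℕ) = WorkFunction.Solution (Shift.solution s₀ r)
    using (coordinates; cap; wt; weight≥1; competitive; additive) renaming (state to stateAt; state-initial to stateAt-initial)

  weight : ℕ → ℕ
  weight r = 𝔼 (cap r) (wt r) (λ _ → 1)

  common : ℕ
  common = product (map weight (downFrom G))

  -- The total weights of different offsets differ, so each offset is rescaled to the same total.
  scale : ℕ → ℕ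
  scale r = (common / weight r) {{>-nonZero (weight≥1 r)}}

  scale-weight : ∀ {r} → r < G → scale r * weight r ≡ common
  scale-weight {r} r<G = m/n*n≡m {{>-nonZero (weight≥1 r)}} (∈⇒∣product (∈-map⁺ weight (∈-downFrom⁺ r<G)))

  State : Set
  State = Σ ℕ (λ r → Vec ℕ (coordinates r)) × (S → ℕ)

  current : State → S
  current ((r , Y) , w) = stateAt r Y w

  offsetOutcomes : ℕ → List (ℕ × State)
  offsetOutcomes r = map (λ o → scale r * proj₁ o , (r , proj₂ o) , Shift.initial s₀ r s₀) (seeds (cap r) (wt r))

  outcomes : List (ℕ × State)
  outcomes = concatMap offsetOutcomes (downFrom G)

  ∑outcomes : ∀ (F : State → ℕ) → ∑ outcomes (λ o → proj₁ o * F (proj₂ o))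
            ≡ ∑ (downFrom G) (λ r → scale r * 𝔼 (cap r) (wt r) (λ Y → F ((r , Y) , Shift.initial s₀ r s₀)))
  ∑outcomes F = trans (∑-concatMap (downFrom G) offsetOutcomes _) (∑-cong (downFrom G) λ {r} _ →
    trans (∑-map (seeds (cap r) (wt r)) _ _) (trans (∑-cong (seeds (cap r) (wt r)) λ {o} _ → *-assoc (scale r) (proj₁ o) _)
      (∑-*ˡ (seeds (cap r) (wt r)) (scale r) _)))

  total : ∑ outcomes proj₁ ≡ G * common
  total = trans (∑-cong outcomes λ {o} _ → sym (*-identityʳ (proj₁ o)))
    (trans (∑outcomes (λ _ → 1)) (trans (∑-cong (downFrom G) λ {r} r∈ → scale-weight (∈-downFrom⁻ r∈))
      (trans (∑-const (downFrom G) common) (cong (_* common) (length-downFrom G)))))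

  1≤G : 1 ≤ G
  1≤G = m^n>0 16 H

  weights≢0 : ∀ rs → All NonZero (map weight rs)
  weights≢0 rs = All.map⁺ (All.tabulate λ {r} _ → >-nonZero (weight≥1 r))

  1≤total : 1 ≤ G * common
  1≤total = *-mono-≤ 1≤G (>-nonZero⁻¹ common {{product≢0 (weights≢0 (downFrom G))}})

  open Weighted {State} (G * common) 1≤total

  -- Offset and seed are drawn at the start, and later steps are deterministic; an oblivious
  -- adversary cannot exploit this. As positions lie in `S`, every state of the algorithm is
  -- allowed, reachable or not.
  ONL : OnlineAlg n
  ONL = record
    { State = State
    ; color = λ s → proj₁ (current s)
    ; start = dist outcomes total
    ; step  = λ s e → dirac (proj₁ s , Shift.serve s₀ (proj₁ (proj₁ s)) (proj₂ s) e)
    }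

  cost : State → List (Fin n) → ℕ
  cost ((r , Y) , w) = Shift.cost s₀ r (stateAt r Y) w

  expFrom≡ : ∀ s σ → expFrom ONL s σ ≡ ℕtoℚ (cost s σ)
  expFrom≡ s []      = refl
  expFrom≡ s@((r , Y) , w) (e ∷ σ) = begin
    ℕtoℚ h ℚ.+ (1ℚ ℚ.* (ℕtoℚ m ℚ.+ expFrom ONL s′ σ) ℚ.+ 0ℚ)
      ≡⟨ cong (ℕtoℚ h ℚ.+_) (trans (ℚ.+-identityʳ _) (ℚ.*-identityˡ _)) ⟩
    ℕtoℚ h ℚ.+ (ℕtoℚ m ℚ.+ expFrom ONL s′ σ)
      ≡⟨ cong (λ x → ℕtoℚ h ℚ.+ (ℕtoℚ m ℚ.+ x)) (expFrom≡ s′ σ) ⟩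
    ℕtoℚ h ℚ.+ (ℕtoℚ m ℚ.+ ℕtoℚ (cost s′ σ))
      ≡⟨ cong (ℕtoℚ h ℚ.+_) (ℕtoℚ-+ m (cost s′ σ)) ⟨
    ℕtoℚ h ℚ.+ ℕtoℚ (m + cost s′ σ)
      ≡⟨ ℕtoℚ-+ h (m + cost s′ σ) ⟨
    ℕtoℚ (cost s (e ∷ σ)) ∎
    where
    open ≡-Reasoning
    s′ : State
    s′ = (r , Y) , Shift.serve s₀ r w e
    h = hit (proj₁ (current s)) e
    m = hamming (proj₁ (current s)) (proj₁ (current s′))

  expStart≡ : ∀ init os σ → expStart ONL init (normalise os) σ
            ≡ inv ℚ.* ℕtoℚ (∑ os (λ o → proj₁ o * (hamming init (proj₁ (current (proj₂ o))) + cost (proj₂ o) σ)))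
  expStart≡ init []             σ = sym (ℚ.*-zeroʳ inv)
  expStart≡ init ((p , s) ∷ os) σ = begin
    inv ℚ.* ℕtoℚ p ℚ.* (ℕtoℚ m ℚ.+ expFrom ONL s σ) ℚ.+ expStart ONL init (normalise os) σ
      ≡⟨ cong₂ (λ x y → inv ℚ.* ℕtoℚ p ℚ.* (ℕtoℚ m ℚ.+ x) ℚ.+ y) (expFrom≡ s σ) (expStart≡ init os σ) ⟩
    inv ℚ.* ℕtoℚ p ℚ.* (ℕtoℚ m ℚ.+ ℕtoℚ (cost s σ)) ℚ.+ inv ℚ.* ℕtoℚ rest
      ≡⟨ cong (λ x → inv ℚ.* ℕtoℚ p ℚ.* x ℚ.+ inv ℚ.* ℕtoℚ rest) (ℕtoℚ-+ m (cost s σ)) ⟨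
    inv ℚ.* ℕtoℚ p ℚ.* ℕtoℚ (m + cost s σ) ℚ.+ inv ℚ.* ℕtoℚ rest
      ≡⟨ cong (ℚ._+ inv ℚ.* ℕtoℚ rest) (trans (ℚ.*-assoc inv _ _) (cong (inv ℚ.*_) (sym (ℕtoℚ-* p _)))) ⟩
    inv ℚ.* ℕtoℚ (p * (m + cost s σ)) ℚ.+ inv ℚ.* ℕtoℚ rest
      ≡⟨ trans (sym (ℚ.*-distribˡ-+ inv _ _)) (cong (inv ℚ.*_) (sym (ℕtoℚ-+ (p * (m + cost s σ)) rest))) ⟩
    inv ℚ.* ℕtoℚ (p * (m + cost s σ) + rest) ∎
    where
    open ≡-Reasoning
    m = hamming init (proj₁ (current s))
    rest = ∑ os (λ o → proj₁ o * (hamming init (proj₁ (current (proj₂ o))) + cost (proj₂ o) σ))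

  1≤K : 1 ≤ K
  1≤K = ≤-trans (*-mono-≤ {1} {2} {1} {A} (s≤s z≤n) (s≤s z≤n)) (m≤n+m (2 * A) (12 * H))

  -- `n` covers the initial recoloring. The additive terms are summed over the offsets instead of
  -- averaged, which is crude but independent of the requests.
  β : ℕ
  β = n + ∑ (downFrom G) additive

  module _ (init : Coloring n) (σ : List (Fin n)) (ts : Vec S (length σ)) where

    off : ℕ
    off = offCostFrom c₀ σ (Vec.map proj₁ ts)

    payment : State → ℕ
    payment s = hamming init (proj₁ (current s)) + cost s σ

    offset-bound : ∀ r → K * 𝔼 (cap r) (wt r) (λ Y → payment ((r , Y) , Shift.initial s₀ r s₀))
                 ≤ weight r * (K * n + (ratio * Shift.offline s₀ r s₀ σ ts + additive r))
    offset-bound r = begin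
      K * E (λ Y → payment ((r , Y) , w₀))
        ≡⟨ 𝔼-*ˡ (cap r) (wt r) K _ ⟨
      E (λ Y → K * payment ((r , Y) , w₀))
        ≤⟨ 𝔼-mono (cap r) (wt r) (λ Y _ → ≤-trans (≤-reflexive (*-distribˡ-+ K (moved Y) (cost ((r , Y) , w₀) σ)))
             (+-mono-≤ (*-monoʳ-≤ K (hamming≤n init (proj₁ (stateAt r Y w₀)))) (Shift.cost≤online s₀ r (stateAt r Y) w₀ σ))) ⟩
      E (λ Y → K * n + Shift.online s₀ r (stateAt r Y) w₀ σ)
        ≡⟨ trans (𝔼-+ (cap r) (wt r) _ _) (cong (_+ E (λ Y → Shift.online s₀ r (stateAt r Y) w₀ σ))
             (trans (𝔼-const (cap r) (wt r) (K * n)) (*-comm (K * n) (weight r)))) ⟩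
      weight r * (K * n) + E (λ Y → Shift.online s₀ r (stateAt r Y) w₀ σ)
        ≤⟨ +-monoʳ-≤ (weight r * (K * n)) (competitive r σ ts) ⟩
      weight r * (K * n) + weight r * (ratio * Shift.offline s₀ r s₀ σ ts + additive r)
        ≡⟨ *-distribˡ-+ (weight r) (K * n) _ ⟨
      weight r * (K * n + (ratio * Shift.offline s₀ r s₀ σ ts + additive r)) ∎
      where
      open ≤-Reasoning
      E = 𝔼 (cap r) (wt r)
      w₀ = Shift.initial s₀ r s₀
      moved : Vec ℕ (coordinates r) → ℕ
      moved Y = hamming init (proj₁ (stateAt r Y w₀))

    -- Tree costs carry a factor `K`, as does `stretch`. Cancelling it leaves the ratio on the tree
    -- times the average stretch `H * base`, each of them O(k log n).
    payments≤ : ∑ outcomes (λ o → proj₁ o * payment (proj₂ o)) ≤ G * common * (ratio * (H * base) * off + β)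
    payments≤ = *-cancelˡ-≤ K {{>-nonZero 1≤K}} (begin
      K * ∑ outcomes (λ o → proj₁ o * payment (proj₂ o))
        ≡⟨ cong (K *_) (∑outcomes payment) ⟩
      K * ∑ (downFrom G) (λ r → scale r * E r)
        ≡⟨ ∑-*ˡ (downFrom G) K _ ⟨
      ∑ (downFrom G) (λ r → K * (scale r * E r))
        ≤⟨ ∑-mono (downFrom G) (λ {r} r∈ → per-offset r (∈-downFrom⁻ r∈)) ⟩
      ∑ (downFrom G) (λ r → common * (K * n + (ratio * Shift.offline s₀ r s₀ σ ts + additive r)))
        ≡⟨ trans (∑-*ˡ (downFrom G) common _) (cong (common *_) (trans (∑-distrib-+ (downFrom G) _ _)
             (cong₂ _+_ (trans (∑-const (downFrom G) (K * n)) (cong (_* (K * n)) (length-downFrom G)))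
               (trans (∑-distrib-+ (downFrom G) _ _) (cong (_+ extra) (∑-*ˡ (downFrom G) ratio _)))))) ⟩
      common * (G * (K * n) + (ratio * ∑ (downFrom G) (λ r → Shift.offline s₀ r s₀ σ ts) + extra))
        ≤⟨ *-monoʳ-≤ common (+-monoʳ-≤ (G * (K * n)) (+-mono-≤ (*-monoʳ-≤ ratio (∑offline≤ s₀ σ ts)) extra≤)) ⟩
      common * (G * (K * n) + (ratio * (H * (base * K * G) * off) + K * G * extra))
        ≡⟨ regroup common G K n ratio H base off extra ⟩
      K * (G * common * (ratio * (H * base) * off + (n + extra))) ∎)
      where
      open ≤-Reasoning
      E : ℕ → ℕ
      E r = 𝔼 (cap r) (wt r) (λ Y → payment ((r , Y) , Shift.initial s₀ r s₀))
      extra = ∑ (downFrom G) additive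
      -- Inflated so that `K * G` can be factored out of every summand.
      extra≤ : extra ≤ K * G * extra
      extra≤ = ≤-trans (≤-reflexive (sym (*-identityˡ extra))) (*-monoˡ-≤ extra (*-mono-≤ 1≤K 1≤G))
      per-offset : ∀ r → r < G → K * (scale r * E r)
                 ≤ common * (K * n + (ratio * Shift.offline s₀ r s₀ σ ts + additive r))
      per-offset r r<G = begin
        K * (scale r * E r)             ≡⟨ swap K (scale r) (E r) ⟩
        scale r * (K * E r)             ≤⟨ *-monoʳ-≤ (scale r) (offset-bound r) ⟩
        scale r * (weight r * x)        ≡⟨ *-assoc (scale r) (weight r) x ⟨
        scale r * weight r * x          ≡⟨ cong (_* x) (scale-weight r<G) ⟩
        common * x                      ∎
        where
        x = K * n + (ratio * Shift.offline s₀ r s₀ σ ts + additive r)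
        swap : ∀ a b c → a * (b * c) ≡ b * (a * c)
        swap = solve-∀
      regroup : ∀ Q G K n ρ H b o x → Q * (G * (K * n) + (ρ * (H * (b * K * G) * o) + K * G * x))
                                    ≡ K * (G * Q * (ρ * (H * b) * o + (n + x)))
      regroup = solve-∀

    expCost≤ : expCost ONL init σ ℚ.≤ ℕtoℚ (ratio * (H * base)) ℚ.* ℕtoℚ off ℚ.+ ℕtoℚ β
    expCost≤ = begin
      expCost ONL init σ                                            ≡⟨ expStart≡ init outcomes σ ⟩
      inv ℚ.* ℕtoℚ (∑ outcomes (λ o → proj₁ o * payment (proj₂ o))) ≤⟨ average≤ payments≤ ⟩
      ℕtoℚ (ratio * (H * base) * off + β)                           ≡⟨ ℕtoℚ-+ (ratio * (H * base) * off) β ⟩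
      ℕtoℚ (ratio * (H * base) * off) ℚ.+ ℕtoℚ β                    ≡⟨ cong (ℚ._+ ℕtoℚ β) (ℕtoℚ-* (ratio * (H * base)) off) ⟩
      ℕtoℚ (ratio * (H * base)) ℚ.* ℕtoℚ off ℚ.+ ℕtoℚ β             ∎
      where open ℚ.≤-Reasoning

  Starts : State → Set
  Starts s = proj₁ (current s) ≡ c₀

  normalise-starts : ∀ {os} → All (λ o → Starts (proj₂ o)) os → All (λ o → Starts (proj₂ o)) (normalise os)
  normalise-starts []       = []
  normalise-starts (p ∷ ps) = p ∷ normalise-starts ps

  start-state : ∀ r {o} → o ∈ seeds (cap r) (wt r) → Starts ((r , proj₂ o) , Shift.initial s₀ r s₀)
  start-state r {o} o∈ = cong proj₁ (stateAt-initial r (proj₂ o) (seeds-bounded (cap r) (wt r) o∈))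

  offset-starts : ∀ r → All (λ o → Starts (proj₂ o)) (offsetOutcomes r)
  offset-starts r = All.map⁺ (All.tabulate (start-state r))

  all-start : ∀ rs → All (λ o → Starts (proj₂ o)) (concatMap offsetOutcomes rs)
  all-start []       = []
  all-start (r ∷ rs) = All.++⁺ (offset-starts r) (all-start rs)

  starts : All (λ o → proj₁ (current (proj₂ o)) ≡ c₀) (Dist.outcomes (OnlineAlg.start ONL))
  starts = normalise-starts (all-start (downFrom G))


-- The final constant and the assembly.

-- With `x = k * l`: both 2s in the first factor come from `suc l ≤ 2 * x`, the 8 from
-- `2 * A ≤ 8 * x`, and `2 * d` from `suc l ≤ 2 * l`.
constantOf : ℕ → ℕ → ℕ → ℕ → ℕ
constantOf a b c d = (1 + 2 * (a * (b * 2 + 8) + c * 2)) * (2 * d)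

-- The numerals of ratio * (H * base) are kept as variables a, b, c, d.
coarsen : ∀ a b c d k l A → 1 ≤ k → 1 ≤ l → A ≤ 2 + 2 * k * l →
  (1 + 2 * (a * (b * suc l + 2 * A) + c * suc l)) * (suc l * (d * k)) ≤ constantOf a b c d * (k * k) * (l * l)
coarsen a b c d k l A 1≤k 1≤l A≤ = begin
  (1 + 2 * (a * (b * suc l + 2 * A) + c * suc l)) * (suc l * (d * k))
    ≤⟨ *-mono-≤ (+-mono-≤ 1≤x (*-monoʳ-≤ 2 (+-mono-≤ (*-monoʳ-≤ a (+-mono-≤ (*-monoʳ-≤ b suc≤) (*-monoʳ-≤ 2 A≤x)))
         (*-monoʳ-≤ c suc≤)))) (*-monoˡ-≤ (d * k) (+-monoˡ-≤ l 1≤l)) ⟩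
  (x + 2 * (a * (b * (2 * x) + 2 * (4 * x)) + c * (2 * x))) * ((l + l) * (d * k))
    ≡⟨ identity a b c d k l ⟩
  constantOf a b c d * (k * k) * (l * l) ∎
  where
  open ≤-Reasoning
  x = k * l
  1≤x : 1 ≤ x
  1≤x = *-mono-≤ 1≤k 1≤l
  suc≤ : suc l ≤ 2 * x
  suc≤ = ≤-trans (+-mono-≤ 1≤x (≤-trans (≤-reflexive (sym (*-identityˡ l))) (*-monoˡ-≤ l 1≤k)))
                 (≤-reflexive (cong (x +_) (sym (+-identityʳ x))))
  A≤x : A ≤ 4 * x
  A≤x = ≤-trans A≤ (≤-trans (+-monoˡ-≤ (2 * k * l) (*-monoʳ-≤ 2 1≤x)) (≤-reflexive (four k l)))
    where
    four : ∀ k l → 2 * (k * l) + 2 * k * l ≡ 4 * (k * l)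
    four = solve-∀
  identity : ∀ a b c d k l →
    (k * l + 2 * (a * (b * (2 * (k * l)) + 2 * (4 * (k * l))) + c * (2 * (k * l)))) * ((l + l) * (d * k))
    ≡ (1 + 2 * (a * (b * 2 + 8) + c * 2)) * (2 * d) * (k * k) * (l * l)
  identity = solve-∀

abstract
  constant : ℕ
  constant = constantOf 128 12 4 80

  ratio≤ : ∀ k l A → 1 ≤ k → 1 ≤ l → A ≤ 2 + 2 * k * l →
    (1 + 2 * (128 * (12 * suc l + 2 * A) + 4 * suc l)) * (suc l * (80 * k)) ≤ constant * (k * k) * (l * l)
  ratio≤ = coarsen 128 12 4 80

balanced-mono : ∀ {n α α′} (c : Coloring n) → α ℚ.≤ α′ → Balanced α c → Balanced α′ c
balanced-mono {n} c α≤α′ (red , blue) = ℚ.≤-trans red scaled , ℚ.≤-trans blue scaled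
  where
  scaled = ℚ.*-monoʳ-≤-nonNeg (ℕtoℚ n) {{ℚ.nonNegative (ℕtoℚ≥0 n)}} α≤α′

allowed? : ∀ {n} k α (c : Coloring n) → Dec (Allowed k α c)
allowed? k α c = ((_ ℚ.≤? _) ×-dec (_ ℚ.≤? _)) ×-dec (_ ≤? _)

module Construction (n : ℕ) (2≤n : 2 ≤ n) (k : ℕ) {{k≢0 : NonZero k}} (α : ℚ) (k≤α : onePlusInv k ℚ.≤ α)
  (reb : Coloring n → Coloring n) (spec : RebalanceSpec k reb)
  (init : Coloring n) (init-balanced : Balanced 1ℚ init) where

  reb-allowed : Allowed k α (reb init)
  reb-allowed = balanced-mono (reb init) k≤α (proj₂ (proj₂ (spec init init-balanced)))
              , ≤-trans (≤-reflexive (proj₁ (proj₂ (spec init init-balanced)))) (m⊓n≤m (2 * k) (numCuts init))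

  open Mixture n (≤-trans (s≤s z≤n) 2≤n) k (>-nonZero⁻¹ k) (Allowed k α) (allowed? k α) (λ c → proj₂)
    (reb init) reb-allowed

  allowed : ∀ s → Allowed k α (proj₁ (current s))
  allowed s = toWitness {a? = allowed? k α (proj₁ (current s))} (proj₂ (current s))

  lift : ∀ {m} {cs : Vec (Coloring n) m} → OffValid k α cs → Vec S m
  lift []                 = []
  lift {cs = c ∷ _} (p ∷ ps) = (c , fromWitness {a? = allowed? k α c} p) ∷ lift ps

  lift-colors : ∀ {m} {cs : Vec (Coloring n) m} (ps : OffValid k α cs) → Vec.map proj₁ (lift ps) ≡ cs
  lift-colors []       = refl
  lift-colors (p ∷ ps) = cong (_ ∷_) (lift-colors ps)

  bound : ∀ σ (cs : Vec (Coloring n) (length σ)) → OffValid k α cs → expCost ONL init σ ℚ.≤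
    ℕtoℚ (constant * (k * k) * (⌈log₂ n ⌉ * ⌈log₂ n ⌉)) ℚ.* ℕtoℚ (offCost init (reb init) σ cs) ℚ.+ ℕtoℚ β
  bound σ cs valid = begin
    expCost ONL init σ
      ≤⟨ expCost≤ init σ (lift valid) ⟩
    ℕtoℚ (ratio * (H * base)) ℚ.* ℕtoℚ (off init σ (lift valid)) ℚ.+ ℕtoℚ β
      ≡⟨ cong (ℚ._+ ℕtoℚ β) (ℕtoℚ-* (ratio * (H * base)) (off init σ (lift valid))) ⟨
    ℕtoℚ (ratio * (H * base) * off init σ (lift valid)) ℚ.+ ℕtoℚ β
      ≤⟨ ℚ.+-monoˡ-≤ (ℕtoℚ β) (ℕtoℚ-mono (*-mono-≤
           (ratio≤ k lg A (>-nonZero⁻¹ k) (⌈log₂⌉-mono-≤ {2} {n} 2≤n) A≤)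
           (≤-trans (≤-reflexive (cong (offCostFrom (reb init) σ) (lift-colors valid))) (m≤n+m _ (hamming init (reb init)))))) ⟩
    ℕtoℚ (constant * (k * k) * (⌈log₂ n ⌉ * ⌈log₂ n ⌉) * offCost init (reb init) σ cs) ℚ.+ ℕtoℚ β
      ≡⟨ cong (ℚ._+ ℕtoℚ β) (ℕtoℚ-* (constant * (k * k) * (⌈log₂ n ⌉ * ⌈log₂ n ⌉)) _) ⟩
    ℕtoℚ (constant * (k * k) * (⌈log₂ n ⌉ * ⌈log₂ n ⌉)) ℚ.* ℕtoℚ (offCost init (reb init) σ cs) ℚ.+ ℕtoℚ β ∎
    where open ℚ.≤-Reasoning

  rebalanced-online : Σ (OnlineAlg n) λ ONL → InClass ONL k α reb init × Σ ℚ λ β →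
    (σ : List (Fin n)) (off : Vec (Coloring n) (length σ)) → OffValid k α off → expCost ONL init σ ℚ.≤
    ℕtoℚ (constant * (k * k) * (⌈log₂ n ⌉ * ⌈log₂ n ⌉)) ℚ.* ℕtoℚ (offCost init (reb init) σ off) ℚ.+ β
  rebalanced-online = ONL , (allowed , starts) , ℕtoℚ β , bound

theorem3 : Σ ℕ λ c →
    (n : ℕ) → 2 ≤ n → 2 ∣ n →
    (k : ℕ) → {{_ : NonZero k}} →
    (α : ℚ) → onePlusInv k ℚ.≤ α →
    (reb : Coloring n → Coloring n) → RebalanceSpec k reb →
    (init : Coloring n) → Balanced 1ℚ init →
    Σ (OnlineAlg n) λ ONL →
    InClass ONL k α reb init
    × Σ ℚ λ β →
    (σ : List (Fin n)) (off : Vec (Coloring n) (length σ)) → OffValid k α off →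
    expCost ONL init σ ℚ.≤
    ℕtoℚ (c * (k * k) * (⌈log₂ n ⌉ * ⌈log₂ n ⌉)) ℚ.* ℕtoℚ (offCost init (reb init) σ off) ℚ.+ β
theorem3 = constant , λ n 2≤n _ k α k≤α reb spec init init-balanced →
  Construction.rebalanced-online n 2≤n k α k≤α reb spec init init-balanced
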